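{- For any positive integers $k\ge 5$ and $n\ge \frac{k+2}{2}$, the distributive lattice $\mathbf{(n+k)}\times\mathbf{n}$ is not Schur positive; that is, the chromatic symmetric function $X_{\mathrm{inc}(\mathbf{(n+k)}\times\mathbf{n})}$ is not a nonnegative linear combination of Schur functions.
   Context: $\mathbf{m}$ denotes the $m$-element chain $1<2<\cdots<m$, and $\mathbf{m}\times\mathbf{n}$ is the product poset (componentwise order). For a poset $P$, its incomparability graph $\mathrm{inc}(P)$ has vertex set $P$ and an edge between $x\ne y$ whenever $x,y$ are incomparable in $P$. For a graph $G=(V,E)$, Stanley's chromatic symmetric function is $X_G=\sum_\kappa\prod_{v\in V}x_{\kappa(v)}$, summed over all proper colorings $\kappa:V\to\{1,2,\ldots\}$ (i.e. $\kappa(u)\ne\kappa(v)$ whenever $uv\in E$). A poset $P$ is called Schur positive if $X_{\mathrm{inc}(P)}$ has nonnegative coefficients in the Schur function basis $\{s_\lambda\}$. -}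

module Defs where

open import Data.Bool using (Bool; true; false; _∧_; not)
open import Data.Nat as ℕ using (ℕ; zero; suc)
open import Data.Fin as Fin using (Fin; remQuot)
open import Data.Fin.Properties using (_≟_; _≤?_)
open import Data.List using (List; []; _∷_; map; concatMap; length; lookup; allFin; filterᵇ; foldr)
open import Data.List.Relation.Unary.All using (All)
open import Data.List.Relation.Unary.Linked using (Linked)
open import Data.Vec as Vec using (Vec)
open import Data.Product using (_×_; _,_; proj₁; proj₂; Σ)
open import Data.Integer as ℤ using ()
open import Data.Rational as ℚ using (ℚ; 0ℚ; _/_)
open import Relation.Nullary.Decidable using (⌊_⌋)
open import Relation.Binary.PropositionalEquality using (_≡_)

allVecs : {A : Set} → (n : ℕ) → List A → List (Vec A n)
allVecs zero    xs = Vec.[] ∷ []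
allVecs (suc n) xs = concatMap (λ x → map (x Vec.∷_) (allVecs n xs)) xs

allᵇ : {A : Set} → (A → Bool) → List A → Bool
allᵇ p []       = true
allᵇ p (x ∷ xs) = p x ∧ allᵇ p xs

countᵇ : {A : Set} → (A → Bool) → List A → ℕ
countᵇ p xs = length (filterᵇ p xs)

_==ᶠ_ : {m : ℕ} → Fin m → Fin m → Bool
a ==ᶠ b = ⌊ a ≟ b ⌋

_==ℕ_ : ℕ → ℕ → Bool
a ==ℕ b = ⌊ a ℕ.≟ b ⌋

record FinPoset (N : ℕ) : Set where
  field
    leq : Fin N → Fin N → Bool

record FinGraph (N : ℕ) : Set where
  field
    adj : Fin N → Fin N → Bool

inc : {N : ℕ} → FinPoset N → FinGraph N
inc P = record { adj = λ x y → not (x ==ᶠ y) ∧ (not (leq x y) ∧ not (leq y x)) }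
  where open FinPoset P

-- the m-element chain 1 < ... < m is modelled on Fin m with its usual order;
-- the product poset m × n on Fin (m * n), an element x corresponding to the
-- pair remQuot n x : Fin m × Fin n, with the componentwise order
chainProduct : (m n : ℕ) → FinPoset (m ℕ.* n)
chainProduct m n = record { leq = λ x y →
  ⌊ proj₁ (remQuot {m} n x) ≤? proj₁ (remQuot {m} n y) ⌋ ∧
  ⌊ proj₂ (remQuot {m} n x) ≤? proj₂ (remQuot {m} n y) ⌋ }

-- Chromatic symmetric function, via its monomial coefficients.
-- A monomial x_1^{α_1} ⋯ x_r^{α_r} is indexed by a finite list α of
-- exponents (trailing zeros allowed; every monomial occurs this way).

occ : {m N : ℕ} → Fin m → Vec (Fin m) N → ℕ
occ c v = countᵇ (λ d → d ==ᶠ c) (Vec.toList v)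

hasContent : {N : ℕ} (α : List ℕ) → Vec (Fin (length α)) N → Bool
hasContent α κ = allᵇ (λ c → occ c κ ==ℕ lookup α c) (allFin (length α))

properᵇ : {N m : ℕ} → FinGraph N → Vec (Fin m) N → Bool
properᵇ {N} G κ =
  allᵇ (λ x → allᵇ (λ y → not (FinGraph.adj G x y) ∨' not (Vec.lookup κ x ==ᶠ Vec.lookup κ y))
                 (allFin N)) (allFin N)
  where
    _∨'_ : Bool → Bool → Bool
    true  ∨' _ = true
    false ∨' b = b

-- coefficient of x^α in X_G = Σ_κ Π_v x_{κ(v)} : the number of proper
-- colourings κ : V → {1,2,...} with exactly α_i vertices of colour i
-- (such κ only use colours 1..length α, hence are vectors over Fin (length α))
chromCoeff : {N : ℕ} → FinGraph N → List ℕ → ℕ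
chromCoeff {N} G α =
  countᵇ (λ κ → properᵇ G κ ∧ hasContent α κ) (allVecs N (allFin (length α)))

IsPartition : List ℕ → Set
IsPartition λ' = All (λ p → 1 ℕ.≤ p) λ' × Linked ℕ._≥_ λ'

fillings : (m : ℕ) → (λ' : List ℕ) → List (List (List (Fin m)))
fillings m []        = [] ∷ []
fillings m (r ∷ λ') =
  concatMap (λ row → map (row ∷_) (fillings m λ')) (map Vec.toList (allVecs r (allFin m)))

_≤ᶠ_ : {m : ℕ} → Fin m → Fin m → Bool
a ≤ᶠ b = ⌊ a ≤? b ⌋

_<ᶠ_ : {m : ℕ} → Fin m → Fin m → Bool
a <ᶠ b = ⌊ Fin.suc a Data.Fin.Properties.≤? Fin.inject₁ b ⌋

rowOK : {m : ℕ} → List (Fin m) → Bool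
rowOK []            = true
rowOK (a ∷ [])      = true
rowOK (a ∷ b ∷ r)   = (a ≤ᶠ b) ∧ rowOK (b ∷ r)

-- entries of the lower row strictly exceed those directly above
-- (the lower row is not longer than the upper one)
colOK : {m : ℕ} → List (Fin m) → List (Fin m) → Bool
colOK (a ∷ u) (b ∷ l) = (a <ᶠ b) ∧ colOK u l
colOK _       _       = true

isSSYT : {m : ℕ} → List (List (Fin m)) → Bool
isSSYT []            = true
isSSYT (r ∷ [])      = rowOK r
isSSYT (r ∷ s ∷ T)   = rowOK r ∧ (colOK r s ∧ isSSYT (s ∷ T))

concatL : {A : Set} → List (List A) → List A
concatL = foldr Data.List._++_ []

tabContent : (α : List ℕ) → List (List (Fin (length α))) → Bool
tabContent α T = allᵇ (λ c → countᵇ (λ d → d ==ᶠ c) (concatL T) ==ℕ lookup α c)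
                     (allFin (length α))

kostka : List ℕ → List ℕ → ℕ
kostka λ' α = countᵇ (λ T → isSSYT T ∧ tabContent α T) (fillings (length α) λ')

toℚ : ℕ → ℚ
toℚ n = ℤ.+ n / 1

combCoeff : List (List ℕ × ℚ) → List ℕ → ℚ
combCoeff []             α = 0ℚ
combCoeff ((λ' , c) ∷ L) α = (c ℚ.* toℚ (kostka λ' α)) ℚ.+ combCoeff L α

-- X_G is a nonnegative (finite) linear combination of Schur functions:
-- equality of symmetric functions = equality of all monomial coefficients
SchurPositiveGraph : {N : ℕ} → FinGraph N → Set
SchurPositiveGraph G =
  Σ (List (List ℕ × ℚ)) λ L →
    All (λ p → IsPartition (proj₁ p) × (0ℚ ℚ.≤ proj₂ p)) L ×
    ((α : List ℕ) → toℚ (chromCoeff G α) ≡ combCoeff L α)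

SchurPositive : {N : ℕ} → FinPoset N → Set
SchurPositive P = SchurPositiveGraph (inc P)

{-# OPTIONS --safe #-}
-- Write m = n − 1 and a = k − 3. If X is Schur positive, then so is its pairing with the coefficient functional of s_ν,
-- ν = (a,2,2), in three of the variables: with γ the exponents of the remaining m variables and N the coefficient of a
-- monomial, N(2,2,a,γ) − N(3,1,a,γ) − N(2,1,a+1,γ) + N(3,0,a+1,γ) + N(1,1,a+2,γ) − N(2,0,a+2,γ) ≥ 0. For a single Schur
-- function this is an injection between semistandard tableaux that alters one entry of the first two rows.
--
-- The k + 1 middle ranks of the grid are antichains of size n. If three colours are used k + 1 times altogether, the other
-- m colours are chains meeting each rank at most once, so every middle rank contains exactly one vertex of the three
-- colours, and there are no others. Comparing consecutive ranks shows that the m chains appear in the same order in each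
-- of them and that the row of the exceptional vertex weakly decreases; exceptional vertices are comparable iff they share
-- a row. Hence N(b,γ) = D · W(b), where D does not depend on b and W(b) counts the assignments of rows to the three colours
-- together with the words of content b along which these rows decrease. This number is
--   n · multinomial(b) + n (n − 1) · (sum of the binomials of pairs) + n (n − 1) (n − 2),
-- and the alternating sum above becomes negative once k ≥ 5 and 2n ≥ k + 2. Taking for γ the exponents of a partition of the grid
-- into hooks makes D positive.
module Submission where

open import Defs
open import Data.Nat using (ℕ; _+_; _*_; _≤_)
open import Relation.Nullary using (¬_)

open import Data.Bool using (Bool; true; false; T; _∧_)
open import Data.Bool.Properties using (T-∧; T?)
open import Data.Empty using (⊥; ⊥-elim)
open import Data.Fin as Fin using (Fin; zero; suc; toℕ; fromℕ; fromℕ<; cast; combine; remQuot; punchIn; punchOut; _↑ˡ_; _↑ʳ_)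
open import Data.Fin.Induction using (<-weakInduction; >-weakInduction)
open import Data.Fin.Patterns using (0F; 1F; 2F)
import Data.Fin.Properties as Finₚ
open import Data.Integer as ℤ using (+≤+)
import Data.Integer.Properties as ℤₚ
open import Data.List as List using (List; []; _∷_; _++_; length; map; concatMap; filter; filterᵇ; lookup; cartesianProduct; allFin; replicate; applyUpTo)
open import Data.List.Membership.Propositional using (_∈_; find)
open import Data.List.Membership.Propositional.Properties as Mem
  using (∈-map⁺; ∈-map⁻; ∈-++⁺ˡ; ∈-++⁺ʳ; ∈-++⁻; ∈-cartesianProduct⁺; ∈-cartesianProduct⁻; ∈-filter⁺; ∈-filter⁻; ∈-lookup; ∈-allFin; ∈-concatMap⁻)
import Data.List.Properties as Listₚ
open import Data.List.Relation.Unary.All as All using (All; []; _∷_)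
import Data.List.Relation.Unary.All.Properties as Allₚ
open import Data.List.Relation.Unary.AllPairs as AllPairs using (AllPairs; []; _∷_)
import Data.List.Relation.Unary.AllPairs.Properties as AllPairsₚ
open import Data.List.Relation.Unary.Any as Any using (here; there; index)
open import Data.List.Relation.Unary.Any.Properties using (lookup-index)
open import Data.List.Relation.Unary.Linked using (Linked; []; [-]; _∷_)
open import Data.List.Relation.Unary.Unique.Propositional using (Unique)
import Data.List.Relation.Unary.Unique.Propositional.Properties as Uniqueₚ
open import Data.Nat as ℕ using (zero; suc; pred; _∸_; _<_; _⊓_; z≤n; s≤s)
import Data.Nat.Coprimality as Coprime
import Data.Nat.Properties as ℕₚ
open import Data.Nat.Tactic.RingSolver using (solve-∀)
open import Data.Product using (_×_; _,_; proj₁; proj₂; ∃-syntax)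
open import Data.Product.Properties using (≡-dec)
open import Data.Rational as ℚ using (0ℚ; mkℚ; *≤*)
import Data.Rational.Properties as ℚₚ
open import Data.Rational.Solver using (module +-*-Solver)
open import Data.Sum using (_⊎_; inj₁; inj₂; [_,_]′)
open import Data.Unit using (⊤; tt)
open import Data.Vec as Vec using (Vec)
import Data.Vec.Properties as Vecₚ
open import Function using (_∘_; id; _∋_; Equivalence)
open import Relation.Binary using (tri<; tri≈; tri>)
open import Relation.Binary.PropositionalEquality
open import Relation.Nullary using (Dec; yes; no)
open import Relation.Nullary.Decidable using (⌊_⌋; toWitness; fromWitness)

-- The six terms and their signs are the expansion of the Jacobi-Trudi determinant of s_(a,2,2),
-- with each product of three complete symmetric functions h_i h_j h_l replaced by the coefficient
-- with exponents i, j, l. The condition k ≥ 5 says that (a,2,2) is a partition; for k = 4 the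
-- determinant has two equal rows and the sum vanishes. The small exponents go to the smallest
-- letters, so that a tableau has at most three 0s and two 1s, and every cell that changes is near
-- the start of the first two rows. Subtraction is avoided: the negative terms stand on the other
-- side of each inequality. The factor D has to be the same number for all b. It is the number of
-- reference colourings, in which all k + 1 exceptional vertices have colour 0 and lie in the top
-- row. Passing between these and arbitrary colourings repaints the middle ranks only. Properness
-- survives because ranks m and m + k + 2 have m vertices each, one on every chain: any comparison
-- between a vertex beyond the middle ranks and a repainted one passes through a vertex of these two
-- ranks, whose colour is unchanged.

-- Counting

-- A count is carried by an explicit list without repetitions, so that filtered enumerations,
-- products and sums over `Fin n` can all be compared through injections.
record Card {A : Set} (P : A → Set) (N : ℕ) : Set where
  field
    elems    : List A
    unique   : Unique elems
    sound    : ∀ {x} → x ∈ elems → P x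
    complete : ∀ {x} → P x → x ∈ elems
    size     : length elems ≡ N

open Card

private variable
  A B C : Set
  P Q : A → Set
  M N : ℕ

lookup-injective : {xs : List A} → Unique xs → ∀ {i j} → lookup xs i ≡ lookup xs j → i ≡ j
lookup-injective (_ ∷ _) {zero} {zero} _ = refl
lookup-injective {xs = _ ∷ xs} (x∉ ∷ _) {zero} {suc j} eq = ⊥-elim (All.lookup x∉ (∈-lookup {xs = xs} j) eq)
lookup-injective {xs = _ ∷ xs} (x∉ ∷ _) {suc i} {zero} eq = ⊥-elim (All.lookup x∉ (∈-lookup {xs = xs} i) (sym eq))
lookup-injective (_ ∷ u) {suc i} {suc j} eq = cong suc (lookup-injective u eq)

-- `f` receives the proof of `P x` because later injections compute the image from it; injectivity
-- concerns the underlying elements only.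
card-≤ : {P : A → Set} {Q : B → Set} → Card P M → Card Q N → (f : ∀ {x} → P x → B) → (∀ {x} (p : P x) → Q (f p)) →
         (∀ {x y} (p : P x) (q : P y) → f p ≡ f q → x ≡ y) → M ≤ N
card-≤ cP cQ f f-Q f-inj =
  subst₂ _≤_ (size cP) (size cQ) (Finₚ.injective⇒≤ {f = h} h-inj)
  where
  p : ∀ i → _
  p i = sound cP (∈-lookup i)
  ∈Q : ∀ i → f (p i) ∈ elems cQ
  ∈Q i = complete cQ (f-Q (p i))
  h : Fin (length (elems cP)) → Fin (length (elems cQ))
  h i = index (∈Q i)
  h-inj : ∀ {i j} → h i ≡ h j → i ≡ j
  h-inj {i} {j} eq = lookup-injective (unique cP) (f-inj (p i) (p j)
    (trans (lookup-index (∈Q i)) (trans (cong (lookup (elems cQ)) eq) (sym (lookup-index (∈Q j))))))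

card-cong : {P Q : A → Set} → (∀ {x} → P x → Q x) → (∀ {x} → Q x → P x) → Card P N → Card Q N
card-cong to from c = record
  { elems = elems c ; unique = unique c ; sound = to ∘ sound c ; complete = complete c ∘ from ; size = size c }

card-⊥ : (∀ {x} → ¬ P x) → Card P 0
card-⊥ ¬P = record { elems = [] ; unique = [] ; sound = λ () ; complete = ⊥-elim ∘ ¬P ; size = refl }

card-singleton : (x : A) → Card (_≡ x) 1
card-singleton x = record
  { elems = x ∷ [] ; unique = [] ∷ [] ; sound = λ { (here eq) → eq } ; complete = here ; size = refl }

card-⊎ : {P Q : A → Set} → (∀ {x} → P x → ¬ Q x) → Card P M → Card Q N → Card (λ x → P x ⊎ Q x) (M + N)
card-⊎ disjoint cP cQ = record
  { elems    = elems cP ++ elems cQ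
  ; unique   = Uniqueₚ.++⁺ (unique cP) (unique cQ) (λ (p , q) → disjoint (sound cP p) (sound cQ q))
  ; sound    = λ x∈ → Data.Sum.map (sound cP) (sound cQ) (∈-++⁻ (elems cP) x∈)
  ; complete = λ { (inj₁ p) → ∈-++⁺ˡ (complete cP p) ; (inj₂ q) → ∈-++⁺ʳ (elems cP) (complete cQ q) }
  ; size     = trans (Listₚ.length-++ (elems cP)) (cong₂ _+_ (size cP) (size cQ))
  }

length-cartesianProduct : (xs : List A) (ys : List B) → length (cartesianProduct xs ys) ≡ length xs * length ys
length-cartesianProduct []       ys = refl
length-cartesianProduct (x ∷ xs) ys = trans (Listₚ.length-++ (map (x ,_) ys))
  (cong₂ _+_ (Listₚ.length-map (x ,_) ys) (length-cartesianProduct xs ys))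

card-× : {P : A → Set} {Q : B → Set} → Card P M → Card Q N → Card (λ ((x , y) : A × B) → P x × Q y) (M * N)
card-× cP cQ = record
  { elems    = cartesianProduct (elems cP) (elems cQ)
  ; unique   = Uniqueₚ.cartesianProduct⁺ (unique cP) (unique cQ)
  ; sound    = λ x∈ → let p , q = ∈-cartesianProduct⁻ (elems cP) (elems cQ) x∈ in sound cP p , sound cQ q
  ; complete = λ (p , q) → ∈-cartesianProduct⁺ (complete cP p) (complete cQ q)
  ; size     = trans (length-cartesianProduct (elems cP) (elems cQ)) (cong₂ _*_ (size cP) (size cQ))
  }

card-image : {P : A → Set} (f : A → B) → (∀ {x y} → f x ≡ f y → x ≡ y) → Card P N →
             Card (λ y → ∃[ x ] P x × y ≡ f x) N
card-image f f-inj c = record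
  { elems    = map f (elems c)
  ; unique   = Uniqueₚ.map⁺ f-inj (unique c)
  ; sound    = λ y∈ → let x , x∈ , eq = ∈-map⁻ f y∈ in x , sound c x∈ , eq
  ; complete = λ { (x , px , refl) → ∈-map⁺ f (complete c px) }
  ; size     = trans (Listₚ.length-map f (elems c)) (size c)
  }

card-⇔ : {P : A → Set} {Q : B → Set} (f : A → B) → (∀ {x y} → f x ≡ f y → x ≡ y) → (∀ {x} → P x → Q (f x)) →
         (∀ {y} → Q y → ∃[ x ] P x × y ≡ f x) → Card P N → Card Q N
card-⇔ f f-inj to from c = card-cong (λ { (x , px , refl) → to px }) from (card-image f f-inj c)

Σᶠ : ∀ {n} → (Fin n → ℕ) → ℕ
Σᶠ {zero}  h = 0
Σᶠ {suc n} h = h zero + Σᶠ (h ∘ suc)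

card-Σ : ∀ {n} {Q : Fin n → B → Set} {h : Fin n → ℕ} → (∀ i → Card (Q i) (h i)) →
         Card (λ ((i , y) : Fin n × B) → Q i y) (Σᶠ h)
card-Σ {n = zero}  cQ = card-⊥ λ { {() , _} }
card-Σ {n = suc n} cQ = card-cong
  (λ { (inj₁ (_ , q , refl)) → q ; (inj₂ (_ , q , refl)) → q })
  (λ { {zero , y} q → inj₁ (y , q , refl) ; {suc i , y} q → inj₂ ((i , y) , q , refl) })
  (card-⊎ (λ { (_ , _ , refl) (_ , _ , ()) })
    (card-image (zero ,_) (λ { refl → refl }) (cQ zero))
    (card-image (λ (i , y) → suc i , y) (λ { refl → refl }) (card-Σ (λ i → cQ (suc i)))))

card-filter : (p : A → Bool) {xs : List A} → Unique xs → Card (λ x → x ∈ xs × T (p x)) (countᵇ p xs)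
card-filter p {xs} u = record
  { elems    = filterᵇ p xs
  ; unique   = Uniqueₚ.filter⁺ (T? ∘ p) u
  ; sound    = ∈-filter⁻ (T? ∘ p)
  ; complete = λ (x∈ , px) → ∈-filter⁺ (T? ∘ p) x∈ px
  ; size     = refl
  }

card-unique : Card P M → Card P N → M ≡ N
card-unique c d = ℕₚ.≤-antisym
  (card-≤ c d (λ {x} _ → x) id (λ _ _ → id)) (card-≤ d c (λ {x} _ → x) id (λ _ _ → id))

card-allFin : ∀ n → Card (λ (i : Fin n) → ⊤) n
card-allFin n = record
  { elems = allFin n ; unique = Uniqueₚ.allFin⁺ n ; sound = λ _ → tt ; complete = λ _ → ∈-allFin _ ; size = Listₚ.length-tabulate id }

-- A missed `x` would join the `n` distinct values of `f` and give `suc n` elements of a set of size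
-- `n`.
card-onto : ∀ {n} {P : A → Set} → (∀ x y → Dec (x ≡ y)) → Card P n → (f : Fin n → A) → (∀ i → P (f i)) →
            (∀ {i j} → f i ≡ f j → i ≡ j) → ∀ {x} → P x → ∃[ i ] f i ≡ x
card-onto {n = n} _≟_ c f f-P f-inj {x} px with Finₚ.any? (λ i → f i ≟ x)
... | yes found = found
... | no  none  = ⊥-elim (ℕₚ.1+n≰n (card-≤ (card-allFin (suc n)) c (λ {i} _ → h i) (λ {i} _ → h-P i) (λ {i} {j} _ _ → h-inj i j)))
  where
  h : Fin (suc n) → _
  h zero    = x
  h (suc i) = f i
  h-P : ∀ i → _
  h-P zero    = px
  h-P (suc i) = f-P i
  h-inj : ∀ i j → h i ≡ h j → i ≡ j
  h-inj zero    zero    _  = refl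
  h-inj zero    (suc j) eq = ⊥-elim (none (j , sym eq))
  h-inj (suc i) zero    eq = ⊥-elim (none (i , eq))
  h-inj (suc i) (suc j) eq = cong suc (f-inj eq)

-- Enumerations of colourings and fillings without repetition

∈-concatMap⁺ : {f : A → List B} {x : A} {y : B} {xs : List A} → x ∈ xs → y ∈ f x → y ∈ concatMap f xs
∈-concatMap⁺ {f = f} x∈ y∈ = Mem.∈-concatMap⁺ f (Any.map (λ { refl → y∈ }) x∈)

unique-concatMap : {f : A → List B} {xs : List A} → Unique xs → (∀ x → Unique (f x)) →
                   (∀ {x x' y} → y ∈ f x → y ∈ f x' → x ≡ x') → Unique (concatMap f xs)
unique-concatMap [] _ _ = []
unique-concatMap {f = f} {x ∷ xs} (x∉ ∷ u) uf disjoint =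
  Uniqueₚ.++⁺ (uf x) (unique-concatMap u uf disjoint) λ (y∈ , y∈') →
    let x' , x'∈ , y∈fx' = find (∈-concatMap⁻ f {xs = xs} y∈') in All.lookup x∉ x'∈ (disjoint y∈ y∈fx')

unique-map-∷ : {ys : List B} {D : Set} {_∙_ : A → B → D} → (∀ {x x' y y'} → x ∙ y ≡ x' ∙ y' → x ≡ x' × y ≡ y') →
               {xs : List A} → Unique xs → Unique ys → Unique (concatMap (λ x → map (x ∙_) ys) xs)
unique-map-∷ inj ux uy = unique-concatMap ux (λ x → Uniqueₚ.map⁺ (proj₂ ∘ inj) uy)
  λ y∈ y∈' → let _ , _ , eq = ∈-map⁻ _ y∈ ; _ , _ , eq' = ∈-map⁻ _ y∈' in proj₁ (inj (trans (sym eq) eq'))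

unique-allVecs : ∀ n {xs : List A} → Unique xs → Unique (allVecs n xs)
unique-allVecs zero    u = [] ∷ []
unique-allVecs (suc n) u = unique-map-∷ Vecₚ.∷-injective u (unique-allVecs n u)

∈-allVecs : ∀ {n} {xs : List A} → (∀ x → x ∈ xs) → (v : Vec A n) → v ∈ allVecs n xs
∈-allVecs all Vec.[]      = here refl
∈-allVecs all (x Vec.∷ v) = ∈-concatMap⁺ (all x) (∈-map⁺ _ (∈-allVecs all v))

rows : ∀ m r → List (List (Fin m))
rows m r = map Vec.toList (allVecs r (allFin m))

unique-rows : ∀ m r → Unique (rows m r)
unique-rows m r = Uniqueₚ.map⁺ (λ {v} {w} eq → trans (sym (Vecₚ.cast-is-id refl v)) (Vecₚ.toList-injective refl v w eq))
  (unique-allVecs r (Uniqueₚ.allFin⁺ m))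

unique-fillings : ∀ m λ' → Unique (fillings m λ')
unique-fillings m []       = [] ∷ []
unique-fillings m (r ∷ λ') = unique-map-∷ Listₚ.∷-injective (unique-rows m r) (unique-fillings m λ')

∈-fillings⁺ : ∀ {m} (T : List (List (Fin m))) → T ∈ fillings m (map length T)
∈-fillings⁺ []      = here refl
∈-fillings⁺ (r ∷ T) = ∈-concatMap⁺ (subst (_∈ rows _ (length r)) (Vecₚ.toList∘fromList r)
  (∈-map⁺ Vec.toList (∈-allVecs ∈-allFin (Vec.fromList r)))) (∈-map⁺ _ (∈-fillings⁺ T))

∈-fillings⁻ : ∀ {m} λ' {T : List (List (Fin m))} → T ∈ fillings m λ' → map length T ≡ λ'
∈-fillings⁻ []       (here refl) = refl
∈-fillings⁻ {m} (r ∷ λ') T∈ with find (∈-concatMap⁻ _ {xs = rows m r} T∈)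
... | row , row∈ , T∈' with ∈-map⁻ Vec.toList row∈ | ∈-map⁻ _ T∈'
... | v , _ , refl | T' , T'∈ , refl = cong₂ _∷_ (Vecₚ.length-toList v) (∈-fillings⁻ λ' T'∈)

-- Kostka numbers

∧⁻ : ∀ {a b} → T (a ∧ b) → T a × T b
∧⁻ = Equivalence.to T-∧

∧⁺ : ∀ {a b} → T a → T b → T (a ∧ b)
∧⁺ p q = Equivalence.from T-∧ (p , q)

allᵇ⁻ : {A : Set} (p : A → Bool) {xs : List A} → T (allᵇ p xs) → ∀ {x} → x ∈ xs → T (p x)
allᵇ⁻ p {_ ∷ _} h (here refl) = proj₁ (∧⁻ h)
allᵇ⁻ p {y ∷ _} h (there x∈)  = allᵇ⁻ p (proj₂ (∧⁻ {p y} h)) x∈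

allᵇ⁺ : {A : Set} (p : A → Bool) (xs : List A) → (∀ x → T (p x)) → T (allᵇ p xs)
allᵇ⁺ p []       h = tt
allᵇ⁺ p (x ∷ xs) h = ∧⁺ (h x) (allᵇ⁺ p xs h)

allFinᵇ⁻ : ∀ {n} (p : Fin n → Bool) → T (allᵇ p (allFin n)) → ∀ i → T (p i)
allFinᵇ⁻ p h i = allᵇ⁻ p h (∈-allFin i)

==ℕ⁻ : ∀ {a b} → T (a ==ℕ b) → a ≡ b
==ℕ⁻ = toWitness

==ℕ⁺ : ∀ {a b} → a ≡ b → T (a ==ℕ b)
==ℕ⁺ = fromWitness

private variable
  n : ℕ

# : Fin n → List (Fin n) → ℕ
# c = countᵇ (_==ᶠ c)

Tableau : ℕ → Set
Tableau n = List (List (Fin n))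

-- All pairs instead of adjacent ones: after one entry has changed, the surviving comparisons can be
-- reused as they stand.
Increasing : List (Fin n) → Set
Increasing = AllPairs Fin._≤_

Above : List (Fin n) → List (Fin n) → Set
Above (a ∷ u) (b ∷ l) = a Fin.< b × Above u l
Above _       _       = ⊤

SSYT : Tableau n → Set
SSYT []          = ⊤
SSYT (r ∷ [])    = Increasing r
SSYT (r ∷ s ∷ U) = Increasing r × Above r s × SSYT (s ∷ U)

≤ᶠ⁻ : {a b : Fin n} → T (a ≤ᶠ b) → a Fin.≤ b
≤ᶠ⁻ = toWitness

<ᶠ⁻ : {a b : Fin n} → T (a <ᶠ b) → a Fin.< b
<ᶠ⁻ {a = a} {b} h = subst (suc (toℕ a) ≤_) (Finₚ.toℕ-inject₁ b) (toWitness h)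

<ᶠ⁺ : {a b : Fin n} → a Fin.< b → T (a <ᶠ b)
<ᶠ⁺ {a = a} {b} h = fromWitness (subst (suc (toℕ a) ≤_) (sym (Finₚ.toℕ-inject₁ b)) h)

rowOK⁻ : (r : List (Fin n)) → T (rowOK r) → Increasing r
rowOK⁻ []          h = []
rowOK⁻ (a ∷ [])    h = [] ∷ []
rowOK⁻ (a ∷ b ∷ r) h =
  let a≤b , h' = ∧⁻ {a ≤ᶠ b} h
      inc      = rowOK⁻ (b ∷ r) h'
  in (≤ᶠ⁻ {a = a} a≤b ∷ All.map (Finₚ.≤-trans (≤ᶠ⁻ {a = a} a≤b)) (head≤ inc)) ∷ inc
  where
  head≤ : ∀ {x : Fin _} {xs} → Increasing (x ∷ xs) → All (x Fin.≤_) xs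
  head≤ (p ∷ _) = p

rowOK⁺ : {r : List (Fin n)} → Increasing r → T (rowOK r)
rowOK⁺ []                            = tt
rowOK⁺ (_ ∷ [])                      = tt
rowOK⁺ ((a≤b ∷ _) ∷ inc@(_ ∷ _))     = ∧⁺ (fromWitness a≤b) (rowOK⁺ inc)

colOK⁻ : (u l : List (Fin n)) → T (colOK u l) → Above u l
colOK⁻ (a ∷ u) (b ∷ l) h = let a<b , h' = ∧⁻ {a <ᶠ b} h in <ᶠ⁻ {a = a} a<b , colOK⁻ u l h'
colOK⁻ []      _       h = tt
colOK⁻ (_ ∷ _) []      h = tt

colOK⁺ : (u l : List (Fin n)) → Above u l → T (colOK u l)
colOK⁺ (a ∷ u) (b ∷ l) (a<b , h) = ∧⁺ {a <ᶠ b} (<ᶠ⁺ {a = a} a<b) (colOK⁺ u l h)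
colOK⁺ []      _       h = tt
colOK⁺ (_ ∷ _) []      h = tt

isSSYT⁻ : (U : Tableau n) → T (isSSYT U) → SSYT U
isSSYT⁻ []          h = tt
isSSYT⁻ (r ∷ [])    h = rowOK⁻ r h
isSSYT⁻ (r ∷ s ∷ U) h = let p , h' = ∧⁻ {rowOK r} h ; q , h'' = ∧⁻ {colOK r s} h' in
  rowOK⁻ r p , colOK⁻ r s q , isSSYT⁻ (s ∷ U) h''

isSSYT⁺ : (U : Tableau n) → SSYT U → T (isSSYT U)
isSSYT⁺ []          h = tt
isSSYT⁺ (r ∷ [])    h = rowOK⁺ h
isSSYT⁺ (r ∷ s ∷ U) (p , q , h) = ∧⁺ (rowOK⁺ p) (∧⁺ {colOK r s} (colOK⁺ r s q) (isSSYT⁺ (s ∷ U) h))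

record IsTableau (λ' α : List ℕ) (U : Tableau (length α)) : Set where
  constructor mkTableau
  field
    shape   : map length U ≡ λ'
    ssyt    : SSYT U
    content : ∀ c → # c (concatL U) ≡ lookup α c

card-kostka : ∀ λ' α → Card (IsTableau λ' α) (kostka λ' α)
card-kostka λ' α = card-cong
  (λ { {U} (U∈ , h) → let p , q = ∧⁻ {isSSYT U} h in
       mkTableau (∈-fillings⁻ λ' U∈) (isSSYT⁻ U p) (λ c → ==ℕ⁻ (allFinᵇ⁻ _ q c)) })
  (λ { {U} (mkTableau refl p q) → ∈-fillings⁺ U , ∧⁺ (isSSYT⁺ U p) (allᵇ⁺ _ (allFin _) (λ c → ==ℕ⁺ (q c))) })
  (card-filter (λ U → isSSYT U ∧ tabContent α U) (unique-fillings (length α) λ'))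

#-++ : (c : Fin n) (xs ys : List (Fin n)) → # c (xs ++ ys) ≡ # c xs + # c ys
#-++ c xs ys = trans (cong length (Listₚ.filter-++ _ xs ys)) (Listₚ.length-++ (filter _ xs))

#-< : {c : Fin n} {xs : List (Fin n)} → All (c Fin.<_) xs → # c xs ≡ 0
#-< {c = c} c< = cong length (Listₚ.filter-none _ (All.map (λ { {x} c<x h → Finₚ.<⇒≢ c<x (sym (toWitness h)) }) c<))

at-least : ℕ → List (Fin n) → Set
at-least i = All (λ e → i ≤ toℕ e)

above-at-least : ∀ {i} (u l : List (Fin n)) → length l ≤ length u → Above u l → at-least i u → at-least (suc i) l
above-at-least _       []      _         _           _        = []
above-at-least (a ∷ u) (b ∷ l) (s≤s len) (a<b , h) (i≤a ∷ p) = ℕₚ.≤-trans (s≤s i≤a) a<b ∷ above-at-least u l len h p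

-- Each row is no longer than the one above it and columns increase strictly, so the lower bound
-- rises going down. Hence 0 occurs in the first row only and 1 in the first two rows only.
rows-at-least : ∀ {i} (r : List (Fin n)) (U : Tableau n) → Linked ℕ._≥_ (map length (r ∷ U)) → SSYT (r ∷ U) →
                at-least i r → at-least (suc i) (concatL U)
rows-at-least r []      _         _           _ = []
rows-at-least {i = i} r (s ∷ U) (len ∷ link) (_ , h , ss) p = Allₚ.++⁺ s≥
  (All.map (ℕₚ.≤-trans (ℕₚ.n≤1+n _)) (rows-at-least s U link ss s≥))
  where
  s≥ = above-at-least r s len h p

leading-zeros : ∀ x (r : List (Fin (suc n))) → Increasing r → # zero r ≡ x → ∃[ R ] r ≡ replicate x zero ++ R × at-least 1 R
leading-zeros zero    []          _          _  = [] , refl , []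
leading-zeros (suc x) (zero ∷ r)  (_ ∷ inc)  eq =
  let R , r≡ , R≥ = leading-zeros x r inc (ℕₚ.suc-injective eq) in R , cong (zero ∷_) r≡ , R≥
leading-zeros x       (suc e ∷ r) (e≤ ∷ inc) eq with trans (sym (#-< {c = zero} (All.map (ℕₚ.≤-trans (s≤s z≤n)) e≤))) eq
... | refl = suc e ∷ r , refl , s≤s z≤n ∷ All.map (ℕₚ.≤-trans (s≤s z≤n)) e≤

leading-one : (R : List (Fin (suc (suc n)))) → Increasing R → at-least 1 R → (∃[ R' ] R ≡ 1F ∷ R') ⊎ at-least 2 R
leading-one []                _         _         = inj₂ []
leading-one (zero ∷ _)        _         (() ∷ _)
leading-one (1F ∷ R')         _         _         = inj₁ (R' , refl)
leading-one (suc (suc _) ∷ _) (e≤ ∷ _)  _         = inj₂ (s≤s (s≤s z≤n) ∷ All.map (ℕₚ.≤-trans (s≤s (s≤s z≤n))) e≤)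

-- The contents (of the letters 0, 1, 2) before and after a move are
--   (3,1,a) → (2,2,a), (2,0,a+2) → (1,1,a+2), (2,1,a+1) → (3,0,a+1), (2,1,a+1) → (2,2,a), (2,1,a+1) → (1,1,a+2);
-- the last two apply when the letter 1 lies in the second row, move₄ if it is followed by a 2 there and move₅ otherwise.
data Move {n : ℕ} : Tableau (3 + n) → Tableau (3 + n) → Set where
  move₁ : ∀ {R U}   → Move ((0F ∷ 0F ∷ 0F ∷ R) ∷ U) ((0F ∷ 0F ∷ 1F ∷ R) ∷ U)
  move₂ : ∀ {R U}   → Move ((0F ∷ 0F ∷ R) ∷ U) ((0F ∷ 1F ∷ R) ∷ U)
  move₃ : ∀ {R U}   → Move ((0F ∷ 0F ∷ 1F ∷ R) ∷ U) ((0F ∷ 0F ∷ 0F ∷ R) ∷ U)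
  move₄ : ∀ {R S U} → at-least 2 R → Move ((0F ∷ 0F ∷ R) ∷ (1F ∷ 2F ∷ S) ∷ U) ((0F ∷ 0F ∷ R) ∷ (1F ∷ 1F ∷ S) ∷ U)
  move₅ : ∀ {R S U} → Move ((0F ∷ 0F ∷ R) ∷ (1F ∷ S) ∷ U) ((0F ∷ 2F ∷ R) ∷ (1F ∷ S) ∷ U)

-- The result reveals the move: the first row begins with 001, 01, 000 or 02 after the moves 1, 2, 3
-- and 5, and `at-least 2 R` keeps the result 00R of `move₄` away from 001 and 000.
move-injective : ∀ {U U' V : Tableau (3 + n)} → Move U V → Move U' V → U ≡ U'
move-injective move₁ move₁ = refl
move-injective move₁ (move₄ (s≤s () ∷ _))
move-injective move₂ move₂ = refl
move-injective move₃ move₃ = refl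
move-injective move₃ (move₄ (() ∷ _))
move-injective (move₄ (s≤s () ∷ _)) move₁
move-injective (move₄ (() ∷ _)) move₃
move-injective (move₄ _) (move₄ _) = refl
move-injective move₅ move₅ = refl

first-row : ∀ {λ' x α} {U : Tableau (length (suc x ∷ α))} → IsPartition λ' → IsTableau λ' (suc x ∷ α) U →
            ∃[ R ] ∃[ V ] U ≡ (replicate (suc x) zero ++ R) ∷ V × at-least 1 R × at-least 1 (concatL V)
first-row {U = []} _ (mkTableau _ _ content) with () ← content zero
first-row {x = x} {U = r ∷ V} (_ , link) (mkTableau refl ss content) =
  let R , eq , R≥ = leading-zeros (suc x) r (increasing ss) #r in R , V , cong (_∷ V) eq , R≥ , V≥
  where
  increasing : ∀ {V} → SSYT (r ∷ V) → Increasing r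
  increasing {[]}    p = p
  increasing {_ ∷ _} p = proj₁ p
  V≥ = rows-at-least r V link ss (All.universal (λ _ → z≤n) r)
  #r : # zero r ≡ suc x
  #r = trans (sym (trans (#-++ zero r (concatL V)) (trans (cong (# zero r +_) (#-< V≥)) (ℕₚ.+-identityʳ _)))) (content zero)
at-least-2 : {xs : List (Fin (2 + n))} → at-least 1 xs → # 1F xs ≡ 0 → at-least 2 xs
at-least-2 []                          _  = []
at-least-2 {xs = suc (suc _) ∷ _} (_ ∷ p) eq = s≤s (s≤s z≤n) ∷ at-least-2 p eq

#-middle : (c : Fin n) (xs ys zs : List (Fin n)) → # c (xs ++ ys ++ zs) ≡ # c ys + (# c xs + # c zs)
#-middle c xs ys zs = trans (#-++ c xs (ys ++ zs)) (trans (cong (# c xs +_) (#-++ c ys zs))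
  (trans (sym (ℕₚ.+-assoc (# c xs) _ _)) (trans (cong (_+ # c zs) (ℕₚ.+-comm (# c xs) _)) (ℕₚ.+-assoc (# c ys) _ _))))

-- A 1 in the third cell would force 1s in the first two. So with a single 1 in the tableau, the
-- third entry of the second row exceeds the 1 that `move₁` writes above it.
at-least-2-beyond : ∀ (e f g : Fin (2 + n)) {s} → Increasing (e ∷ f ∷ g ∷ s) → at-least 1 (e ∷ f ∷ g ∷ s) →
                    # 1F (e ∷ f ∷ g ∷ s) ≤ 1 → 2 ≤ toℕ g
at-least-2-beyond _             _             (suc (suc _)) _ _ _ = s≤s (s≤s z≤n)
at-least-2-beyond 1F            1F            1F _ _ (s≤s ())
at-least-2-beyond zero          _             1F _ (() ∷ _) _
at-least-2-beyond (suc (suc _)) _             1F ((_ ∷ s≤s () ∷ _) ∷ _) _ _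
at-least-2-beyond _             zero          1F _ (_ ∷ () ∷ _) _
at-least-2-beyond _             (suc (suc _)) 1F (_ ∷ (s≤s () ∷ _) ∷ _) _ _
at-least-2-beyond _             _             zero _ (_ ∷ _ ∷ () ∷ _) _

module _ {λ' : List ℕ} (λ'-partition : IsPartition λ') {a : ℕ} {γ : List ℕ} where

  private
    Tab : ℕ → ℕ → ℕ → Tableau (3 + length γ) → Set
    Tab x y z = IsTableau λ' (x ∷ y ∷ z ∷ γ)

    Target : Tableau (3 + length γ) → (Tableau (3 + length γ) → Set) → Set
    Target U P = ∃[ V ] Move U V × P V

  step₁ : ∀ {U} → Tab 3 1 a U → Target U (Tab 2 2 a)
  step₁ t with first-row λ'-partition t
  step₁ (mkTableau shape ss content) | R , W , refl , R≥ , W≥ = (0F ∷ 0F ∷ 1F ∷ R) ∷ W , move₁ , mkTableau shape (ssyt' W ss W≥ one) content'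
    where
    one : # 1F R + # 1F (concatL W) ≡ 1
    one = trans (sym (#-++ 1F R (concatL W))) (content 1F)

    zeros : # 0F (R ++ concatL W) ≡ 0
    zeros = ℕₚ.suc-injective (ℕₚ.suc-injective (ℕₚ.suc-injective (content 0F)))

    content' : ∀ c → # c (0F ∷ 0F ∷ 1F ∷ R ++ concatL W) ≡ lookup (2 ∷ 2 ∷ a ∷ γ) c
    content' 0F = cong (2 +_) zeros
    content' 1F = cong suc (content 1F)
    content' 2F = content 2F
    content' (suc (suc (suc i))) = content (suc (suc (suc i)))

    row : Increasing (0F ∷ 0F ∷ 0F ∷ R) → Increasing (0F ∷ 0F ∷ 1F ∷ R)
    row ((_ ∷ _ ∷ p) ∷ (_ ∷ q) ∷ (_ ∷ inc)) = (z≤n ∷ z≤n ∷ p) ∷ (z≤n ∷ q) ∷ (R≥ ∷ inc)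

    above : ∀ s → Increasing s → at-least 1 s → # 1F s ≤ 1 → Above (0F ∷ 0F ∷ 0F ∷ R) s → Above (0F ∷ 0F ∷ 1F ∷ R) s
    above []              _ _ _ _ = tt
    above (e ∷ [])        _ _ _ h = h
    above (e ∷ f ∷ [])    _ _ _ h = h
    above (e ∷ f ∷ g ∷ s) inc p o (h₁ , h₂ , _ , h) = h₁ , h₂ , at-least-2-beyond e f g inc p o , h

    increasing : ∀ s V → SSYT (s ∷ V) → Increasing s
    increasing s []      p = p
    increasing s (_ ∷ _) p = proj₁ p

    ssyt' : ∀ W → SSYT ((0F ∷ 0F ∷ 0F ∷ R) ∷ W) → at-least 1 (concatL W) → # 1F R + # 1F (concatL W) ≡ 1 → SSYT ((0F ∷ 0F ∷ 1F ∷ R) ∷ W)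
    ssyt' []      p _ _ = row p
    ssyt' (s ∷ W) (p , q , ss) W≥ eq = row p , above s (increasing s W ss) (Allₚ.++⁻ˡ s W≥) o q , ss
      where
      o : # 1F s ≤ 1
      o = ℕₚ.≤-trans (ℕₚ.m≤m+n _ (# 1F (concatL W)))
            (ℕₚ.≤-trans (ℕₚ.≤-reflexive (sym (#-++ 1F s (concatL W)))) (ℕₚ.≤-trans (ℕₚ.m≤n+m _ (# 1F R)) (ℕₚ.≤-reflexive eq)))

  -- Without the letter 1 every entry below the first row is at least 2, so the second 0 may become
  -- a 1.
  step₂ : ∀ {U} → Tab 2 0 (2 + a) U → Target U (Tab 1 1 (2 + a))
  step₂ t with first-row λ'-partition t
  step₂ (mkTableau shape ss content) | R , W , refl , R≥ , W≥ = (0F ∷ 1F ∷ R) ∷ W , move₂ , mkTableau shape (ssyt' W ss W≥ no-one) content'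
    where
    no-one : # 1F (concatL W) ≡ 0
    no-one = ℕₚ.m+n≡0⇒n≡0 (# 1F R) (trans (sym (#-++ 1F R (concatL W))) (content 1F))

    content' : ∀ c → # c (0F ∷ 1F ∷ R ++ concatL W) ≡ lookup (1 ∷ 1 ∷ 2 + a ∷ γ) c
    content' 0F = ℕₚ.suc-injective (content 0F)
    content' 1F = cong suc (content 1F)
    content' 2F = content 2F
    content' (suc (suc (suc i))) = content (suc (suc (suc i)))

    row : Increasing (0F ∷ 0F ∷ R) → Increasing (0F ∷ 1F ∷ R)
    row ((_ ∷ p) ∷ (_ ∷ inc)) = (z≤n ∷ p) ∷ (R≥ ∷ inc)

    above : ∀ s → at-least 2 s → Above (0F ∷ 0F ∷ R) s → Above (0F ∷ 1F ∷ R) s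
    above []          _           _ = tt
    above (e ∷ [])    _           h = h
    above (e ∷ f ∷ s) (_ ∷ p ∷ _) (h₁ , _ , h) = h₁ , p , h

    ssyt' : ∀ W → SSYT ((0F ∷ 0F ∷ R) ∷ W) → at-least 1 (concatL W) → # 1F (concatL W) ≡ 0 → SSYT ((0F ∷ 1F ∷ R) ∷ W)
    ssyt' []      p _ _ = row p
    ssyt' (s ∷ W) (p , q , ss) W≥ eq = row p , above s (Allₚ.++⁻ˡ s (at-least-2 W≥ eq)) q , ss

  Result₃ : Tableau (3 + length γ) → Set
  Result₃ V = Tab 2 2 a V ⊎ Tab 3 0 (1 + a) V ⊎ Tab 1 1 (2 + a) V

  -- The only 1 lies in the first row or opens the second. In the first case it becomes a 0. In the
  -- second, a 2 that follows it becomes a 1; otherwise the next cell of the second row is absent or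
  -- exceeds 2, and the second 0 of the first row may become a 2.
  step₃ : ∀ {U} → Tab 2 1 (1 + a) U → Target U Result₃
  step₃ t with first-row λ'-partition t
  step₃ (mkTableau shape ss content) | R , W , refl , R≥ , W≥ with leading-one R (incR W ss) R≥
    where
    incR : ∀ W → SSYT ((0F ∷ 0F ∷ R) ∷ W) → Increasing R
    incR []      (_ ∷ _ ∷ p) = p
    incR (_ ∷ _) ((_ ∷ _ ∷ p) , _) = p
  ... | inj₁ (R' , refl) = (0F ∷ 0F ∷ 0F ∷ R') ∷ W , move₃ , inj₂ (inj₁ (mkTableau shape (ssyt' W ss) content'))
    where
    content' : ∀ c → # c (0F ∷ 0F ∷ 0F ∷ R' ++ concatL W) ≡ lookup (3 ∷ 0 ∷ 1 + a ∷ γ) c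
    content' 0F = cong suc (content 0F)
    content' 1F = ℕₚ.suc-injective (content 1F)
    content' 2F = content 2F
    content' (suc (suc (suc i))) = content (suc (suc (suc i)))

    row : Increasing (0F ∷ 0F ∷ 1F ∷ R') → Increasing (0F ∷ 0F ∷ 0F ∷ R')
    row ((_ ∷ _ ∷ p) ∷ (_ ∷ q) ∷ (_ ∷ inc)) = (z≤n ∷ z≤n ∷ p) ∷ (z≤n ∷ q) ∷ (All.map (λ _ → z≤n) p ∷ inc)

    above : ∀ s → Above (0F ∷ 0F ∷ 1F ∷ R') s → Above (0F ∷ 0F ∷ 0F ∷ R') s
    above []              _ = tt
    above (e ∷ [])        h = h
    above (e ∷ f ∷ [])    h = h
    above (e ∷ f ∷ g ∷ s) (h₁ , h₂ , h₃ , h) = h₁ , h₂ , ℕₚ.≤-trans (s≤s z≤n) h₃ , h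

    ssyt' : ∀ W → SSYT ((0F ∷ 0F ∷ 1F ∷ R') ∷ W) → SSYT ((0F ∷ 0F ∷ 0F ∷ R') ∷ W)
    ssyt' []      p            = row p
    ssyt' (s ∷ W) (p , q , ss) = row p , above s q , ss
  ... | inj₂ R≥2 = below W shape ss content W≥
    where
    one : ∀ W → # 1F (R ++ concatL W) ≡ 1 → # 1F (concatL W) ≡ 1
    one W eq = trans (sym (cong (_+ # 1F (concatL W)) (#-< {c = 1F} R≥2))) (trans (sym (#-++ 1F R (concatL W))) eq)

    below : ∀ W → map length ((0F ∷ 0F ∷ R) ∷ W) ≡ λ' → SSYT ((0F ∷ 0F ∷ R) ∷ W) →
            (∀ c → # c (0F ∷ 0F ∷ R ++ concatL W) ≡ lookup (2 ∷ 1 ∷ 1 + a ∷ γ) c) → at-least 1 (concatL W) →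
            Target ((0F ∷ 0F ∷ R) ∷ W) Result₃
    below [] _ _ content _ with () ← one [] (content 1F)
    below (s ∷ W) refl (p , q , ss) content W≥ with leading-one s (increasing s W ss) (Allₚ.++⁻ˡ s W≥)
      where
      increasing : ∀ s V → SSYT (s ∷ V) → Increasing s
      increasing s []      p = p
      increasing s (_ ∷ _) p = proj₁ p
    -- The rows below the second have entries at least 2, so the 1 would be nowhere.
    ... | inj₂ s≥2 = ⊥-elim (ℕₚ.0≢1+n (trans (sym (#-< {c = 1F} (Allₚ.++⁺ s≥2 rest≥2))) (one (s ∷ W) (content 1F))))
      where rest≥2 = rows-at-least s W (linked (proj₂ λ'-partition)) ss (Allₚ.++⁻ˡ s W≥)
              where
              linked : ∀ {k ks} → Linked ℕ._≥_ (k ∷ ks) → Linked ℕ._≥_ ks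
              linked (_ ∷ l) = l
              linked [-] = []
    ... | inj₁ (s' , refl) = lower s' (at-least-2 (tail (Allₚ.++⁻ˡ s W≥)) no-one) refl
      where
      tail : ∀ {x : Fin (3 + length γ)} {xs} → at-least 1 (x ∷ xs) → at-least 1 xs
      tail (_ ∷ p) = p

      no-one : # 1F s' ≡ 0
      no-one = ℕₚ.m+n≡0⇒m≡0 (# 1F s') (trans (sym (#-++ 1F s' (concatL W))) (ℕₚ.suc-injective (one (s ∷ W) (content 1F))))

      row : Increasing (0F ∷ 0F ∷ R) → Increasing (0F ∷ 2F ∷ R)
      row ((_ ∷ p) ∷ (_ ∷ inc)) = (z≤n ∷ p) ∷ (R≥2 ∷ inc)

      content' : ∀ c → # c (0F ∷ 2F ∷ R ++ (1F ∷ s') ++ concatL W) ≡ lookup (1 ∷ 1 ∷ 2 + a ∷ γ) c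
      content' 0F = ℕₚ.suc-injective (content 0F)
      content' 1F = content 1F
      content' 2F = cong suc (content 2F)
      content' (suc (suc (suc i))) = content (suc (suc (suc i)))

      lower : ∀ s'' → at-least 2 s'' → s' ≡ s'' → Target ((0F ∷ 0F ∷ R) ∷ (1F ∷ s') ∷ W) Result₃
      lower (2F ∷ s₃) (_ ∷ s₃≥2) refl = (0F ∷ 0F ∷ R) ∷ (1F ∷ 1F ∷ s₃) ∷ W , move₄ R≥2 , inj₁ (mkTableau refl (p , above q , ssyt' W ss) content'')
        where
        above : Above (0F ∷ 0F ∷ R) (1F ∷ 2F ∷ s₃) → Above (0F ∷ 0F ∷ R) (1F ∷ 1F ∷ s₃)
        above (h₁ , h₂ , h) = h₁ , s≤s z≤n , h

        above' : ∀ s → Above (1F ∷ 2F ∷ s₃) s → Above (1F ∷ 1F ∷ s₃) s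
        above' []          _ = tt
        above' (e ∷ [])    h = h
        above' (e ∷ f ∷ s) (h₁ , h₂ , h) = h₁ , ℕₚ.≤-trans (ℕₚ.n≤1+n _) h₂ , h

        row' : Increasing (1F ∷ 2F ∷ s₃) → Increasing (1F ∷ 1F ∷ s₃)
        row' ((_ ∷ p) ∷ (q ∷ inc)) = (s≤s z≤n ∷ p) ∷ (p ∷ inc)

        ssyt' : ∀ W → SSYT ((1F ∷ 2F ∷ s₃) ∷ W) → SSYT ((1F ∷ 1F ∷ s₃) ∷ W)
        ssyt' []      p            = row' p
        ssyt' (s ∷ W) (p , q , ss) = row' p , above' s q , ss

        content'' : ∀ c → # c (0F ∷ 0F ∷ R ++ (1F ∷ 1F ∷ s₃) ++ concatL W) ≡ lookup (2 ∷ 2 ∷ a ∷ γ) c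
        content'' 0F = trans (cong (2 +_) (trans (#-middle 0F R (1F ∷ 1F ∷ s₃) (concatL W)) (sym (#-middle 0F R (1F ∷ 2F ∷ s₃) (concatL W))))) (content 0F)
        content'' 1F = trans (#-middle 1F R (1F ∷ 1F ∷ s₃) (concatL W))
          (cong suc (trans (sym (#-middle 1F R (1F ∷ 2F ∷ s₃) (concatL W))) (content 1F)))
        content'' 2F = trans (#-middle 2F R (1F ∷ 1F ∷ s₃) (concatL W))
          (ℕₚ.suc-injective (trans (sym (#-middle 2F R (1F ∷ 2F ∷ s₃) (concatL W))) (content 2F)))
        content'' c@(suc (suc (suc i))) = trans (trans (#-middle c R (1F ∷ 1F ∷ s₃) (concatL W)) (sym (#-middle c R (1F ∷ 2F ∷ s₃) (concatL W)))) (content c)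
      lower (1F ∷ _)  (s≤s () ∷ _)     _
      lower []                       _ refl = (0F ∷ 2F ∷ R) ∷ (1F ∷ []) ∷ W , move₅ , inj₂ (inj₂ (mkTableau refl (row p , (s≤s z≤n , tt) , ss) content'))
      lower (suc (suc (suc e)) ∷ s₃) _ refl = (0F ∷ 2F ∷ R) ∷ (1F ∷ suc (suc (suc e)) ∷ s₃) ∷ W , move₅ ,
        inj₂ (inj₂ (mkTableau refl (row p , (s≤s z≤n , s≤s (s≤s (s≤s z≤n)) , proj₂ (proj₂ q)) , ss) content'))

  -- This is the nonnegativity of the alternating sum for a single Schur function. `step` changes
  -- one entry of a tableau counted on the left, and `move-injective` recovers the tableau from the
  -- result.
  kostka-≤ : kostka λ' (3 ∷ 1 ∷ a ∷ γ) + (kostka λ' (2 ∷ 0 ∷ 2 + a ∷ γ) + kostka λ' (2 ∷ 1 ∷ 1 + a ∷ γ)) ≤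
             kostka λ' (2 ∷ 2 ∷ a ∷ γ) + (kostka λ' (3 ∷ 0 ∷ 1 + a ∷ γ) + kostka λ' (1 ∷ 1 ∷ 2 + a ∷ γ))
  kostka-≤ = card-≤ sources targets
    (λ p → proj₁ (step p)) (λ p → proj₂ (proj₂ (step p)))
    (λ p q eq → move-injective (subst (Move _) eq (proj₁ (proj₂ (step p)))) (proj₁ (proj₂ (step q))))
    where
    Source : Tableau (3 + length γ) → Set
    Source U = Tab 3 1 a U ⊎ Tab 2 0 (2 + a) U ⊎ Tab 2 1 (1 + a) U

    differ : ∀ {x y z x' y' z' U} (c : Fin (3 + length γ)) → lookup (x ∷ y ∷ z ∷ γ) c ≢ lookup (x' ∷ y' ∷ z' ∷ γ) c →
             Tab x y z U → Tab x' y' z' U → ⊥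
    differ c ≢c t t' = ≢c (trans (sym (IsTableau.content t c)) (IsTableau.content t' c))

    sources : Card Source _
    sources = card-⊎ (λ { t (inj₁ t') → differ 0F (λ ()) t t' ; t (inj₂ t') → differ 0F (λ ()) t t' })
      (card-kostka λ' _) (card-⊎ (differ 1F (λ ())) (card-kostka λ' _) (card-kostka λ' _))

    targets : Card Result₃ _
    targets = card-⊎ (λ { t (inj₁ t') → differ 0F (λ ()) t t' ; t (inj₂ t') → differ 0F (λ ()) t t' })
      (card-kostka λ' _) (card-⊎ (differ 0F (λ ())) (card-kostka λ' _) (card-kostka λ' _))

    step : ∀ {U} → Source U → Target U Result₃
    step (inj₁ t)        = let V , m , t' = step₁ t in V , m , inj₁ t'
    step (inj₂ (inj₁ t)) = let V , m , t' = step₂ t in V , m , inj₂ (inj₂ t')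
    step (inj₂ (inj₂ t)) = step₃ t

-- From Kostka numbers to chromatic coefficients

toℚ-mkℚ : ∀ n → toℚ n ≡ mkℚ (ℤ.+ n) 0 (Coprime.sym (Coprime.1-coprimeTo n))
toℚ-mkℚ n = ℚₚ.normalize-coprime _

toℚ-+ : ∀ m n → toℚ m ℚ.+ toℚ n ≡ toℚ (m + n)
toℚ-+ m n rewrite toℚ-mkℚ m | toℚ-mkℚ n = cong (λ z → z ℚ./ 1) (cong₂ ℤ._+_ (ℤₚ.*-identityʳ (ℤ.+ m)) (ℤₚ.*-identityʳ (ℤ.+ n)))

toℚ-mono-≤ : ∀ {m n} → m ≤ n → toℚ m ℚ.≤ toℚ n
toℚ-mono-≤ {m} {n} m≤n rewrite toℚ-mkℚ m | toℚ-mkℚ n =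
  *≤* (subst₂ ℤ._≤_ (sym (ℤₚ.*-identityʳ (ℤ.+ m))) (sym (ℤₚ.*-identityʳ (ℤ.+ n))) (+≤+ m≤n))

toℚ-cancel-≤ : ∀ {m n} → toℚ m ℚ.≤ toℚ n → m ≤ n
toℚ-cancel-≤ {m} {n} p rewrite toℚ-mkℚ m | toℚ-mkℚ n =
  ℤₚ.drop‿+≤+ (subst₂ ℤ._≤_ (ℤₚ.*-identityʳ (ℤ.+ m)) (ℤₚ.*-identityʳ (ℤ.+ n)) (ℚₚ.drop-*≤* p))

toℚ-+³ : ∀ x y z → toℚ (x + (y + z)) ≡ toℚ x ℚ.+ (toℚ y ℚ.+ toℚ z)
toℚ-+³ x y z = sym (trans (cong (toℚ x ℚ.+_) (toℚ-+ y z)) (toℚ-+ x (y + z)))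

combCoeff-∷ : ∀ λ' c L α β γ →
  combCoeff ((λ' , c) ∷ L) α ℚ.+ (combCoeff ((λ' , c) ∷ L) β ℚ.+ combCoeff ((λ' , c) ∷ L) γ) ≡
  c ℚ.* toℚ (kostka λ' α + (kostka λ' β + kostka λ' γ)) ℚ.+ (combCoeff L α ℚ.+ (combCoeff L β ℚ.+ combCoeff L γ))
combCoeff-∷ λ' c L α β γ = trans
  (solve 7 (λ c x y z p q r → (c :* x :+ p) :+ ((c :* y :+ q) :+ (c :* z :+ r)) := c :* (x :+ (y :+ z)) :+ (p :+ (q :+ r)))
    refl c (toℚ (kostka λ' α)) (toℚ (kostka λ' β)) (toℚ (kostka λ' γ)) (combCoeff L α) (combCoeff L β) (combCoeff L γ))
  (cong (λ k → c ℚ.* k ℚ.+ _) (sym (toℚ-+³ (kostka λ' α) (kostka λ' β) (kostka λ' γ))))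
  where open +-*-Solver

module _ {α₁ α₂ α₃ β₁ β₂ β₃ : List ℕ}
         (kostka-mono : ∀ λ' → IsPartition λ' → kostka λ' α₁ + (kostka λ' α₂ + kostka λ' α₃) ≤ kostka λ' β₁ + (kostka λ' β₂ + kostka λ' β₃))
         where

  combCoeff-mono : ∀ L → All (λ p → IsPartition (proj₁ p) × (0ℚ ℚ.≤ proj₂ p)) L →
                   combCoeff L α₁ ℚ.+ (combCoeff L α₂ ℚ.+ combCoeff L α₃) ℚ.≤ combCoeff L β₁ ℚ.+ (combCoeff L β₂ ℚ.+ combCoeff L β₃)
  combCoeff-mono []             []                          = ℚₚ.≤-refl
  combCoeff-mono ((λ' , c) ∷ L) ((partition , 0≤c) ∷ L≥0) = subst₂ ℚ._≤_
    (sym (combCoeff-∷ λ' c L α₁ α₂ α₃)) (sym (combCoeff-∷ λ' c L β₁ β₂ β₃))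
    (ℚₚ.+-mono-≤ (ℚₚ.*-monoˡ-≤-nonNeg c {{ℚ.nonNegative 0≤c}} (toℚ-mono-≤ (kostka-mono λ' partition))) (combCoeff-mono L L≥0))

  schurPositive-≤ : ∀ {N} {G : FinGraph N} → SchurPositiveGraph G →
                    chromCoeff G α₁ + (chromCoeff G α₂ + chromCoeff G α₃) ≤ chromCoeff G β₁ + (chromCoeff G β₂ + chromCoeff G β₃)
  schurPositive-≤ {G = G} (L , L≥0 , X≡) = toℚ-cancel-≤ (subst₂ ℚ._≤_ (expand α₁ α₂ α₃) (expand β₁ β₂ β₃) (combCoeff-mono L L≥0))
    where
    expand : ∀ α β γ → combCoeff L α ℚ.+ (combCoeff L β ℚ.+ combCoeff L γ) ≡ toℚ (chromCoeff G α + (chromCoeff G β + chromCoeff G γ))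
    expand α β γ = trans (sym (cong₂ ℚ._+_ (X≡ α) (cong₂ ℚ._+_ (X≡ β) (X≡ γ)))) (sym (toℚ-+³ (chromCoeff G α) (chromCoeff G β) (chromCoeff G γ)))

-- Colourings of the grid

card-lookup : ∀ {N n} (c : Fin n) (v : Vec (Fin n) N) → Card (λ x → Vec.lookup v x ≡ c) (countᵇ (_==ᶠ c) (Vec.toList v))
card-lookup c Vec.[] = card-⊥ λ { {()} }
card-lookup c (d Vec.∷ v) with d Finₚ.≟ c
... | yes d≡c = card-cong
  (λ { (inj₁ refl) → d≡c ; (inj₂ (_ , eq , refl)) → eq })
  (λ { {zero} _ → inj₁ refl ; {suc x} eq → inj₂ (x , eq , refl) })
  (card-⊎ (λ { refl (_ , _ , ()) }) (card-singleton zero) (card-image suc Finₚ.suc-injective (card-lookup c v)))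
... | no d≢c = card-⇔ suc Finₚ.suc-injective id
  (λ { {zero} d≡c → ⊥-elim (d≢c d≡c) ; {suc x} eq → x , eq , refl }) (card-lookup c v)

clamp : ∀ {n} → ℕ → Fin (suc n)
clamp         zero    = zero
clamp {zero}  (suc _) = zero
clamp {suc n} (suc i) = suc (clamp i)

toℕ-clamp : ∀ {n i} → i ≤ n → toℕ (clamp {n} i) ≡ i
toℕ-clamp z≤n     = refl
toℕ-clamp (s≤s p) = cong suc (toℕ-clamp p)

clamp-toℕ : ∀ {n} (i : Fin (suc n)) → clamp (toℕ i) ≡ i
clamp-toℕ i = Finₚ.toℕ-injective (toℕ-clamp (ℕ.s≤s⁻¹ (Finₚ.toℕ<n i)))

properᵇ⁻ : ∀ {N C} (G : FinGraph N) (κ : Vec (Fin C) N) → T (properᵇ G κ) → ∀ x y → T (FinGraph.adj G x y) → Vec.lookup κ x ≢ Vec.lookup κ y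
properᵇ⁻ G κ h x y xy eq with allFinᵇ⁻ _ (allFinᵇ⁻ _ h x) y
... | h' with FinGraph.adj G x y | Vec.lookup κ x Finₚ.≟ Vec.lookup κ y
...   | true | yes _ = h'
...   | true | no ≢c = ≢c eq

allᵇ-counterexample : {A : Set} (p : A → Bool) (xs : List A) → ¬ T (allᵇ p xs) → ∃[ x ] ¬ T (p x)
allᵇ-counterexample p []       h = ⊥-elim (h tt)
allᵇ-counterexample p (x ∷ xs) h with p x in eq
... | true  = allᵇ-counterexample p xs h
... | false = x , subst T eq

properᵇ⁺ : ∀ {N C} (G : FinGraph N) (κ : Vec (Fin C) N) → (∀ x y → Vec.lookup κ x ≡ Vec.lookup κ y → ¬ T (FinGraph.adj G x y)) → T (properᵇ G κ)
properᵇ⁺ {N} G κ h with T? (properᵇ G κ)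
... | yes p = p
... | no ¬p with allᵇ-counterexample _ (allFin N) ¬p
...   | x , ¬px with allᵇ-counterexample _ (allFin N) ¬px
...     | y , ¬pxy with FinGraph.adj G x y in eq | Vec.lookup κ x Finₚ.≟ Vec.lookup κ y
...       | false | _       = ⊥-elim (¬pxy tt)
...       | true  | no _    = ⊥-elim (¬pxy tt)
...       | true  | yes x≡y = ⊥-elim (h x y x≡y (subst T (sym eq) tt))

module _ (m k : ℕ) where

  Vertex : Set
  Vertex = ℕ × ℕ

  -- Columns are numbered from 1, so that level 0 and level k + 2 below each gain a virtual vertex outside the grid.
  InGrid : Vertex → Set
  InGrid (c , j) = 1 ≤ c × c ≤ suc (m + k) × j ≤ m

  rank : Vertex → ℕ
  rank (c , j) = c + j

  _⊑_ : Vertex → Vertex → Set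
  (c , j) ⊑ (c' , j') = c ≤ c' × j ≤ j'

  Size : ℕ
  Size = suc (m + k) * suc m

  column : Fin Size → Fin (suc (m + k))
  column x = proj₁ (remQuot {suc (m + k)} (suc m) x)

  row : Fin Size → Fin (suc m)
  row x = proj₂ (remQuot {suc (m + k)} (suc m) x)

  coords : Fin Size → Vertex
  coords x = suc (toℕ (column x)) , toℕ (row x)

  vertex : Vertex → Fin Size
  vertex (c , j) = combine {suc (m + k)} (clamp (pred c)) (clamp j)

  coords-vertex : ∀ {v} → InGrid v → coords (vertex v) ≡ v
  coords-vertex {suc c , j} (_ , s≤s c≤ , j≤) = trans
    (cong (λ (c' , j') → suc (toℕ c') , toℕ j') (Finₚ.remQuot-combine {suc (m + k)} {suc m} (clamp c) (clamp j)))
    (cong₂ _,_ (cong suc (toℕ-clamp c≤)) (toℕ-clamp j≤))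

  vertex-coords : ∀ x → vertex (coords x) ≡ x
  vertex-coords x = trans (cong₂ (combine {suc (m + k)} {suc m}) (clamp-toℕ (column x)) (clamp-toℕ (row x)))
    (Finₚ.combine-remQuot {suc (m + k)} (suc m) x)

  coords-inGrid : ∀ x → InGrid (coords x)
  coords-inGrid x = s≤s z≤n , Finₚ.toℕ<n (column x) , ℕ.s≤s⁻¹ (Finₚ.toℕ<n (row x))

  coords-injective : ∀ {x y} → coords x ≡ coords y → x ≡ y
  coords-injective {x} {y} eq = trans (sym (vertex-coords x)) (trans (cong vertex eq) (vertex-coords y))

  -- Rank is strictly monotone, so an element below `v` whose rank is not smaller is `v` itself.
  ⊑-antisym-rank : ∀ {v w} → w ⊑ v → rank v ≤ rank w → v ⊑ w
  ⊑-antisym-rank {c , j} {c' , j'} (c'≤c , j'≤j) le =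
    ℕₚ.+-cancelʳ-≤ j c c' (ℕₚ.≤-trans le (ℕₚ.+-monoʳ-≤ c' j'≤j)) , ℕₚ.+-cancelˡ-≤ c j j' (ℕₚ.≤-trans le (ℕₚ.+-monoˡ-≤ j' c'≤c))

  private
    G = inc (chainProduct (suc (m + k)) (suc m))
    leq = FinPoset.leq (chainProduct (suc (m + k)) (suc m))

  leq⁻ : ∀ x y → T (leq x y) → coords x ⊑ coords y
  leq⁻ x y h =
    let p , q = ∧⁻ {⌊ column x Finₚ.≤? column y ⌋} {⌊ row x Finₚ.≤? row y ⌋} h
    in s≤s (toWitness {a? = column x Finₚ.≤? column y} p) , toWitness {a? = row x Finₚ.≤? row y} q

  leq⁺ : ∀ x y → coords x ⊑ coords y → T (leq x y)
  leq⁺ x y (s≤s p , q) = ∧⁺ {⌊ column x Finₚ.≤? column y ⌋} (fromWitness p) (fromWitness q)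

  nonadjacent : ∀ x y → FinGraph.adj G x y ≡ false → coords x ⊑ coords y ⊎ coords y ⊑ coords x
  nonadjacent x y eq with x Finₚ.≟ y | leq x y in eq₁ | leq y x in eq₂ | eq
  ... | yes refl | _     | _     | _ = inj₁ (ℕₚ.≤-refl , ℕₚ.≤-refl)
  ... | no _     | true  | _     | _ = inj₁ (leq⁻ x y (subst T (sym eq₁) tt))
  ... | no _     | false | true  | _ = inj₂ (leq⁻ y x (subst T (sym eq₂) tt))
  ... | no _     | false | false | ()

  adjacent : ∀ x y → T (leq x y) ⊎ T (leq y x) → ¬ T (FinGraph.adj G x y)
  adjacent x y h xy with x Finₚ.≟ y | leq x y | leq y x | h | xy
  ... | no _ | false | false | inj₁ () | _
  ... | no _ | false | false | inj₂ () | _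

  module _ {C : ℕ} where

    at : Vec (Fin C) Size → Vertex → Fin C
    at κ v = Vec.lookup κ (vertex v)

    at-coords : ∀ κ x → at κ (coords x) ≡ Vec.lookup κ x
    at-coords κ x = cong (Vec.lookup κ) (vertex-coords x)

    colouring : (Vertex → Fin C) → Vec (Fin C) Size
    colouring F = Vec.tabulate (F ∘ coords)

    at-colouring : ∀ F {v} → InGrid v → at (colouring F) v ≡ F v
    at-colouring F {v} v∈ = trans (Vecₚ.lookup∘tabulate (F ∘ coords) (vertex v)) (cong F (coords-vertex v∈))

    at-injective : ∀ {κ κ'} → (∀ {v} → InGrid v → at κ v ≡ at κ' v) → κ ≡ κ'
    at-injective {κ} {κ'} h = trans (sym (Vecₚ.tabulate∘lookup κ)) (trans (Vecₚ.tabulate-cong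
      (λ x → trans (sym (at-coords κ x)) (trans (h (coords-inGrid x)) (at-coords κ' x)))) (Vecₚ.tabulate∘lookup κ'))

    card-colour : ∀ κ d → Card (λ v → InGrid v × at κ v ≡ d) (occ d κ)
    card-colour κ d = card-⇔ coords coords-injective
      (λ {x} eq → coords-inGrid x , trans (at-coords κ x) eq)
      (λ {v} (v∈ , eq) → vertex v , eq , sym (coords-vertex v∈)) (card-lookup d κ)

    -- Comparability of equally coloured vertices, oriented by rank: the vertex of smaller rank is
    -- the smaller one, which removes the disjunction.
    Proper : (Vertex → Fin C) → Set
    Proper F = ∀ {v w} → InGrid v → InGrid w → rank v ≤ rank w → F v ≡ F w → v ⊑ w

    comparable⁻ : ∀ (κ : Vec (Fin C) Size) → T (properᵇ G κ) → ∀ x y → Vec.lookup κ x ≡ Vec.lookup κ y → coords x ⊑ coords y ⊎ coords y ⊑ coords x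
    comparable⁻ κ h x y eq with FinGraph.adj G x y in eq'
    ... | false = nonadjacent x y eq'
    ... | true  = ⊥-elim (properᵇ⁻ G κ h x y (subst T (sym eq') tt) eq)

    proper⁻ : ∀ (κ : Vec (Fin C) Size) → T (properᵇ G κ) → Proper (at κ)
    proper⁻ κ h {v} {w} v∈ w∈ le eq with comparable⁻ κ h (vertex v) (vertex w) eq
    ... | inj₁ v⊑w = subst₂ _⊑_ (coords-vertex v∈) (coords-vertex w∈) v⊑w
    ... | inj₂ w⊑v = ⊑-antisym-rank (subst₂ _⊑_ (coords-vertex w∈) (coords-vertex v∈) w⊑v) le

    proper⁺ : ∀ (κ : Vec (Fin C) Size) → Proper (at κ) → T (properᵇ G κ)
    proper⁺ κ proper = properᵇ⁺ G κ (λ x y eq → adjacent x y (comparable x y eq))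
      where
      comparable : ∀ x y → Vec.lookup κ x ≡ Vec.lookup κ y → T (leq x y) ⊎ T (leq y x)
      comparable x y eq with ℕₚ.≤-total (rank (coords x)) (rank (coords y))
      ... | inj₁ le = inj₁ (leq⁺ x y (proper (coords-inGrid x) (coords-inGrid y) le
                        (trans (at-coords κ x) (trans eq (sym (at-coords κ y))))))
      ... | inj₂ le = inj₂ (leq⁺ y x (proper (coords-inGrid y) (coords-inGrid x) le
                        (trans (at-coords κ y) (trans (sym eq) (sym (at-coords κ x))))))

-- The rows of a level with one row left out

punchIn-lower : ∀ {m} (q : Fin (suc m)) i → toℕ i ≤ toℕ (punchIn q i)
punchIn-lower zero    i       = ℕₚ.n≤1+n _
punchIn-lower (suc q) zero    = z≤n
punchIn-lower (suc q) (suc i) = s≤s (punchIn-lower q i)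

punchIn-upper : ∀ {m} (q : Fin (suc m)) i → toℕ (punchIn q i) ≤ suc (toℕ i)
punchIn-upper zero    i       = ℕₚ.≤-refl
punchIn-upper (suc q) zero    = z≤n
punchIn-upper (suc q) (suc i) = s≤s (punchIn-upper q i)

-- `punchIn q i` is the i-th row other than `q`; lowering the omitted row can only push the i-th
-- remaining row up.
punchIn-antitone : ∀ {m} (q q' : Fin (suc m)) i → toℕ q' ≤ toℕ q → toℕ (punchIn q i) ≤ toℕ (punchIn q' i)
punchIn-antitone q       zero     i       _       = punchIn-upper q i
punchIn-antitone (suc q) (suc q') zero    _       = z≤n
punchIn-antitone (suc q) (suc q') (suc i) (s≤s p) = s≤s (punchIn-antitone q q' i p)

-- The positions of the chains thus compare the omitted rows. If `q` were below `q'`, slot `q` would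
-- lie in row q + 1 on the left and in row q on the right.
punchIn-cancel-antitone : ∀ {m} (q q' : Fin (suc m)) → (∀ i → toℕ (punchIn q i) ≤ toℕ (punchIn q' i)) → toℕ q' ≤ toℕ q
punchIn-cancel-antitone         q       zero     h = z≤n
punchIn-cancel-antitone {suc m} zero    (suc q') h with () ← h zero
punchIn-cancel-antitone {suc m} (suc q) (suc q') h = s≤s (punchIn-cancel-antitone q q' (λ i → ℕ.s≤s⁻¹ (h (suc i))))

punchIn-fromℕ : ∀ m i → toℕ (punchIn (fromℕ m) i) ≡ toℕ i
punchIn-fromℕ (suc m) zero    = refl
punchIn-fromℕ (suc m) (suc i) = cong suc (punchIn-fromℕ m i)

strictly-increasing-lower : ∀ {m n} (f : Fin m → Fin n) → (∀ {i j} → i Fin.< j → f i Fin.< f j) → ∀ i → toℕ i ≤ toℕ (f i)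
strictly-increasing-lower {suc m} f f-mono = <-weakInduction (λ i → toℕ i ≤ toℕ (f i)) z≤n
  λ i p → ℕₚ.≤-trans (s≤s (subst (_≤ toℕ (f (Fin.inject₁ i))) (Finₚ.toℕ-inject₁ i) p)) (f-mono {Fin.inject₁ i} {suc i} (s≤s (ℕₚ.≤-reflexive (Finₚ.toℕ-inject₁ i))))

strictly-increasing-upper : ∀ {m} (f : Fin m → Fin m) → (∀ {i j} → i Fin.< j → f i Fin.< f j) → ∀ i → toℕ (f i) ≤ toℕ i
strictly-increasing-upper {suc m} f f-mono = >-weakInduction (λ i → toℕ (f i) ≤ toℕ i)
  (subst (toℕ (f (fromℕ m)) ≤_) (sym (Finₚ.toℕ-fromℕ m)) (ℕ.s≤s⁻¹ (Finₚ.toℕ<n (f (fromℕ m)))))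
  λ i p → subst (toℕ (f (Fin.inject₁ i)) ≤_) (sym (Finₚ.toℕ-inject₁ i)) (ℕ.s≤s⁻¹ (ℕₚ.≤-trans (f-mono {Fin.inject₁ i} {suc i} (s≤s (ℕₚ.≤-reflexive (Finₚ.toℕ-inject₁ i)))) p))

strictly-increasing-id : ∀ {m} (f : Fin m → Fin m) → (∀ {i j} → i Fin.< j → f i Fin.< f j) → ∀ i → f i ≡ i
strictly-increasing-id f f-mono i = Finₚ.toℕ-injective (ℕₚ.≤-antisym (strictly-increasing-upper f f-mono i) (strictly-increasing-lower f f-mono i))

module _ {m : ℕ} where

  -- Of the 3 + m colours, the first three are those of the exceptional vertices and the other `m`
  -- are those of the chains.
  mark : Fin 3 → Fin (3 + m)
  mark e = e ↑ˡ m

  chain : Fin m → Fin (3 + m)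
  chain i = 3 ↑ʳ i

  mark-injective : ∀ {d e} → mark d ≡ mark e → d ≡ e
  mark-injective {d} {e} = Finₚ.↑ˡ-injective m d e

  chain-injective : ∀ {i j} → chain i ≡ chain j → i ≡ j
  chain-injective {i} {j} = Finₚ.↑ʳ-injective 3 i j

  mark≢chain : ∀ {e i} → mark e ≢ chain i
  mark≢chain {0F} ()
  mark≢chain {1F} ()
  mark≢chain {2F} ()

  IsChain : Fin (3 + m) → Set
  IsChain d = ∃[ i ] d ≡ chain i

  mark-or-chain : ∀ d → (∃[ e ] d ≡ mark e) ⊎ IsChain d
  mark-or-chain 0F = inj₁ (0F , refl)
  mark-or-chain 1F = inj₁ (1F , refl)
  mark-or-chain 2F = inj₁ (2F , refl)
  mark-or-chain (suc (suc (suc i))) = inj₂ (i , refl)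

-- Structure of a colouring on the middle ranks

module _ (m k : ℕ) where

  private
    V = Vertex m k
    Colour = Fin (3 + m)

  -- The vertices of rank m + t, indexed by row; the middle ranks are the levels 1 to k + 1. Row m
  -- of level 0 falls on column 0 and row 0 of level k + 2 on column m + k + 2, both outside the
  -- grid.
  level : ℕ → Fin (suc m) → V
  level t j = m ∸ toℕ j + t , toℕ j

  rank-level : ∀ t j → rank m k (level t j) ≡ m + t
  rank-level t j = begin
    m ∸ toℕ j + t + toℕ j   ≡⟨ ℕₚ.+-assoc (m ∸ toℕ j) t (toℕ j) ⟩
    m ∸ toℕ j + (t + toℕ j) ≡⟨ cong (m ∸ toℕ j +_) (ℕₚ.+-comm t (toℕ j)) ⟩
    m ∸ toℕ j + (toℕ j + t) ≡⟨ ℕₚ.+-assoc (m ∸ toℕ j) (toℕ j) t ⟨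
    m ∸ toℕ j + toℕ j + t   ≡⟨ cong (_+ t) (ℕₚ.m∸n+n≡m (ℕ.s≤s⁻¹ (Finₚ.toℕ<n j))) ⟩
    m + t                   ∎
    where open ≡-Reasoning

  level-injective : ∀ {t t' j j'} → level t j ≡ level t' j' → t ≡ t' × j ≡ j'
  level-injective {t} {t'} {j} {j'} eq =
    ℕₚ.+-cancelˡ-≡ m t t' (trans (sym (rank-level t j)) (trans (cong (rank m k) eq) (rank-level t' j'))) ,
    Finₚ.toℕ-injective (cong proj₂ eq)

  level-inGrid : ∀ {t} j → t ≤ k → InGrid m k (level (suc t) j)
  level-inGrid {t} j t≤k rewrite ℕₚ.+-suc (m ∸ toℕ j) t =
    s≤s z≤n , s≤s (ℕₚ.+-mono-≤ (ℕₚ.m∸n≤m m (toℕ j)) t≤k) , ℕ.s≤s⁻¹ (Finₚ.toℕ<n j)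

  -- q t is the row of the vertex of level t that lies on none of the m chains; at both ends it is the virtual one.
  record Levels (q : ℕ → Fin (suc m)) : Set where
    field
      first    : q 0 ≡ fromℕ m
      last     : q (2 + k) ≡ zero
      antitone : ∀ {t t'} → t ≤ t' → t' ≤ 2 + k → toℕ (q t') ≤ toℕ (q t)

  -- The grid vertices of levels 0 and k + 2 count as outer; along them the repainted middle is
  -- glued to the rest.
  Outer : V → Set
  Outer v = rank m k v ≤ m ⊎ 2 + m + k ≤ rank m k v

  data View (q : ℕ → Fin (suc m)) : V → Set where
    outer  : ∀ {v} → Outer v → View q v
    marked : ∀ t → t ≤ k → View q (level (suc t) (q (suc t)))
    linked : ∀ t i → t ≤ k → View q (level (suc t) (punchIn (q (suc t)) i))

  view : ∀ q {v} → InGrid m k v → View q v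
  view q {c , j} (1≤c , c≤ , j≤m) with c + j ℕₚ.≤? m | 2 + m + k ℕₚ.≤? c + j
  ... | yes p | _     = outer (inj₁ p)
  ... | no _  | yes p = outer (inj₂ p)
  ... | no p  | no p' = subst (View q) eq cases
    where
    j' : Fin (suc m)
    j' = clamp j
    t = c + j ∸ suc m
    sum≡ : suc (m + t) ≡ c + j
    sum≡ = ℕₚ.m+[n∸m]≡n (ℕₚ.≰⇒> p)
    eq : level (suc t) j' ≡ (c , j)
    eq = cong₂ _,_ (ℕₚ.+-cancelʳ-≡ (toℕ j') _ c (trans (rank-level (suc t) j') (trans (ℕₚ.+-suc m t) (trans sum≡ (cong (c +_) (sym (toℕ-clamp j≤m))))))) (toℕ-clamp j≤m)
    t≤k : t ≤ k
    t≤k = ℕₚ.+-cancelˡ-≤ m t k (ℕ.s≤s⁻¹ (subst (_≤ suc (m + k)) (sym sum≡) (ℕ.s≤s⁻¹ (ℕₚ.≰⇒> p'))))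
    cases : View q (level (suc t) j')
    cases with q (suc t) Finₚ.≟ j'
    ... | yes q≡j  = subst (λ x → View q (level (suc t) x)) q≡j (marked t t≤k)
    ... | no q≢j   = subst (λ x → View q (level (suc t) x)) (Finₚ.punchIn-punchOut q≢j) (linked t (punchOut q≢j) t≤k)

  module _ {q : ℕ → Fin (suc m)} (first : q 0 ≡ fromℕ m) (last : q (2 + k) ≡ zero) where

    -- Each of the two end levels has one vertex outside the grid, and `first` and `last` omit
    -- exactly that one.
    linked-inGrid : ∀ {t} i → t ≤ 2 + k → InGrid m k (level t (punchIn (q t) i))
    linked-inGrid {zero} i _ = ℕₚ.≤-trans (ℕₚ.m<n⇒0<n∸m (subst (_< m) (sym j≡i) (Finₚ.toℕ<n i))) (ℕₚ.m≤m+n _ 0) ,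
      ℕₚ.≤-trans (ℕₚ.≤-reflexive (ℕₚ.+-identityʳ _)) (ℕₚ.≤-trans (ℕₚ.m∸n≤m m (toℕ (punchIn (q 0) i))) (ℕₚ.≤-trans (ℕₚ.m≤m+n m k) (ℕₚ.n≤1+n _))) ,
      ℕ.s≤s⁻¹ (Finₚ.toℕ<n (punchIn (q 0) i))
      where
      j≡i : toℕ (punchIn (q 0) i) ≡ toℕ i
      j≡i = trans (cong (λ x → toℕ (punchIn x i)) first) (punchIn-fromℕ m i)
    linked-inGrid {suc t} i (s≤s t≤) with t ℕₚ.≤? k
    ... | yes t≤k = level-inGrid _ t≤k
    ... | no t≰k with ℕₚ.≤-antisym t≤ (ℕₚ.≰⇒> t≰k)
    ...   | refl rewrite last = ℕₚ.≤-trans (s≤s z≤n) (ℕₚ.m≤n+m (2 + k) _) , bound , Finₚ.toℕ<n i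
      where
      bound : m ∸ suc (toℕ i) + (2 + k) ≤ suc (m + k)
      bound = ℕₚ.≤-trans (ℕₚ.≤-reflexive (trans (ℕₚ.+-suc _ (suc k)) (cong suc (ℕₚ.+-suc _ k))))
        (s≤s (ℕₚ.+-monoˡ-≤ k (ℕₚ.≤-trans (s≤s (ℕₚ.∸-monoʳ-≤ m (s≤s z≤n))) (ℕₚ.≤-reflexive (ℕₚ.m+[n∸m]≡n (ℕₚ.≤-trans (s≤s z≤n) (Finₚ.toℕ<n i)))))))

  module _ {q : ℕ → Fin (suc m)} (levels : Levels q) where
    open Levels levels

    -- A chain that starts in row i meets every level in row i or i + 1.
    linked-⊑ : ∀ {t t'} i → t ≤ t' → t' ≤ 2 + k → _⊑_ m k (level t (punchIn (q t) i)) (level t' (punchIn (q t') i))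
    linked-⊑ {t} {t'} i t≤t' t'≤ = col , row≤
      where
      a = toℕ (punchIn (q t) i)
      b = toℕ (punchIn (q t') i)
      row≤ : a ≤ b
      row≤ = punchIn-antitone (q t) (q t') i (antitone t≤t' t'≤)
      b≤1+a : b ≤ suc a
      b≤1+a = ℕₚ.≤-trans (punchIn-upper (q t') i) (s≤s (punchIn-lower (q t) i))
      ∸-suc : ∀ x y → x ∸ y ≤ suc (x ∸ suc y)
      ∸-suc zero    zero    = z≤n
      ∸-suc zero    (suc y) = z≤n
      ∸-suc (suc x) zero    = ℕₚ.≤-refl
      ∸-suc (suc x) (suc y) = ∸-suc x y
      -- From one level to a later one the rank grows by at least 1 and the row by at most 1, so the
      -- column does not fall.
      col : m ∸ a + t ≤ m ∸ b + t'
      col with t ℕₚ.≟ t'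
      ... | yes refl = ℕₚ.≤-refl
      ... | no t≢t' = ℕₚ.≤-trans (ℕₚ.+-monoˡ-≤ t (ℕₚ.≤-trans (∸-suc m a) (s≤s (ℕₚ.∸-monoʳ-≤ m b≤1+a))))
        (ℕₚ.≤-trans (ℕₚ.≤-reflexive (sym (ℕₚ.+-suc _ t))) (ℕₚ.+-monoʳ-≤ (m ∸ b) (ℕₚ.≤∧≢⇒< t≤t' t≢t')))

  -- A single `π` for all levels expresses that the chains keep their order. The field `chains`
  -- includes the end levels 0 and k + 2 and so ties the middle to the outer part.
  record Described (F : V → Colour) (q : ℕ → Fin (suc m)) (col : ℕ → Fin 3) (π : Fin m → Fin m) : Set where
    field
      levels      : Levels q
      marks       : ∀ {t} → t ≤ k → F (level (suc t) (q (suc t))) ≡ mark (col t)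
      chains      : ∀ {t} → t ≤ 2 + k → ∀ i → F (level t (punchIn (q t) i)) ≡ chain (π i)
      π-injective : ∀ {i j} → π i ≡ π j → i ≡ j
      outer-chain : ∀ {v} → InGrid m k v → Outer v → IsChain (F v)

  extend : (Fin (suc k) → Fin (suc m)) → ℕ → Fin (suc m)
  extend r zero    = fromℕ m
  extend r (suc t) with t ℕₚ.≤? k
  ... | yes _ = r (clamp t)
  ... | no  _ = zero

  extend-≤ : ∀ r {t} → t ≤ k → extend r (suc t) ≡ r (clamp t)
  extend-≤ r {t} t≤k with t ℕₚ.≤? k
  ... | yes _  = refl
  ... | no t≰k = ⊥-elim (t≰k t≤k)

  extend-last : ∀ r → extend r (2 + k) ≡ zero
  extend-last r with suc k ℕₚ.≤? k
  ... | yes p = ⊥-elim (ℕₚ.1+n≰n p)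
  ... | no  _ = refl

  antitone-steps : (q : ℕ → Fin (suc m)) → (∀ t → t ≤ suc k → toℕ (q (suc t)) ≤ toℕ (q t)) →
                   ∀ {t t'} → t ≤ t' → t' ≤ 2 + k → toℕ (q t') ≤ toℕ (q t)
  antitone-steps q step {t} {zero}   z≤n _ = ℕₚ.≤-refl
  antitone-steps q step {t} {suc t'} t≤ (s≤s t'≤) with t ℕₚ.≟ suc t'
  ... | yes refl = ℕₚ.≤-refl
  ... | no t≢    = ℕₚ.≤-trans (step t' t'≤) (antitone-steps q step (ℕ.s≤s⁻¹ (ℕₚ.≤∧≢⇒< t≤ t≢)) (ℕₚ.m≤n⇒m≤1+n t'≤))

  module _ {F : V → Colour} (proper : Proper m k F) where

    same-level : ∀ {t j j'} → InGrid m k (level t j) → InGrid m k (level t j') → F (level t j) ≡ F (level t j') → j ≡ j'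
    same-level {t} {j} {j'} j∈ j'∈ eq = Finₚ.toℕ-injective (ℕₚ.≤-antisym
      (proj₂ (proper j∈ j'∈ (ℕₚ.≤-reflexive (trans (rank-level t j) (sym (rank-level t j')))) eq))
      (proj₂ (proper j'∈ j∈ (ℕₚ.≤-reflexive (trans (rank-level t j') (sym (rank-level t j)))) (sym eq))))

    -- Comparable vertices of consecutive ranks differ by one step, either in the column or in the
    -- row.
    next-level : ∀ {t j j'} → InGrid m k (level t j) → InGrid m k (level (suc t) j') → F (level t j) ≡ F (level (suc t) j') →
                 toℕ j ≤ toℕ j' × toℕ j' ≤ suc (toℕ j)
    next-level {t} {j} {j'} j∈ j'∈ eq with proper j∈ j'∈ rank≤ eq
      where
      rank≤ : rank m k (level t j) ≤ rank m k (level (suc t) j')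
      rank≤ = subst₂ _≤_ (sym (rank-level t j)) (sym (rank-level (suc t) j')) (ℕₚ.+-monoʳ-≤ m (ℕₚ.n≤1+n t))
    ... | c≤c' , j≤j' = j≤j' , ℕₚ.+-cancelˡ-≤ (m ∸ toℕ j + t) _ _ (begin
      m ∸ toℕ j + t + toℕ j'           ≤⟨ ℕₚ.+-monoˡ-≤ (toℕ j') c≤c' ⟩
      rank m k (level (suc t) j')      ≡⟨ rank-level (suc t) j' ⟩
      m + suc t                        ≡⟨ ℕₚ.+-suc m t ⟩
      suc (m + t)                      ≡⟨ cong suc (rank-level t j) ⟨
      suc (m ∸ toℕ j + t + toℕ j)      ≡⟨ ℕₚ.+-suc _ (toℕ j) ⟨
      m ∸ toℕ j + t + suc (toℕ j)      ∎)
      where open ℕₚ.≤-Reasoning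

    -- The m + 1 vertices of a middle level form an antichain, so the `m` chain colours cannot cover
    -- them.
    marked-row : ∀ {t} → t ≤ k → ∃[ j ] ∃[ e ] F (level (suc t) j) ≡ mark e
    marked-row {t} t≤k with Finₚ.any? (λ j → Finₚ.any? (λ e → F (level (suc t) j) Finₚ.≟ mark e))
    ... | yes found = found
    ... | no  none  = ⊥-elim (clash (Finₚ.pigeonhole ℕₚ.≤-refl (proj₁ ∘ unmarked)))
      where
      unmarked : ∀ j → IsChain (F (level (suc t) j))
      unmarked j with mark-or-chain (F (level (suc t) j))
      ... | inj₁ (e , eq) = ⊥-elim (none (j , e , eq))
      ... | inj₂ c        = c
      clash : ¬ (∃[ i ] ∃[ j ] i Fin.< j × proj₁ (unmarked i) ≡ proj₁ (unmarked j))
      clash (i , j , i<j , eq) = Finₚ.<⇒≢ i<j (same-level (level-inGrid i t≤k) (level-inGrid j t≤k)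
        (trans (proj₂ (unmarked i)) (trans (cong chain eq) (sym (proj₂ (unmarked j))))))

    module _ (few : Card (λ v → InGrid m k v × (∃[ e ] F v ≡ mark e)) (suc k)) where

      private
        t≤k : (t : Fin (suc k)) → toℕ t ≤ k
        t≤k t = ℕ.s≤s⁻¹ (Finₚ.toℕ<n t)

        r : Fin (suc k) → Fin (suc m)
        r t = proj₁ (marked-row (t≤k t))

        q : ℕ → Fin (suc m)
        q = extend r

        col : ℕ → Fin 3
        col t = proj₁ (proj₂ (marked-row (t≤k (clamp t))))

        -- The k + 1 middle levels already supply k + 1 distinct exceptional vertices, which is as
        -- many as there are.
        all-marks : ∀ {v} → InGrid m k v → ∀ {e} → F v ≡ mark e → ∃[ t ] level (suc (toℕ t)) (r t) ≡ v
        all-marks v∈ eq = card-onto (≡-dec ℕₚ._≟_ ℕₚ._≟_) few (λ t → level (suc (toℕ t)) (r t))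
          (λ t → level-inGrid (r t) (t≤k t) , proj₂ (marked-row (t≤k t)))
          (λ {t} {t'} eq → Finₚ.toℕ-injective (ℕₚ.suc-injective (proj₁ (level-injective {j = r t} {j' = r t'} eq))))
          (v∈ , _ , eq)

        rank-mark : ∀ t → rank m k (level (suc (toℕ t)) (r t)) ≡ suc (m + toℕ t)
        rank-mark t = trans (rank-level (suc (toℕ t)) (r t)) (ℕₚ.+-suc m (toℕ t))

        outer-chain : ∀ {v} → InGrid m k v → Outer v → IsChain (F v)
        outer-chain {v} v∈ h with mark-or-chain (F v)
        ... | inj₂ c        = c
        ... | inj₁ (e , eq) with all-marks v∈ eq
        ...   | t , refl with h
        ...     | inj₁ le = ⊥-elim (ℕₚ.1+n≰n (ℕₚ.≤-trans (s≤s (ℕₚ.m≤m+n m (toℕ t))) (subst (_≤ m) (rank-mark t) le)))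
        ...     | inj₂ le = ⊥-elim (ℕₚ.1+n≰n (ℕₚ.≤-trans (subst (2 + m + k ≤_) (rank-mark t) le) (s≤s (ℕₚ.+-monoʳ-≤ m (t≤k t)))))

        q-last : q (2 + k) ≡ zero
        q-last = extend-last r

        inGrid : ∀ {t} i → t ≤ 2 + k → InGrid m k (level t (punchIn (q t) i))
        inGrid = linked-inGrid {q = q} refl q-last

        linked-chain : ∀ {t} i → t ≤ 2 + k → IsChain (F (level t (punchIn (q t) i)))
        linked-chain {t} i t≤ with mark-or-chain (F (level t (punchIn (q t) i)))
        ... | inj₂ c        = c
        ... | inj₁ (e , eq) with all-marks (inGrid {t} i t≤) eq
        ...   | t' , eq' with level-injective {suc (toℕ t')} {t} {r t'} {punchIn (q t) i} eq'
        ...     | refl , r≡ = ⊥-elim (Finₚ.punchInᵢ≢i (q (suc (toℕ t'))) i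
                    (trans (sym r≡) (trans (cong r (sym (clamp-toℕ t'))) (sym (extend-≤ r (t≤k t'))))))

        w : ∀ {t} → t ≤ 2 + k → Fin m → Fin m
        w t≤ i = proj₁ (linked-chain i t≤)

        w-colour : ∀ {t} (t≤ : t ≤ 2 + k) i → F (level t (punchIn (q t) i)) ≡ chain (w t≤ i)
        w-colour t≤ i = proj₂ (linked-chain i t≤)

        w-injective : ∀ {t} (t≤ : t ≤ 2 + k) {i j} → w t≤ i ≡ w t≤ j → i ≡ j
        w-injective {t} t≤ {i} {j} eq = Finₚ.punchIn-injective (q t) i j (same-level (inGrid i t≤) (inGrid j t≤)
          (trans (w-colour t≤ i) (trans (cong chain eq) (sym (w-colour t≤ j)))))

        -- Consecutive levels carry the same `m` chain colours, so a permutation `σ` matches their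
        -- slots. Being strictly increasing, it is the identity.
        module Step {t} (t<  : suc t ≤ 2 + k) where
          t≤ : t ≤ 2 + k
          t≤ = ℕₚ.≤-trans (ℕₚ.n≤1+n t) t<

          onto : ∀ i → ∃[ j ] w t< j ≡ i
          onto i = card-onto Finₚ._≟_ (card-allFin m) (w t<) (λ _ → tt) (w-injective t<) tt

          σ : Fin m → Fin m
          σ i = proj₁ (onto (w t≤ i))

          σ-colour : ∀ i → w t< (σ i) ≡ w t≤ i
          σ-colour i = proj₂ (onto (w t≤ i))

          a b : Fin m → Fin (suc m)
          a i = punchIn (q t) i
          b i = punchIn (q (suc t)) (σ i)

          a-b : ∀ i → toℕ (a i) ≤ toℕ (b i) × toℕ (b i) ≤ suc (toℕ (a i))
          a-b i = next-level (inGrid i t≤) (inGrid (σ i) t<)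
            (trans (w-colour t≤ i) (trans (cong chain (sym (σ-colour i))) (sym (w-colour t< (σ i)))))

          σ-mono : ∀ {i j} → i Fin.< j → σ i Fin.< σ j
          σ-mono {i} {j} i<j = ℕₚ.≰⇒> λ σj≤σi →
            b≢ (ℕₚ.≤-antisym b≤ (Finₚ.punchIn-mono-≤ (q (suc t)) (σ j) (σ i) σj≤σi))
            where
            a< : toℕ (a i) < toℕ (a j)
            a< = ℕₚ.≤∧≢⇒< (Finₚ.punchIn-mono-≤ (q t) i j (ℕₚ.<⇒≤ i<j))
              (λ eq → Finₚ.<⇒≢ i<j (Finₚ.punchIn-injective (q t) i j (Finₚ.toℕ-injective eq)))
            -- `b i` ≤ `a i` + 1 ≤ `a j` ≤ `b j`, and the two ends differ because the colours do.
            b≤ : toℕ (b i) ≤ toℕ (b j)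
            b≤ = ℕₚ.≤-trans (proj₂ (a-b i)) (ℕₚ.≤-trans a< (proj₁ (a-b j)))
            b≢ : toℕ (b i) ≢ toℕ (b j)
            b≢ eq = Finₚ.<⇒≢ i<j (w-injective t≤ (trans (sym (σ-colour i)) (trans
              (cong (w t<) (Finₚ.punchIn-injective (q (suc t)) (σ i) (σ j) (Finₚ.toℕ-injective eq))) (σ-colour j))))

          σ-id : ∀ i → σ i ≡ i
          σ-id = strictly-increasing-id σ σ-mono

          same-word : ∀ i → w t< i ≡ w t≤ i
          same-word i = trans (cong (w t<) (sym (σ-id i))) (σ-colour i)

          q-decreases : toℕ (q (suc t)) ≤ toℕ (q t)
          q-decreases = punchIn-cancel-antitone (q t) (q (suc t))
            (λ i → subst (λ x → toℕ (a i) ≤ toℕ (punchIn (q (suc t)) x)) (σ-id i) (proj₁ (a-b i)))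

        word : ∀ {t} (t≤ : t ≤ 2 + k) i → w t≤ i ≡ w z≤n i
        word {zero}  z≤n i = refl
        word {suc t} t<  i = trans (Step.same-word t< i) (word (Step.t≤ t<) i)

      structure : ∃[ q ] ∃[ col ] ∃[ π ] Described F q col π
      structure = q , col , w z≤n , record
        { levels      = record { first = refl ; last = q-last ; antitone = antitone-steps q (λ t t≤ → Step.q-decreases (s≤s t≤)) }
        ; marks       = λ {t} t≤ → trans (cong₂ (λ x y → F (level (suc x) y)) (sym (toℕ-clamp t≤)) (extend-≤ r t≤))
                          (proj₂ (proj₂ (marked-row (t≤k (clamp t)))))
        ; chains      = λ t≤ i → trans (w-colour t≤ i) (cong chain (word t≤ i))
        ; π-injective = w-injective z≤n
        ; outer-chain = outer-chain
        }

  not-outer : ∀ {t} j → t ≤ k → ¬ Outer (level (suc t) j)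
  not-outer {t} j t≤k (inj₁ le) = ℕₚ.m+1+n≰m m (subst (_≤ m) (rank-level (suc t) j) le)
  not-outer {t} j t≤k (inj₂ le) = ℕₚ.1+n≰n (ℕₚ.≤-trans (subst (2 + m + k ≤_) (trans (rank-level (suc t) j) (ℕₚ.+-suc m t)) le)
    (s≤s (ℕₚ.+-monoʳ-≤ m t≤k)))

  module _ {q q' : ℕ → Fin (suc m)} where

    -- Matches the vertices of the layout `q` with those of `q'`. It sends each chain colour class
    -- injectively into the class of the same colour, so using it in both directions shows that
    -- repainting keeps the class sizes.
    relocate : ∀ {v} → View q v → V
    relocate {v} (outer _)      = v
    relocate     (marked t _)   = level (suc t) (q' (suc t))
    relocate     (linked t i _) = level (suc t) (punchIn (q' (suc t)) i)

    relocate-injective : ∀ {v w} (p : View q v) (p' : View q w) → relocate p ≡ relocate p' → v ≡ w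
    relocate-injective (outer _)       (outer _)          eq   = eq
    relocate-injective (outer o)       (marked t t≤k)     refl = ⊥-elim (not-outer (q' (suc t)) t≤k o)
    relocate-injective (outer o)       (linked t i t≤k)   refl = ⊥-elim (not-outer (punchIn (q' (suc t)) i) t≤k o)
    relocate-injective (marked t t≤k)  (outer o)          refl = ⊥-elim (not-outer (q' (suc t)) t≤k o)
    relocate-injective (linked t i t≤k) (outer o)         refl = ⊥-elim (not-outer (punchIn (q' (suc t)) i) t≤k o)
    relocate-injective (marked t _)    (marked t' _)      eq with refl ← proj₁ (level-injective {suc t} {suc t'} {q' (suc t)} {q' (suc t')} eq) = refl
    relocate-injective (marked t _)    (linked t' i _)    eq with level-injective {suc t} {suc t'} {q' (suc t)} {punchIn (q' (suc t')) i} eq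
    ... | refl , j≡ = ⊥-elim (Finₚ.punchInᵢ≢i (q' (suc t)) i (sym j≡))
    relocate-injective (linked t i _)  (marked t' _)      eq with level-injective {suc t} {suc t'} {punchIn (q' (suc t)) i} {q' (suc t')} eq
    ... | refl , j≡ = ⊥-elim (Finₚ.punchInᵢ≢i (q' (suc t)) i j≡)
    relocate-injective (linked t i _)  (linked t' i' _)   eq
      with level-injective {suc t} {suc t'} {punchIn (q' (suc t)) i} {punchIn (q' (suc t')) i'} eq
    ... | refl , j≡ with refl ← Finₚ.punchIn-injective (q' (suc t)) i i' j≡ = refl

  -- What properness means for exceptional vertices once their rows are antitone in the level: one
  -- row for each colour.
  Separated : (ℕ → Fin (suc m)) → (ℕ → Fin 3) → Set
  Separated q col = ∀ {t t'} → t ≤ k → t' ≤ k → col t ≡ col t' → q (suc t) ≡ q (suc t')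

  ⊑-trans : ∀ {u v w} → _⊑_ m k u v → _⊑_ m k v w → _⊑_ m k u w
  ⊑-trans (p , p') (q , q') = ℕₚ.≤-trans p q , ℕₚ.≤-trans p' q'

  outer≢mark : ∀ {F q col π} → Described F q col π → ∀ {v e} → InGrid m k v → Outer v → F v ≢ mark e
  outer≢mark D v∈ o eq = let i , eq' = Described.outer-chain D v∈ o in mark≢chain (trans (sym eq) eq')

  module _ {F F' : V → Colour} {q q' : ℕ → Fin (suc m)} {col col' : ℕ → Fin 3} {π : Fin m → Fin m}
           (D : Described F q col π) (D' : Described F' q' col' π)
           (agree : ∀ {v} → InGrid m k v → Outer v → F' v ≡ F v) where

    private
      module D  = Described D
      module D' = Described D'
      open Levels D'.levels

    chain-colour-≤ : ∀ {i M N} → Card (λ v → InGrid m k v × F v ≡ chain i) M → Card (λ v → InGrid m k v × F' v ≡ chain i) N → M ≤ N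
    chain-colour-≤ {i} c c' = card-≤ c c' (λ (v∈ , _) → relocate {q' = q'} (view q v∈)) (λ (v∈ , eq) → moved (view q v∈) v∈ eq)
      (λ (v∈ , _) (w∈ , _) → relocate-injective (view q v∈) (view q w∈))
      where
      moved : ∀ {v} (p : View q v) → InGrid m k v → F v ≡ chain i → InGrid m k (relocate {q' = q'} p) × F' (relocate {q' = q'} p) ≡ chain i
      moved (outer o)        v∈ eq = v∈ , trans (agree v∈ o) eq
      moved (marked t t≤k)   v∈ eq = ⊥-elim (mark≢chain (trans (sym (D.marks t≤k)) eq))
      moved (linked t j t≤k) v∈ eq = level-inGrid _ t≤k , trans (D'.chains t≤ j) (trans (sym (D.chains t≤ j)) eq)
        where t≤ = s≤s (ℕₚ.m≤n⇒m≤1+n t≤k)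

    module _ (proper : Proper m k F) (separated : Separated q' col') where

      -- Two middle vertices of one chain are comparable by `linked-⊑`. A middle and an outer vertex
      -- are compared through the vertex of that chain on level 0 or k + 2: there `F` and `F'`
      -- agree, and properness of `F` covers the outer half.
      proper-transfer : Proper m k F'
      proper-transfer {v} {w} v∈ w∈ le eq = compare (view q' v∈) (view q' w∈) v∈ w∈ le eq
        where
        up : ∀ {t} → t ≤ k → suc t ≤ 2 + k
        up t≤k = s≤s (ℕₚ.m≤n⇒m≤1+n t≤k)

        end : ℕ → Fin m → V
        end t i = level t (punchIn (q' t) i)

        end-inGrid : ∀ t i → t ≤ 2 + k → InGrid m k (end t i)
        end-inGrid t i = linked-inGrid {q = q'} first last i

        rank-low : ∀ i → rank m k (end 0 i) ≡ m
        rank-low i = trans (rank-level 0 (punchIn (q' 0) i)) (ℕₚ.+-identityʳ m)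

        rank-high : ∀ i → rank m k (end (2 + k) i) ≡ 2 + m + k
        rank-high i = trans (rank-level (2 + k) (punchIn (q' (2 + k)) i)) (trans (ℕₚ.+-suc m (suc k)) (cong suc (ℕₚ.+-suc m k)))

        end-colour : ∀ t i → t ≤ 2 + k → Outer (end t i) → F (end t i) ≡ chain (π i)
        end-colour t i t≤ o = trans (sym (agree (end-inGrid t i t≤) o)) (D'.chains t≤ i)

        low-colour : ∀ i → F (end 0 i) ≡ chain (π i)
        low-colour i = end-colour 0 i z≤n (inj₁ (ℕₚ.≤-reflexive (rank-low i)))

        high-colour : ∀ i → F (end (2 + k) i) ≡ chain (π i)
        high-colour i = end-colour (2 + k) i ℕₚ.≤-refl (inj₂ (ℕₚ.≤-reflexive (sym (rank-high i))))

        t-≤ : ∀ {t t' j j'} → rank m k (level (suc t) j) ≤ rank m k (level (suc t') j') → t ≤ t'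
        t-≤ {t} {t'} {j} {j'} le = ℕ.s≤s⁻¹ (ℕₚ.+-cancelˡ-≤ m _ _ (subst₂ _≤_ (rank-level (suc t) j) (rank-level (suc t') j') le))

        compare : ∀ {v w} → View q' v → View q' w → InGrid m k v → InGrid m k w → rank m k v ≤ rank m k w → F' v ≡ F' w → _⊑_ m k v w
        compare (outer o) (outer o') v∈ w∈ le eq = proper v∈ w∈ le (trans (sym (agree v∈ o)) (trans eq (agree w∈ o')))
        compare (outer o) (marked t t≤k) v∈ w∈ le eq = ⊥-elim (outer≢mark D' v∈ o (trans eq (D'.marks t≤k)))
        compare (marked t t≤k) (outer o) v∈ w∈ le eq = ⊥-elim (outer≢mark D' w∈ o (trans (sym eq) (D'.marks t≤k)))
        compare (marked t t≤k) (linked t' i t'≤k) v∈ w∈ le eq =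
          ⊥-elim (mark≢chain (trans (sym (D'.marks t≤k)) (trans eq (D'.chains (up t'≤k) i))))
        compare (linked t i t≤k) (marked t' t'≤k) v∈ w∈ le eq =
          ⊥-elim (mark≢chain (trans (sym (D'.marks t'≤k)) (trans (sym eq) (D'.chains (up t≤k) i))))
        compare (marked t t≤k) (marked t' t'≤k) v∈ w∈ le eq
          with t≤t' ← t-≤ {t} {t'} {q' (suc t)} {q' (suc t')} le
          rewrite separated t≤k t'≤k (mark-injective (trans (sym (D'.marks t≤k)) (trans eq (D'.marks t'≤k)))) =
          ℕₚ.+-monoʳ-≤ (m ∸ toℕ (q' (suc t'))) (s≤s t≤t') , ℕₚ.≤-refl
        compare (linked t i t≤k) (linked t' i' t'≤k) v∈ w∈ le eq
          with refl ← D'.π-injective (chain-injective (trans (sym (D'.chains (up t≤k) i)) (trans eq (D'.chains (up t'≤k) i')))) =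
          linked-⊑ D'.levels i (s≤s (t-≤ {t} {t'} {punchIn (q' (suc t)) i} {punchIn (q' (suc t')) i} le)) (up t'≤k)
        compare {v} (outer (inj₁ p)) (linked t i t≤k) v∈ w∈ le eq = ⊑-trans {v} {end 0 i}
          (proper v∈ (end-inGrid 0 i z≤n) (subst (rank m k v ≤_) (sym (rank-low i)) p)
            (trans (sym (agree v∈ (inj₁ p))) (trans eq (trans (D'.chains (up t≤k) i) (sym (low-colour i))))))
          (linked-⊑ D'.levels i z≤n (up t≤k))
        compare (outer (inj₂ p)) (linked t i t≤k) v∈ w∈ le eq = ⊥-elim (not-outer (punchIn (q' (suc t)) i) t≤k (inj₂ (ℕₚ.≤-trans p le)))
        compare (linked t i t≤k) (outer (inj₁ p)) v∈ w∈ le eq = ⊥-elim (not-outer (punchIn (q' (suc t)) i) t≤k (inj₁ (ℕₚ.≤-trans le p)))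
        compare {w = w} (linked t i t≤k) (outer (inj₂ p)) v∈ w∈ le eq = ⊑-trans {level (suc t) (punchIn (q' (suc t)) i)} {end (2 + k) i} {w}
          (linked-⊑ D'.levels i (up t≤k) ℕₚ.≤-refl)
          (proper (end-inGrid (2 + k) i ℕₚ.≤-refl) w∈ (subst (_≤ rank m k w) (sym (rank-high i)) p)
            (trans (high-colour i) (trans (sym (D'.chains (up t≤k) i)) (trans eq (agree w∈ (inj₂ p))))))

-- Repainting the middle ranks

module _ (m k : ℕ) where

  private
    V = Vertex m k
    Colour = Fin (3 + m)
    Colouring = Vec Colour (Size m k)

  base : Fin m → V
  base i = level m k 0 (punchIn (fromℕ m) i)

  base-inGrid : ∀ i → InGrid m k (base i)
  base-inGrid i = linked-inGrid m k {q = extend m k (λ _ → zero)} refl (extend-last m k (λ _ → zero)) i z≤n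

  base-outer : ∀ i → Outer m k (base i)
  base-outer i = inj₁ (ℕₚ.≤-reflexive (trans (rank-level m k 0 (punchIn (fromℕ m) i)) (ℕₚ.+-identityʳ m)))

  module _ {q : ℕ → Fin (suc m)} (col : ℕ → Fin 3) where

    -- A chain vertex copies the colour that its chain has on level 0. So the result depends on `F`
    -- through outer vertices only, and no `π` has to be chosen.
    paint : (V → Colour) → ∀ {v} → View m k q v → Colour
    paint F {v} (outer _)      = F v
    paint F     (marked t _)   = mark (col t)
    paint F     (linked t i _) = F (base i)

    paint-unique : ∀ F {v w} (p : View m k q v) (p' : View m k q w) → v ≡ w → paint F p ≡ paint F p'
    paint-unique F (outer _) (outer _) eq = cong F eq
    paint-unique F (outer o) (marked t t≤k) refl = ⊥-elim (not-outer m k (q (suc t)) t≤k o)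
    paint-unique F (outer o) (linked t i t≤k) refl = ⊥-elim (not-outer m k (punchIn (q (suc t)) i) t≤k o)
    paint-unique F (marked t t≤k) (outer o) refl = ⊥-elim (not-outer m k (q (suc t)) t≤k o)
    paint-unique F (linked t i t≤k) (outer o) refl = ⊥-elim (not-outer m k (punchIn (q (suc t)) i) t≤k o)
    paint-unique F (marked t _) (marked t' _) eq = cong (mark ∘ col) (ℕₚ.suc-injective (proj₁ (level-injective m k {j = q (suc t)} {q (suc t')} eq)))
    paint-unique F (marked t _) (linked t' i _) eq with level-injective m k {suc t} {suc t'} {q (suc t)} {punchIn (q (suc t')) i} eq
    ... | refl , j≡ = ⊥-elim (Finₚ.punchInᵢ≢i (q (suc t)) i (sym j≡))
    paint-unique F (linked t i _) (marked t' _) eq with level-injective m k {suc t} {suc t'} {punchIn (q (suc t)) i} {q (suc t')} eq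
    ... | refl , j≡ = ⊥-elim (Finₚ.punchInᵢ≢i (q (suc t)) i j≡)
    paint-unique F (linked t i _) (linked t' i' _) eq
      with level-injective m k {suc t} {suc t'} {punchIn (q (suc t)) i} {punchIn (q (suc t')) i'} eq
    ... | refl , j≡ = cong (F ∘ base) (Finₚ.punchIn-injective (q (suc t)) i i' j≡)

    paint-cong : ∀ {F F'} → (∀ {v} → InGrid m k v → Outer m k v → F v ≡ F' v) → ∀ {v} → InGrid m k v →
                 (p : View m k q v) → paint F p ≡ paint F' p
    paint-cong agree v∈ (outer o)      = agree v∈ o
    paint-cong agree v∈ (marked t _)   = refl
    paint-cong agree v∈ (linked t i _) = agree (base-inGrid i) (base-outer i)

  repainted : (ℕ → Fin (suc m)) → (ℕ → Fin 3) → Colouring → Fin (Size m k) → Colour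
  repainted q col κ x = paint col (at m k κ) (view m k q (coords-inGrid m k x))

  abstract
    repaint : (ℕ → Fin (suc m)) → (ℕ → Fin 3) → Colouring → Colouring
    repaint q col κ = Vec.tabulate (repainted q col κ)

    at-repaint : ∀ q col κ {v} → InGrid m k v → (p : View m k q v) → at m k (repaint q col κ) v ≡ paint col (at m k κ) p
    at-repaint q col κ {v} v∈ p = trans (Vecₚ.lookup∘tabulate (repainted q col κ) (vertex m k v))
      (paint-unique col (at m k κ) (view m k q (coords-inGrid m k (vertex m k v))) p (coords-vertex m k v∈))

  repaint-outer : ∀ q col κ {v} → InGrid m k v → Outer m k v → at m k (repaint q col κ) v ≡ at m k κ v
  repaint-outer q col κ v∈ o = at-repaint q col κ v∈ (outer o)

  outer-top : ∀ j → Outer m k (level m k (2 + k) j)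
  outer-top j = inj₂ (ℕₚ.≤-reflexive (sym (trans (rank-level m k (2 + k) j) (trans (ℕₚ.+-suc m (suc k)) (cong suc (ℕₚ.+-suc m k))))))

  repaint-described : ∀ {q q' col col' π} κ → Described m k (at m k κ) q col π → Levels m k q' →
                      Described m k (at m k (repaint q' col' κ)) q' col' π
  repaint-described {q} {q'} {col} {col'} {π} κ D levels' = record
    { levels      = levels'
    ; marks       = λ {t} t≤k → at-repaint q' col' κ (level-inGrid m k (q' (suc t)) t≤k) (marked t t≤k)
    ; chains      = λ {t} → chains' t
    ; π-injective = D.π-injective
    ; outer-chain = λ v∈ o → let i , eq = D.outer-chain v∈ o in i , trans (repaint-outer q' col' κ v∈ o) eq
    }
    where
    module D = Described D
    open Levels
    κ' = repaint q' col' κ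

    base-chain : ∀ i → at m k κ (base i) ≡ chain (π i)
    base-chain i = trans (cong (λ x → at m k κ (level m k 0 (punchIn x i))) (sym (first D.levels))) (D.chains z≤n i)

    inGrid' : ∀ {t} i → t ≤ 2 + k → InGrid m k (level m k t (punchIn (q' t) i))
    inGrid' = linked-inGrid m k {q = q'} (first levels') (last levels')

    chains' : ∀ t → t ≤ 2 + k → ∀ i → at m k κ' (level m k t (punchIn (q' t) i)) ≡ chain (π i)
    chains' zero t≤ i = trans (cong (λ x → at m k κ' (level m k 0 (punchIn x i))) (first levels'))
      (trans (repaint-outer q' col' κ (base-inGrid i) (base-outer i)) (base-chain i))
    chains' (suc t) t≤ i with t ℕₚ.≤? k
    ... | yes t≤k = trans (at-repaint q' col' κ (inGrid' i t≤) (linked t i t≤k)) (base-chain i)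
    ... | no t≰k with ℕₚ.≤-antisym (ℕ.s≤s⁻¹ t≤) (ℕₚ.≰⇒> t≰k)
    ...   | refl = trans (repaint-outer q' col' κ (inGrid' i t≤) (outer-top (punchIn (q' (2 + k)) i)))
      (trans (cong (λ x → at m k κ (level m k (2 + k) (punchIn x i))) (trans (last levels') (sym (last D.levels)))) (D.chains ℕₚ.≤-refl i))

  -- A described colouring is determined by its outer part together with `q` and `col`. No
  -- repainting alters the outer part, so repainting with the original data undoes any other
  -- repainting.
  repaint-repaint : ∀ {q q' col col' π} κ → Described m k (at m k κ) q col π → repaint q col (repaint q' col' κ) ≡ κ
  repaint-repaint {q} {q'} {col} {col'} {π} κ D = at-injective m k {κ = repaint q col (repaint q' col' κ)} {κ} λ {v} v∈ → let p = view m k q v∈ in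
    trans (at-repaint q col (repaint q' col' κ) v∈ p)
    (trans (paint-cong col {at m k (repaint q' col' κ)} {at m k κ} (repaint-outer q' col' κ) v∈ p) (own v∈ p))
    where
    module D = Described D
    own : ∀ {v} → InGrid m k v → (p : View m k q v) → paint col (at m k κ) p ≡ at m k κ v
    own v∈ (outer _)        = refl
    own v∈ (marked t t≤k)   = sym (D.marks t≤k)
    own v∈ (linked t i t≤k) = trans (trans (cong (λ x → at m k κ (level m k 0 (punchIn x i))) (sym (Levels.first D.levels))) (D.chains z≤n i))
      (sym (D.chains (s≤s (ℕₚ.m≤n⇒m≤1+n t≤k)) i))

  module _ {F : V → Colour} {q : ℕ → Fin (suc m)} {col : ℕ → Fin 3} {π : Fin m → Fin m} (D : Described m k F q col π) where
    open Described D

    mark-level : ∀ {v e} → InGrid m k v → F v ≡ mark e → ∃[ t ] t ≤ k × v ≡ level m k (suc t) (q (suc t)) × col t ≡ e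
    mark-level v∈ eq with view m k q v∈
    ... | outer o        = ⊥-elim (outer≢mark m k D v∈ o eq)
    ... | marked t t≤k   = t , t≤k , refl , mark-injective (trans (sym (marks t≤k)) eq)
    ... | linked t i t≤k = ⊥-elim (mark≢chain (trans (sym eq) (chains (s≤s (ℕₚ.m≤n⇒m≤1+n t≤k)) i)))

    card-marks : ∀ {e N} → Card (λ (t : Fin (suc k)) → col (toℕ t) ≡ e) N → Card (λ v → InGrid m k v × F v ≡ mark e) N
    card-marks {e} = card-⇔ (λ t → level m k (suc (toℕ t)) (q (suc (toℕ t))))
      (λ {t} {t'} eq → Finₚ.toℕ-injective (ℕₚ.suc-injective (proj₁ (level-injective m k {j = q (suc (toℕ t))} {q (suc (toℕ t'))} eq))))
      (λ {t} eq → level-inGrid m k (q (suc (toℕ t))) (t≤k t) , trans (marks (t≤k t)) (cong mark eq))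
      (λ (v∈ , eq) → let t , t≤ , v≡ , c≡ = mark-level v∈ eq in
        clamp t , trans (cong col (toℕ-clamp t≤)) c≡ , trans v≡ (cong (λ x → level m k (suc x) (q (suc x))) (sym (toℕ-clamp t≤))))
      where
      t≤k : (t : Fin (suc k)) → toℕ t ≤ k
      t≤k t = ℕ.s≤s⁻¹ (Finₚ.toℕ<n t)

    -- Along levels the row of the exceptional vertex weakly decreases, whereas among comparable
    -- vertices of growing rank it weakly increases.
    separated : Proper m k F → Separated m k q col
    separated proper {t} {t'} t≤k t'≤k eq = [ (λ le → sym (same le t≤k t'≤k eq)) , (λ le → same le t'≤k t≤k (sym eq)) ]′ (ℕₚ.≤-total t t')
      where
      same : ∀ {t t'} → t ≤ t' → t ≤ k → t' ≤ k → col t ≡ col t' → q (suc t') ≡ q (suc t)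
      same {t} {t'} t≤t' t≤k t'≤k eq = Finₚ.toℕ-injective (ℕₚ.≤-antisym
        (Levels.antitone levels (s≤s t≤t') (s≤s (ℕₚ.m≤n⇒m≤1+n t'≤k)))
        (proj₂ (proper (level-inGrid m k (q (suc t)) t≤k) (level-inGrid m k (q (suc t')) t'≤k)
          (subst₂ _≤_ (sym (rank-level m k (suc t) (q (suc t)))) (sym (rank-level m k (suc t') (q (suc t')))) (ℕₚ.+-monoʳ-≤ m (s≤s t≤t')))
          (trans (marks t≤k) (trans (cong mark eq) (sym (marks t'≤k)))))))

  described-cong : ∀ {F q q' col col' π} → (∀ {t} → t ≤ 2 + k → q t ≡ q' t) → (∀ {t} → t ≤ k → col t ≡ col' t) →
                   Described m k F q col π → Described m k F q' col' π
  described-cong {F} {q} {q'} {col} {col'} {π} q≡ col≡ D = record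
    { levels      = record
      { first    = trans (sym (q≡ z≤n)) (first levels)
      ; last     = trans (sym (q≡ ℕₚ.≤-refl)) (last levels)
      ; antitone = λ t≤t' t'≤ → subst₂ _≤_ (cong toℕ (q≡ t'≤)) (cong toℕ (q≡ (ℕₚ.≤-trans t≤t' t'≤))) (antitone levels t≤t' t'≤)
      }
    ; marks       = λ {t} t≤k → trans (cong (λ x → F (level m k (suc t) x)) (sym (q≡ (s≤s (ℕₚ.m≤n⇒m≤1+n t≤k))))) (trans (marks t≤k) (cong mark (col≡ t≤k)))
    ; chains      = λ {t} t≤ i → trans (cong (λ x → F (level m k t (punchIn x i))) (sym (q≡ t≤))) (chains t≤ i)
    ; π-injective = π-injective
    ; outer-chain = outer-chain
    }
    where
    open Described D
    open Levels

-- Words with prescribed content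

#-here : ∀ {n} (d : Fin n) c → # d (d ∷ c) ≡ suc (# d c)
#-here d c with d Finₚ.≟ d
... | yes _ = refl
... | no ≢d = ⊥-elim (≢d refl)

#-there : ∀ {n} {d e : Fin n} c → d ≢ e → # e (d ∷ c) ≡ # e c
#-there {d = d} {e} c d≢e with d Finₚ.≟ e
... | yes d≡e = ⊥-elim (d≢e d≡e)
... | no _    = refl

#-replicate : ∀ {n} (d : Fin n) x → # d (replicate x d) ≡ x
#-replicate d zero    = refl
#-replicate d (suc x) = trans (#-here d (replicate x d)) (cong suc (#-replicate d x))

#-replicate-≢ : ∀ {n} {d e : Fin n} x → d ≢ e → # e (replicate x d) ≡ 0
#-replicate-≢ zero    _   = refl
#-replicate-≢ (suc x) d≢e = trans (#-there (replicate x _) d≢e) (#-replicate-≢ x d≢e)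

letters-occur : ∀ {n} (c : List (Fin n)) → All (λ e → 0 < # e c) c
letters-occur []      = []
letters-occur (d ∷ c) = subst (0 <_) (sym (#-here d c)) (s≤s z≤n) ∷ All.map (λ {e} 0<e → ℕₚ.≤-trans 0<e (weaken e)) (letters-occur c)
  where
  weaken : ∀ e → # e c ≤ # e (d ∷ c)
  weaken e with d Finₚ.≟ e
  ... | yes refl = ℕₚ.n≤1+n _
  ... | no _     = ℕₚ.≤-refl

tri : ℕ → ℕ → ℕ → Fin 3 → ℕ
tri x y z 0F = x
tri x y z 1F = y
tri x y z 2F = z

Content : (Fin 3 → ℕ) → List (Fin 3) → Set
Content b c = ∀ d → # d c ≡ b d

-- The multinomial coefficient, by the recursion on the first letter of a word. The zero summands
-- make its value the literal sum of the three counts in `card-by-head`.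
mult : ℕ → ℕ → ℕ → ℕ
mult zero    zero    zero    = 1
mult zero    zero    (suc z) = 0 + (0 + mult 0 0 z)
mult zero    (suc y) zero    = 0 + (mult 0 y 0 + 0)
mult zero    (suc y) (suc z) = 0 + (mult 0 y (suc z) + mult 0 (suc y) z)
mult (suc x) zero    zero    = mult x 0 0 + (0 + 0)
mult (suc x) zero    (suc z) = mult x 0 (suc z) + (0 + mult (suc x) 0 z)
mult (suc x) (suc y) zero    = mult x (suc y) 0 + (mult (suc x) y 0 + 0)
mult (suc x) (suc y) (suc z) = mult x (suc y) (suc z) + (mult (suc x) y (suc z) + mult (suc x) (suc y) z)

mult-00 : ∀ z → mult 0 0 z ≡ 1
mult-00 zero    = refl
mult-00 (suc z) = mult-00 z

mult-0-0 : ∀ y → mult 0 y 0 ≡ 1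
mult-0-0 zero    = refl
mult-0-0 (suc y) = trans (ℕₚ.+-identityʳ _) (mult-0-0 y)

Headed : Fin 3 → (List (Fin 3) → Set) → List (Fin 3) → Set
Headed d P c = ∃[ c' ] c ≡ d ∷ c' × P c

card-headed : ∀ {d b b' N} → b d ≡ suc (b' d) → (∀ e → e ≢ d → b e ≡ b' e) → Card (Content b') N → Card (Headed d (Content b)) N
card-headed {d} {b} {b'} at-d off-d = card-⇔ (d ∷_) Listₚ.∷-injectiveʳ
  (λ {c} h → c , refl , λ e → prepend e c h)
  (λ { (c , refl , h) → c , (λ e → behead e c h) , refl })
  where
  prepend : ∀ e c → Content b' c → # e (d ∷ c) ≡ b e
  prepend e c h with d Finₚ.≟ e
  ... | yes refl = trans (cong suc (h d)) (sym at-d)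
  ... | no d≢e   = trans (h e) (sym (off-d e (d≢e ∘ sym)))
  behead : ∀ e c → Content b (d ∷ c) → # e c ≡ b' e
  behead e c h with d Finₚ.≟ e | h e
  ... | yes refl | eq = ℕₚ.suc-injective (trans eq at-d)
  ... | no d≢e   | eq = trans eq (off-d e (d≢e ∘ sym))

card-headed-0 : ∀ {d b} → b d ≡ 0 → Card (Headed d (Content b)) 0
card-headed-0 {d} b≡0 = card-⊥ λ { {_} (c , refl , h) → ℕₚ.0≢1+n (trans (sym b≡0) (trans (sym (h d)) (#-here d c))) }

card-by-head : ∀ {b N₀ N₁ N₂} → ¬ Content b [] → Card (Headed 0F (Content b)) N₀ → Card (Headed 1F (Content b)) N₁ →
               Card (Headed 2F (Content b)) N₂ → Card (Content b) (N₀ + (N₁ + N₂))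
card-by-head ¬[] c₀ c₁ c₂ = card-cong
  (λ { (inj₁ (_ , _ , h)) → h ; (inj₂ (inj₁ (_ , _ , h))) → h ; (inj₂ (inj₂ (_ , _ , h))) → h })
  (λ { {[]} h → ⊥-elim (¬[] h) ; {0F ∷ c} h → inj₁ (c , refl , h) ; {1F ∷ c} h → inj₂ (inj₁ (c , refl , h)) ; {2F ∷ c} h → inj₂ (inj₂ (c , refl , h)) })
  (card-⊎ (λ { (_ , refl , _) (inj₁ (_ , () , _)) ; (_ , refl , _) (inj₂ (_ , () , _)) }) c₀
    (card-⊎ (λ { (_ , refl , _) (_ , () , _) }) c₁ c₂))

other-0 : ∀ {x x' y z} e → e ≢ 0F → tri x y z e ≡ tri x' y z e
other-0 0F e≢ = ⊥-elim (e≢ refl)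
other-0 1F _  = refl
other-0 2F _  = refl

other-1 : ∀ {x y y' z} e → e ≢ 1F → tri x y z e ≡ tri x y' z e
other-1 0F _  = refl
other-1 1F e≢ = ⊥-elim (e≢ refl)
other-1 2F _  = refl

other-2 : ∀ {x y z z'} e → e ≢ 2F → tri x y z e ≡ tri x y z' e
other-2 0F _  = refl
other-2 1F _  = refl
other-2 2F e≢ = ⊥-elim (e≢ refl)

card-content : ∀ x y z → Card (Content (tri x y z)) (mult x y z)
card-content zero zero zero = card-cong (λ { refl 0F → refl ; refl 1F → refl ; refl 2F → refl })
  (λ { {[]} _ → refl ; {d ∷ c} h → ⊥-elim (ℕₚ.0≢1+n (trans (sym (zeros d)) (trans (sym (h d)) (#-here d c)))) }) (card-singleton [])
  where
  zeros : ∀ d → tri 0 0 0 d ≡ 0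
  zeros 0F = refl
  zeros 1F = refl
  zeros 2F = refl
card-content zero zero (suc z) = card-by-head (λ h → ℕₚ.0≢1+n (h 2F))
  (card-headed-0 refl) (card-headed-0 refl) (card-headed refl other-2 (card-content 0 0 z))
card-content zero (suc y) zero = card-by-head (λ h → ℕₚ.0≢1+n (h 1F))
  (card-headed-0 refl) (card-headed refl other-1 (card-content 0 y 0)) (card-headed-0 refl)
card-content zero (suc y) (suc z) = card-by-head (λ h → ℕₚ.0≢1+n (h 1F))
  (card-headed-0 refl) (card-headed refl other-1 (card-content 0 y (suc z))) (card-headed refl other-2 (card-content 0 (suc y) z))
card-content (suc x) zero zero = card-by-head (λ h → ℕₚ.0≢1+n (h 0F))
  (card-headed refl other-0 (card-content x 0 0)) (card-headed-0 refl) (card-headed-0 refl)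
card-content (suc x) zero (suc z) = card-by-head (λ h → ℕₚ.0≢1+n (h 0F))
  (card-headed refl other-0 (card-content x 0 (suc z))) (card-headed-0 refl) (card-headed refl other-2 (card-content (suc x) 0 z))
card-content (suc x) (suc y) zero = card-by-head (λ h → ℕₚ.0≢1+n (h 0F))
  (card-headed refl other-0 (card-content x (suc y) 0)) (card-headed refl other-1 (card-content (suc x) y 0)) (card-headed-0 refl)
card-content (suc x) (suc y) (suc z) = card-by-head (λ h → ℕₚ.0≢1+n (h 0F))
  (card-headed refl other-0 (card-content x (suc y) (suc z))) (card-headed refl other-1 (card-content (suc x) y (suc z)))
  (card-headed refl other-2 (card-content (suc x) (suc y) z))

apart : ∀ {x y} → x ≢ y → x < y ⊎ y < x
apart {x} {y} x≢y with ℕₚ.<-cmp x y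
... | tri< x<y _ _ = inj₁ x<y
... | tri≈ _ x≡y _ = ⊥-elim (x≢y x≡y)
... | tri> _ _ y<x = inj₂ y<x

both : ∀ {a b c} → a ≡ b → a < c ⊎ c < a → (a < c × b < c) ⊎ (c < a × c < b)
both refl = Data.Sum.map (λ p → p , p) (λ p → p , p)

module _ (h : Fin 3 → ℕ) where

  -- `h` is the row of each colour: along the word, that is by increasing rank, the rows weakly
  -- decrease.
  Descending : List (Fin 3) → Set
  Descending = AllPairs (λ d e → h e ≤ h d)

  IsWord : (Fin 3 → ℕ) → List (Fin 3) → Set
  IsWord b c = Descending c × Content b c

  used : ∀ {b c} → Content b c → All (λ e → 0 < b e) c
  used {c = c} content = All.map (λ {e} → subst (0 <_) (content e)) (letters-occur c)

  card-flat : ∀ x y z → (∀ d e → 0 < tri x y z d → 0 < tri x y z e → h d ≡ h e) → Card (IsWord (tri x y z)) (mult x y z)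
  card-flat x y z flat = card-cong (λ content → descending (used content) , content) proj₂ (card-content x y z)
    where
    descending : ∀ {c} → All (λ e → 0 < tri x y z e) c → Descending c
    descending []       = []
    descending (d> ∷ p) = All.map (λ e> → ℕₚ.≤-reflexive (flat _ _ e> d>)) p ∷ descending p

  -- If the row of `l` is strictly above or strictly below that of every other letter that occurs,
  -- the copies of `l` form one block at the start or at the end of the word. Deleting the block is
  -- a bijection onto the words of content `b'`, which is `b` with `l` removed.
  module Strip {l : Fin 3} {b b' : Fin 3 → ℕ} (b'l≡0 : b' l ≡ 0) (off : ∀ e → e ≢ l → b' e ≡ b e) where

    content-block : ∀ {c} → Content b' c → ∀ e → # e (replicate (b l) l) + # e c ≡ b e
    content-block content e with l Finₚ.≟ e
    ... | yes refl = trans (cong₂ _+_ (#-replicate l (b l)) (trans (content l) b'l≡0)) (ℕₚ.+-identityʳ _)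
    ... | no l≢e   = trans (cong₂ _+_ (#-replicate-≢ (b l) l≢e) (content e)) (off e (l≢e ∘ sym))

    descending-block : ∀ x → Descending (replicate x l)
    descending-block zero    = []
    descending-block (suc x) = Allₚ.replicate⁺ x ℕₚ.≤-refl ∷ descending-block x

    not-l : ∀ {c} → Content b' c → All (λ e → e ≢ l × 0 < b e) c
    not-l {c} content = All.map (λ {e} 0<e → let e≢l = λ { refl → ℕₚ.<⇒≢ 0<e (sym b'l≡0) } in e≢l , subst (0 <_) (off e e≢l) 0<e) (used {b'} {c} content)

    off-content : ∀ {x c} → # l c ≡ 0 → (∀ e → # e (replicate x l) + # e c ≡ b e) → Content b' c
    off-content {x} {c} #l h e with l Finₚ.≟ e
    ... | yes refl = trans #l (sym b'l≡0)
    ... | no l≢e   = trans (trans (sym (cong (_+ # e c) (#-replicate-≢ x l≢e))) (h e)) (sym (off e (l≢e ∘ sym)))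

    block-size : ∀ {x w} → # l w ≡ 0 → # l (replicate x l) + # l w ≡ b l → x ≡ b l
    block-size {x} #l≡0 h = trans (sym (trans (cong₂ _+_ (#-replicate l x) #l≡0) (ℕₚ.+-identityʳ x))) h

    card-strip-top : ∀ {N} → (∀ e → e ≢ l → 0 < b e → h e < h l) → Card (IsWord b') N → Card (IsWord b) N
    card-strip-top top = card-⇔ (replicate (b l) l ++_) (Listₚ.++-cancelˡ (replicate (b l) l) _ _)
      (λ {w} (desc , content) →
        AllPairsₚ.++⁺ (descending-block (b l)) desc (Allₚ.replicate⁺ (b l) (All.map (λ (e≢l , 0<e) → ℕₚ.<⇒≤ (top _ e≢l 0<e)) (not-l {w} content))) ,
        λ e → trans (#-++ e (replicate (b l) l) w) (content-block {w} content e))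
      λ {c} (desc , content) → let
        x , w , eq , #l≡0 , desc' = split c desc (used {b} {c} content)
        counts = λ e → trans (sym (#-++ e (replicate x l) w)) (trans (cong (# e) (sym eq)) (content e))
        in w , (desc' , off-content {x} {w} #l≡0 counts) , trans eq (cong (λ x → replicate x l ++ w) (block-size {x} {w} #l≡0 (counts l)))
      where
      split : ∀ c → Descending c → All (λ e → 0 < b e) c → ∃[ x ] ∃[ w ] c ≡ replicate x l ++ w × # l w ≡ 0 × Descending w
      split []      _            _        = 0 , [] , refl , refl , []
      split (d ∷ c) (d≥ ∷ desc) (0<d ∷ p) with d Finₚ.≟ l
      ... | yes refl = let x , w , eq , rest = split c desc p in suc x , w , cong (l ∷_) eq , rest
      ... | no d≢l   = 0 , d ∷ c , refl , trans (#-there c d≢l) (none c d≥) , d≥ ∷ desc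
        where
        none : ∀ c → All (λ e → h e ≤ h d) c → # l c ≡ 0
        none []      _        = refl
        none (e ∷ c) (e≤ ∷ p) = trans (#-there {d = e} {l} c (λ { refl → ℕₚ.<⇒≱ (top d d≢l 0<d) e≤ })) (none c p)

    card-strip-bottom : ∀ {N} → (∀ e → e ≢ l → 0 < b e → h l < h e) → Card (IsWord b') N → Card (IsWord b) N
    card-strip-bottom bottom = card-⇔ (_++ replicate (b l) l) (Listₚ.++-cancelʳ (replicate (b l) l) _ _)
      (λ {w} (desc , content) →
        AllPairsₚ.++⁺ desc (descending-block (b l)) (All.map (λ (e≢l , 0<e) → Allₚ.replicate⁺ (b l) (ℕₚ.<⇒≤ (bottom _ e≢l 0<e))) (not-l {w} content)) ,
        λ e → trans (#-++ e w (replicate (b l) l)) (trans (ℕₚ.+-comm (# e w) _) (content-block {w} content e)))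
      λ {c} (desc , content) → let
        x , w , eq , #l≡0 , desc' = split c desc (used {b} {c} content)
        counts = λ e → trans (ℕₚ.+-comm _ (# e w)) (trans (sym (#-++ e w (replicate x l))) (trans (cong (# e) (sym eq)) (content e)))
        in w , (desc' , off-content {x} {w} #l≡0 counts) , trans eq (cong (λ x → w ++ replicate x l) (block-size {x} {w} #l≡0 (counts l)))
      where
      constant : ∀ c → All (λ e → h e ≤ h l) c → All (λ e → 0 < b e) c → c ≡ replicate (length c) l
      constant []      _         _         = refl
      constant (e ∷ c) (e≤ ∷ p) (0<e ∷ p') with e Finₚ.≟ l
      ... | yes refl = cong (l ∷_) (constant c p p')
      ... | no e≢l   = ⊥-elim (ℕₚ.<⇒≱ (bottom e e≢l 0<e) e≤)
      kept : ∀ {d c w x} → c ≡ w ++ replicate x l → All (λ e → h e ≤ h d) c → All (λ e → h e ≤ h d) w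
      kept {w = w} refl p = Allₚ.++⁻ˡ w p
      split : ∀ c → Descending c → All (λ e → 0 < b e) c → ∃[ x ] ∃[ w ] c ≡ w ++ replicate x l × # l w ≡ 0 × Descending w
      split []      _            _        = 0 , [] , refl , refl , []
      split (d ∷ c) (d≥ ∷ desc) (0<d ∷ p) with d Finₚ.≟ l
      ... | yes refl = suc (length c) , [] , cong (l ∷_) (constant c d≥ p) , refl , []
      ... | no d≢l   = let x , w , eq , #l≡0 , desc' = split c desc p in
        x , d ∷ w , cong (d ∷_) eq , trans (#-there w d≢l) #l≡0 , kept eq d≥ ∷ desc'

    card-strip : ∀ {N} → (∀ e → e ≢ l → 0 < b e → h e < h l) ⊎ (∀ e → e ≢ l → 0 < b e → h l < h e) → Card (IsWord b') N → Card (IsWord b) N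
    card-strip (inj₁ top)    = card-strip-top top
    card-strip (inj₂ bottom) = card-strip-bottom bottom

  strip-0 : ∀ {x y z N} → (h 1F < h 0F × h 2F < h 0F) ⊎ (h 0F < h 1F × h 0F < h 2F) → Card (IsWord (tri 0 y z)) N → Card (IsWord (tri x y z)) N
  strip-0 {x} {y} {z} p = Strip.card-strip {l = 0F} {tri x y z} refl other-0 (Data.Sum.map
    (λ (q₁ , q₂) → λ { 0F e≢ _ → ⊥-elim (e≢ refl) ; 1F _ _ → q₁ ; 2F _ _ → q₂ })
    (λ (q₁ , q₂) → λ { 0F e≢ _ → ⊥-elim (e≢ refl) ; 1F _ _ → q₁ ; 2F _ _ → q₂ }) p)

  strip-1 : ∀ {x y z N} → (h 0F < h 1F × h 2F < h 1F) ⊎ (h 1F < h 0F × h 1F < h 2F) → Card (IsWord (tri x 0 z)) N → Card (IsWord (tri x y z)) N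
  strip-1 {x} {y} {z} p = Strip.card-strip {l = 1F} {tri x y z} refl other-1 (Data.Sum.map
    (λ (q₁ , q₂) → λ { 1F e≢ _ → ⊥-elim (e≢ refl) ; 0F _ _ → q₁ ; 2F _ _ → q₂ })
    (λ (q₁ , q₂) → λ { 1F e≢ _ → ⊥-elim (e≢ refl) ; 0F _ _ → q₁ ; 2F _ _ → q₂ }) p)

  strip-2 : ∀ {x y z N} → (h 0F < h 2F × h 1F < h 2F) ⊎ (h 2F < h 0F × h 2F < h 1F) → Card (IsWord (tri x y 0)) N → Card (IsWord (tri x y z)) N
  strip-2 {x} {y} {z} p = Strip.card-strip {l = 2F} {tri x y z} refl other-2 (Data.Sum.map
    (λ (q₁ , q₂) → λ { 2F e≢ _ → ⊥-elim (e≢ refl) ; 0F _ _ → q₁ ; 1F _ _ → q₂ })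
    (λ (q₁ , q₂) → λ { 2F e≢ _ → ⊥-elim (e≢ refl) ; 0F _ _ → q₁ ; 1F _ _ → q₂ }) p)

  card-01 : ∀ x y → h 0F ≡ h 1F → Card (IsWord (tri x y 0)) (mult x y 0)
  card-01 x y eq = card-flat x y 0 λ { 0F 0F _ _ → refl ; 0F 1F _ _ → eq ; 1F 0F _ _ → sym eq ; 1F 1F _ _ → refl ; 0F 2F _ () ; 1F 2F _ () ; 2F _ () _ }

  card-02 : ∀ x z → h 0F ≡ h 2F → Card (IsWord (tri x 0 z)) (mult x 0 z)
  card-02 x z eq = card-flat x 0 z λ { 0F 0F _ _ → refl ; 0F 2F _ _ → eq ; 2F 0F _ _ → sym eq ; 2F 2F _ _ → refl }

  card-12 : ∀ y z → h 1F ≡ h 2F → Card (IsWord (tri 0 y z)) (mult 0 y z)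
  card-12 y z eq = card-flat 0 y z λ { 1F 1F _ _ → refl ; 1F 2F _ _ → eq ; 2F 1F _ _ → sym eq ; 2F 2F _ _ → refl }

  card-012 : ∀ x y z → h 0F ≡ h 1F → h 0F ≡ h 2F → Card (IsWord (tri x y z)) (mult x y z)
  card-012 x y z eq eq' = card-flat x y z λ d e _ _ → trans (sym (all d)) (all e)
    where
    all : ∀ d → h 0F ≡ h d
    all 0F = refl
    all 1F = eq
    all 2F = eq'

  card-0 : ∀ z → Card (IsWord (tri 0 0 z)) 1
  card-0 z = subst (Card _) (mult-00 z) (card-flat 0 0 z λ { 2F 2F _ _ → refl })

  card-1 : ∀ y → Card (IsWord (tri 0 y 0)) 1
  card-1 y = subst (Card _) (mult-0-0 y) (card-flat 0 y 0 λ { 1F 1F _ _ → refl ; 1F 2F _ () ; 2F _ () _ })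

  card-distinct-01 : ∀ x y → h 0F ≢ h 1F → Card (IsWord (tri x y 0)) 1
  card-distinct-01 x y ≢ = Strip.card-strip {l = 0F} {tri x y 0} refl other-0
    (Data.Sum.swap (Data.Sum.map (λ q → λ { 0F e≢ _ → ⊥-elim (e≢ refl) ; 1F _ _ → q ; 2F _ () }) (λ q → λ { 0F e≢ _ → ⊥-elim (e≢ refl) ; 1F _ _ → q ; 2F _ () }) (apart ≢)))
    (card-1 y)

  card-distinct-02 : ∀ x z → h 0F ≢ h 2F → Card (IsWord (tri x 0 z)) 1
  card-distinct-02 x z ≢ = Strip.card-strip {l = 0F} {tri x 0 z} refl other-0
    (Data.Sum.swap (Data.Sum.map (λ q → λ { 0F e≢ _ → ⊥-elim (e≢ refl) ; 2F _ _ → q }) (λ q → λ { 0F e≢ _ → ⊥-elim (e≢ refl) ; 2F _ _ → q }) (apart ≢)))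
    (card-0 z)

  card-distinct-12 : ∀ y z → h 1F ≢ h 2F → Card (IsWord (tri 0 y z)) 1
  card-distinct-12 y z ≢ = Strip.card-strip {l = 1F} {tri 0 y z} refl other-1
    (Data.Sum.swap (Data.Sum.map (λ q → λ { 1F e≢ _ → ⊥-elim (e≢ refl) ; 2F _ _ → q }) (λ q → λ { 1F e≢ _ → ⊥-elim (e≢ refl) ; 2F _ _ → q }) (apart ≢)))
    (card-0 z)

  -- The letter in the highest row forms the initial block; once it is stripped, two letters in
  -- different rows remain and their order is forced too.
  card-distinct : ∀ x y z → h 0F ≢ h 1F → h 0F ≢ h 2F → h 1F ≢ h 2F → Card (IsWord (tri x y z)) 1
  card-distinct x y z ≢₀₁ ≢₀₂ ≢₁₂ with apart ≢₀₁ | apart ≢₀₂ | apart ≢₁₂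
  ... | inj₂ 1<0 | inj₂ 2<0 | _        = strip-0 (inj₁ (1<0 , 2<0)) (card-distinct-12 y z ≢₁₂)
  ... | inj₂ 1<0 | inj₁ 0<2 | _        = strip-2 (inj₁ (0<2 , ℕₚ.<-trans 1<0 0<2)) (card-distinct-01 x y ≢₀₁)
  ... | inj₁ 0<1 | _        | inj₂ 2<1 = strip-1 (inj₁ (0<1 , 2<1)) (card-distinct-02 x z ≢₀₂)
  ... | inj₁ 0<1 | _        | inj₁ 1<2 = strip-2 (inj₁ (ℕₚ.<-trans 0<1 1<2 , 1<2)) (card-distinct-01 x y ≢₀₁)

-- Counting skeletons

Σᶠ-remove : ∀ {n} (i : Fin (suc n)) (f : Fin (suc n) → ℕ) → Σᶠ f ≡ f i + Σᶠ (f ∘ punchIn i)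
Σᶠ-remove {n}     zero    f = refl
Σᶠ-remove {suc n} (suc i) f = trans (cong (f zero +_) (Σᶠ-remove i (f ∘ suc)))
  (trans (sym (ℕₚ.+-assoc (f zero) _ _)) (trans (cong (_+ Σᶠ (f ∘ suc ∘ punchIn i)) (ℕₚ.+-comm (f zero) _)) (ℕₚ.+-assoc (f (suc i)) _ _)))

Σᶠ-const : ∀ {n} (f : Fin n → ℕ) {c} → (∀ i → f i ≡ c) → Σᶠ f ≡ n * c
Σᶠ-const {zero}  f eq = refl
Σᶠ-const {suc n} f eq = cong₂ _+_ (eq zero) (Σᶠ-const (f ∘ suc) (eq ∘ suc))

-- The data of the exceptional vertices: the row of each of the three colours, and the word of their
-- colours by increasing rank. One row per colour is enough because of `Separated`.
Skeleton : ℕ → Set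
Skeleton n = Fin n × Fin n × Fin n × List (Fin 3)

row-of : ∀ {n} → Skeleton n → Fin 3 → Fin n
row-of (g₀ , g₁ , g₂ , _) 0F = g₀
row-of (g₀ , g₁ , g₂ , _) 1F = g₁
row-of (g₀ , g₁ , g₂ , _) 2F = g₂

word-of : ∀ {n} → Skeleton n → List (Fin 3)
word-of (_ , _ , _ , c) = c

-- The row assigned to a colour that does not occur is normalised to zero.
IsSkeleton : ∀ {n} → (Fin 3 → ℕ) → Skeleton (suc n) → Set
IsSkeleton b s = IsWord (toℕ ∘ row-of s) b (word-of s) × (∀ d → b d ≡ 0 → row-of s d ≡ zero)

module _ (m : ℕ) where

  private
    height : ℕ
    height = suc (suc m)

  -- From here on `m` is n - 2 and `height` is n. The outer factor is the choice of the row of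
  -- colour 0; the first bracket puts colour 1 in the same row, the second in another. In
  -- `skeletons₂` colour 1 does not occur.
  skeletons₃ skeletons₂ : ℕ → ℕ → ℕ → ℕ
  skeletons₃ x y z = height * ((mult x y z + suc m * mult x y 0) + suc m * (mult x 0 z + (mult 0 y z + m)))
  skeletons₂ x _ z = height * (mult x 0 z + suc m)

  words-at : ℕ → ℕ → ℕ → Fin height → Fin height → Fin height → ℕ
  words-at x y z g₀ g₁ g₂ with g₀ Finₚ.≟ g₁ | g₀ Finₚ.≟ g₂ | g₁ Finₚ.≟ g₂
  ... | yes _ | yes _ | _     = mult x y z
  ... | yes _ | no _  | _     = mult x y 0
  ... | no _  | yes _ | _     = mult x 0 z
  ... | no _  | no _  | yes _ = mult 0 y z
  ... | no _  | no _  | no _  = 1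

  card-words-at : ∀ x y z g₀ g₁ g₂ → Card (λ c → IsWord (toℕ ∘ row-of (g₀ , g₁ , g₂ , c)) (tri x y z) c) (words-at x y z g₀ g₁ g₂)
  card-words-at x y z g₀ g₁ g₂ = card-cong (λ (d , c) → AllPairs.map (λ {e} {e'} → subst₂ _≤_ (h≗ e') (h≗ e)) d , c)
    (λ (d , c) → AllPairs.map (λ {e} {e'} → subst₂ _≤_ (sym (h≗ e')) (sym (h≗ e))) d , c) words
    where
    h : Fin 3 → ℕ
    h = tri (toℕ g₀) (toℕ g₁) (toℕ g₂)
    h≗ : ∀ {c} e → h e ≡ toℕ (row-of (g₀ , g₁ , g₂ , c) e)
    h≗ 0F = refl
    h≗ 1F = refl
    h≗ 2F = refl
    differ : ∀ {g g' : Fin height} → g ≢ g' → toℕ g ≢ toℕ g'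
    differ ≢ = ≢ ∘ Finₚ.toℕ-injective
    words : Card (IsWord h (tri x y z)) (words-at x y z g₀ g₁ g₂)
    words with g₀ Finₚ.≟ g₁ | g₀ Finₚ.≟ g₂ | g₁ Finₚ.≟ g₂
    ... | yes p | yes q | _ = card-012 h x y z (cong toℕ p) (cong toℕ q)
    ... | yes p | no q  | _     = strip-2 h (both (cong toℕ p) (apart (differ q))) (card-01 h x y (cong toℕ p))
    ... | no p  | yes q | _     = strip-1 h (both (cong toℕ q) (apart (differ p))) (card-02 h x z (cong toℕ q))
    ... | no p  | no q  | yes r = strip-0 h (both (cong toℕ r) (apart (differ (p ∘ sym)))) (card-12 h y z (cong toℕ r))
    ... | no p  | no q  | no r = card-distinct h x y z (differ p) (differ q) (differ r)

  module _ {x y z : ℕ} {g₀ g₁ g₂ : Fin height} where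

    words-at-012 : g₀ ≡ g₁ → g₀ ≡ g₂ → words-at x y z g₀ g₁ g₂ ≡ mult x y z
    words-at-012 p q with g₀ Finₚ.≟ g₁ | g₀ Finₚ.≟ g₂ | g₁ Finₚ.≟ g₂
    ... | yes _ | yes _ | _ = refl
    ... | yes _ | no ¬q | _ = ⊥-elim (¬q q)
    ... | no ¬p | _     | _ = ⊥-elim (¬p p)

    words-at-01 : g₀ ≡ g₁ → g₀ ≢ g₂ → words-at x y z g₀ g₁ g₂ ≡ mult x y 0
    words-at-01 p ¬q with g₀ Finₚ.≟ g₁ | g₀ Finₚ.≟ g₂ | g₁ Finₚ.≟ g₂
    ... | yes _ | yes q | _ = ⊥-elim (¬q q)
    ... | yes _ | no _  | _ = refl
    ... | no ¬p | _     | _ = ⊥-elim (¬p p)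

    words-at-02 : g₀ ≢ g₁ → g₀ ≡ g₂ → words-at x y z g₀ g₁ g₂ ≡ mult x 0 z
    words-at-02 ¬p q with g₀ Finₚ.≟ g₁ | g₀ Finₚ.≟ g₂ | g₁ Finₚ.≟ g₂
    ... | yes p | _     | _ = ⊥-elim (¬p p)
    ... | no _  | yes _ | _ = refl
    ... | no _  | no ¬q | _ = ⊥-elim (¬q q)

    words-at-12 : g₀ ≢ g₁ → g₁ ≡ g₂ → words-at x y z g₀ g₁ g₂ ≡ mult 0 y z
    words-at-12 ¬p r with g₀ Finₚ.≟ g₁ | g₀ Finₚ.≟ g₂ | g₁ Finₚ.≟ g₂
    ... | yes p | _     | _     = ⊥-elim (¬p p)
    ... | no _  | yes q | _     = ⊥-elim (¬p (trans q (sym r)))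
    ... | no _  | no _  | yes _ = refl
    ... | no _  | no _  | no ¬r = ⊥-elim (¬r r)

    words-at-distinct : g₀ ≢ g₁ → g₀ ≢ g₂ → g₁ ≢ g₂ → words-at x y z g₀ g₁ g₂ ≡ 1
    words-at-distinct ¬p ¬q ¬r with g₀ Finₚ.≟ g₁ | g₀ Finₚ.≟ g₂ | g₁ Finₚ.≟ g₂
    ... | yes p | _     | _     = ⊥-elim (¬p p)
    ... | no _  | yes q | _     = ⊥-elim (¬q q)
    ... | no _  | no _  | yes r = ⊥-elim (¬r r)
    ... | no _  | no _  | no _  = refl

  -- Fix `g₀`. If `g₁` equals it, one `g₂` agrees with both and `suc m` do not. For each of the
  -- `suc m` other `g₁`, the row `g₂` is `g₀`, or `g₁`, or one of `m` further rows, each of which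
  -- leaves a single word.
  Σ-words-at : ∀ x y z → Σᶠ (λ g₀ → Σᶠ (λ g₁ → Σᶠ (words-at x y z g₀ g₁))) ≡ skeletons₃ x y z
  Σ-words-at x y z = Σᶠ-const (λ g₀ → Σᶠ (λ g₁ → Σᶠ (words-at x y z g₀ g₁))) λ g₀ →
    trans (Σᶠ-remove g₀ (λ g₁ → Σᶠ (words-at x y z g₀ g₁)))
      (cong₂ _+_ (equal g₀) (Σᶠ-const (λ i → Σᶠ (words-at x y z g₀ (punchIn g₀ i))) (unequal g₀)))
    where
    ≢in : ∀ {n} (i : Fin (suc n)) j → i ≢ punchIn i j
    ≢in i j eq = Finₚ.punchInᵢ≢i i j (sym eq)
    equal : ∀ g₀ → Σᶠ (words-at x y z g₀ g₀) ≡ mult x y z + suc m * mult x y 0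
    equal g₀ = trans (Σᶠ-remove g₀ (words-at x y z g₀ g₀))
      (cong₂ _+_ (words-at-012 {x} {y} {z} {g₀} refl refl)
        (Σᶠ-const (λ i → words-at x y z g₀ g₀ (punchIn g₀ i)) (λ i → words-at-01 {x} {y} {z} {g₀} refl (≢in g₀ i))))
    unequal : ∀ g₀ (i : Fin (suc m)) → Σᶠ (words-at x y z g₀ (punchIn g₀ i)) ≡ mult x 0 z + (mult 0 y z + m)
    unequal g₀ i = trans (Σᶠ-remove g₀ (words-at x y z g₀ (punchIn g₀ i)))
      (cong₂ _+_ (words-at-02 {x} {y} {z} (≢in g₀ i) refl)
        (trans (Σᶠ-remove i (λ j → words-at x y z g₀ (punchIn g₀ i) (punchIn g₀ j)))
          (cong₂ _+_ (words-at-12 {x} {y} {z} (≢in g₀ i) refl)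
            (trans (Σᶠ-const (λ j → words-at x y z g₀ (punchIn g₀ i) (punchIn g₀ (punchIn i j)))
              (λ j → words-at-distinct {x} {y} {z} (≢in g₀ i) (≢in g₀ (punchIn i j)) (≢in i j ∘ Finₚ.punchIn-injective g₀ i (punchIn i j))))
              (ℕₚ.*-identityʳ m)))))

  card-skeletons₃ : ∀ x y z → Card (IsSkeleton {suc m} (tri (suc x) (suc y) (suc z))) (skeletons₃ (suc x) (suc y) (suc z))
  card-skeletons₃ x y z = subst (Card _) (Σ-words-at (suc x) (suc y) (suc z)) (card-cong (λ w → w , λ { 0F () ; 1F () ; 2F () }) proj₁
    (card-Σ (λ g₀ → card-Σ (λ g₁ → card-Σ (λ g₂ → card-words-at (suc x) (suc y) (suc z) g₀ g₁ g₂)))))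

  card-skeletons₂ : ∀ x z → Card (IsSkeleton {suc m} (tri (suc x) 0 (suc z))) (skeletons₂ (suc x) 0 (suc z))
  card-skeletons₂ x z = subst (Card _) total (card-⇔ (λ (g₀ , g₂ , c) → g₀ , zero , g₂ , c) (λ { refl → refl })
    (λ w → w , λ { 0F () ; 1F _ → refl ; 2F () }) (λ { {g₀ , g₁ , g₂ , c} (w , n) → (g₀ , g₂ , c) , at-zero (n 1F refl) w , cong (λ g → g₀ , g , g₂ , c) (n 1F refl) })
    (card-Σ (λ g₀ → card-Σ (λ g₂ → words g₀ g₂))))
    where
    at-zero : ∀ {g₀ g₁ g₂ : Fin height} {c b} → g₁ ≡ zero → IsWord (toℕ ∘ row-of (g₀ , g₁ , g₂ , c)) b c → IsWord (toℕ ∘ row-of (g₀ , zero , g₂ , c)) b c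
    at-zero refl w = w
    count : Fin height → Fin height → ℕ
    count g₀ g₂ with g₀ Finₚ.≟ g₂
    ... | yes _ = mult (suc x) 0 (suc z)
    ... | no _  = 1
    words : ∀ g₀ g₂ → Card (λ c → IsWord (toℕ ∘ row-of (g₀ , zero {suc m} , g₂ , c)) (tri (suc x) 0 (suc z)) c) (count g₀ g₂)
    words g₀ g₂ = card-cong (λ (d , c) → AllPairs.map (λ {e} {e'} → subst₂ _≤_ (h≗ e') (h≗ e)) d , c)
      (λ (d , c) → AllPairs.map (λ {e} {e'} → subst₂ _≤_ (sym (h≗ e')) (sym (h≗ e))) d , c) words'
      where
      h : Fin 3 → ℕ
      h = tri (toℕ g₀) 0 (toℕ g₂)
      h≗ : ∀ {c} e → h e ≡ toℕ (row-of (g₀ , zero {suc m} , g₂ , c) e)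
      h≗ 0F = refl
      h≗ 1F = refl
      h≗ 2F = refl
      words' : Card (IsWord h (tri (suc x) 0 (suc z))) (count g₀ g₂)
      words' with g₀ Finₚ.≟ g₂
      ... | yes p = card-02 h (suc x) (suc z) (cong toℕ p)
      ... | no p  = card-distinct-02 h (suc x) (suc z) (p ∘ Finₚ.toℕ-injective)
    total : Σᶠ (λ g₀ → Σᶠ (count g₀)) ≡ skeletons₂ (suc x) 0 (suc z)
    total = Σᶠ-const (λ g₀ → Σᶠ (count g₀)) λ g₀ → trans (Σᶠ-remove g₀ (count g₀)) (cong₂ _+_ (same g₀) (trans (Σᶠ-const (λ i → count g₀ (punchIn g₀ i)) (other g₀)) (ℕₚ.*-identityʳ (suc m))))
      where
      same : ∀ g → count g g ≡ mult (suc x) 0 (suc z)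
      same g with g Finₚ.≟ g
      ... | yes _ = refl
      ... | no ≢  = ⊥-elim (≢ refl)
      other : ∀ g (i : Fin (suc m)) → count g (punchIn g i) ≡ 1
      other g i with g Finₚ.≟ punchIn g i
      ... | yes eq = ⊥-elim (Finₚ.punchInᵢ≢i g i (sym eq))
      ... | no _   = refl

-- Every colouring is a reference colouring with a skeleton

record IsColouring {N : ℕ} (G : FinGraph N) (α : List ℕ) (κ : Vec (Fin (length α)) N) : Set where
  constructor mkColouring
  field
    proper  : T (properᵇ G κ)
    content : ∀ c → occ c κ ≡ lookup α c

card-chromCoeff : ∀ {N} (G : FinGraph N) α → Card (IsColouring G α) (chromCoeff G α)
card-chromCoeff {N} G α = card-cong
  (λ { {κ} (_ , h) → let p , q = ∧⁻ {properᵇ G κ} h in mkColouring p λ c → ==ℕ⁻ (allFinᵇ⁻ _ q c) })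
  (λ { {κ} (mkColouring p q) → ∈-allVecs ∈-allFin κ , ∧⁺ p (allᵇ⁺ _ (allFin (length α)) (λ c → ==ℕ⁺ (q c))) })
  (card-filter (λ κ → properᵇ G κ ∧ hasContent α κ) (unique-allVecs N (Uniqueₚ.allFin⁺ (length α))))

nth : List (Fin 3) → ℕ → Fin 3
nth []      _       = zero
nth (d ∷ c) zero    = d
nth (d ∷ c) (suc t) = nth c t

nth-injective : ∀ {n c c'} → length c ≡ n → length c' ≡ n → (∀ {t} → t < n → nth c t ≡ nth c' t) → c ≡ c'
nth-injective {c = []}    {[]}      _    _  _ = refl
nth-injective {c = []}    {_ ∷ _}   refl () _
nth-injective {c = _ ∷ _} {[]}      refl () _
nth-injective {c = d ∷ c} {d' ∷ c'} refl eq h = cong₂ _∷_ (h (s≤s z≤n)) (nth-injective refl (ℕₚ.suc-injective eq) (λ t< → h (s≤s t<)))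

nth-applyUpTo : ∀ f {n t} → t < n → nth (applyUpTo f n) t ≡ f t
nth-applyUpTo f {t = zero}  (s≤s _)  = refl
nth-applyUpTo f {t = suc t} (s≤s t<) = nth-applyUpTo (f ∘ suc) t<

nth-All : ∀ {P : Fin 3 → Set} {c} → All P c → ∀ {t} → t < length c → P (nth c t)
nth-All (p ∷ _) {zero}  _        = p
nth-All (_ ∷ p) {suc t} (s≤s t<) = nth-All p t<

nth-AllPairs : ∀ {R : Fin 3 → Fin 3 → Set} {c} → AllPairs R c → ∀ {t t'} → t < t' → t' < length c → R (nth c t) (nth c t')
nth-AllPairs (p ∷ _) {zero}  {suc t'} _        (s≤s t'<) = nth-All p t'<
nth-AllPairs (_ ∷ p) {suc t} {suc t'} (s≤s t<) (s≤s t'<) = nth-AllPairs p t< t'<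

card-nth : ∀ {n} c e → length c ≡ n → Card (λ (t : Fin n) → nth c (toℕ t) ≡ e) (# e c)
card-nth []      e refl = card-⊥ λ { {()} }
card-nth (d ∷ c) e refl with d Finₚ.≟ e
... | yes d≡e = card-cong
  (λ { (inj₁ refl) → d≡e ; (inj₂ (_ , eq , refl)) → eq })
  (λ { {zero} _ → inj₁ refl ; {suc t} eq → inj₂ (t , eq , refl) })
  (card-⊎ (λ { refl (_ , _ , ()) }) (card-singleton zero) (card-image suc Finₚ.suc-injective (card-nth c e refl)))
... | no d≢e = card-⇔ suc Finₚ.suc-injective id
  (λ { {zero} d≡e → ⊥-elim (d≢e d≡e) ; {suc t} eq → t , eq , refl }) (card-nth c e refl)

occurs : ∀ {d x} c → # d c ≡ suc x → ∃[ t ] t < length c × nth c t ≡ d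
occurs {d} (e ∷ c) eq with e Finₚ.≟ d
... | yes e≡d = 0 , s≤s z≤n , e≡d
... | no _    = let t , t< , c≡d = occurs c eq in suc t , s≤s t< , c≡d

length-content : ∀ (c : List (Fin 3)) → length c ≡ # 0F c + (# 1F c + # 2F c)
length-content []       = refl
length-content (0F ∷ c) = cong suc (length-content c)
length-content (1F ∷ c) = trans (cong suc (length-content c)) (sym (ℕₚ.+-suc (# 0F c) _))
length-content (2F ∷ c) = trans (cong suc (length-content c)) (trans (sym (ℕₚ.+-suc (# 0F c) _)) (cong (# 0F c +_) (sym (ℕₚ.+-suc (# 1F c) _))))

module _ (m k : ℕ) where

  private
    V = Vertex m k

  rows-of : Skeleton (suc m) → ℕ → Fin (suc m)
  rows-of s = extend m k (λ t → row-of s (nth (word-of s) (toℕ t)))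

  colours-of : Skeleton (suc m) → ℕ → Fin 3
  colours-of s = nth (word-of s)

  rows-of-≤ : ∀ s {t} → t ≤ k → rows-of s (suc t) ≡ row-of s (nth (word-of s) t)
  rows-of-≤ s t≤k = trans (extend-≤ m k _ t≤k) (cong (row-of s ∘ nth (word-of s)) (toℕ-clamp t≤k))

  HasSkeleton : (V → Fin (3 + m)) → Skeleton (suc m) → Set
  HasSkeleton F s = ∃[ π ] Described m k F (rows-of s) (colours-of s) π

  sum₃ : (Fin 3 → ℕ) → ℕ
  sum₃ b = b 0F + (b 1F + b 2F)

  module _ {b : Fin 3 → ℕ} (Σb : sum₃ b ≡ suc k) where

    length-word : ∀ c → Content b c → length c ≡ suc k
    length-word c h = trans (length-content c) (trans (cong₂ _+_ (h 0F) (cong₂ _+_ (h 1F) (h 2F))) Σb)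

    skeleton-levels : ∀ {s} → IsSkeleton b s → Levels m k (rows-of s)
    skeleton-levels {s} ((desc , content) , _) = record
      { first    = refl
      ; last     = extend-last m k _
      ; antitone = antitone-steps m k (rows-of s) step
      }
      where
      step : ∀ t → t ≤ suc k → toℕ (rows-of s (suc t)) ≤ toℕ (rows-of s t)
      step zero    _ = subst (toℕ (rows-of s 1) ≤_) (sym (Finₚ.toℕ-fromℕ m)) (ℕ.s≤s⁻¹ (Finₚ.toℕ<n (rows-of s 1)))
      step (suc t) (s≤s t≤k) with suc t ℕₚ.≤? k
      ... | yes t<k = subst₂ _≤_ (cong (toℕ ∘ row-of s ∘ nth (word-of s)) (sym (toℕ-clamp t<k))) (cong toℕ (sym (rows-of-≤ s t≤k)))
        (nth-AllPairs desc ℕₚ.≤-refl (subst (suc t <_) (sym (length-word (word-of s) content)) (s≤s t<k)))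
      ... | no _ = z≤n

    skeleton-separated : ∀ s → Separated m k (rows-of s) (colours-of s)
    skeleton-separated s t≤k t'≤k eq = trans (rows-of-≤ s t≤k) (trans (cong (row-of s) eq) (sym (rows-of-≤ s t'≤k)))

    -- The exceptional vertices show the word and the rows of the colours that occur; the other rows
    -- are fixed by the normalisation.
    skeleton-unique : ∀ {F s s'} → IsSkeleton b s → IsSkeleton b s' → HasSkeleton F s → HasSkeleton F s' → s ≡ s'
    skeleton-unique {F} {s@(_ , _ , _ , c)} {s'@(_ , _ , _ , c')} ((_ , content) , norm) ((_ , content') , norm') (_ , D) (_ , D') =
      assemble (row≡ 0F) (row≡ 1F) (row≡ 2F) word≡
      where
      module D = Described D
      module D' = Described D'
      assemble : ∀ {g₀ g₁ g₂ g₀' g₁' g₂' : Fin (suc m)} {c c'} → g₀ ≡ g₀' → g₁ ≡ g₁' → g₂ ≡ g₂' → c ≡ c' → (g₀ , g₁ , g₂ , c) ≡ (g₀' , g₁' , g₂' , c')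
      assemble refl refl refl refl = refl
      same : ∀ {t} → t ≤ k → nth c t ≡ nth c' t × row-of s (nth c t) ≡ row-of s' (nth c' t)
      same {t} t≤k with mark-level m k D' (level-inGrid m k (rows-of s (suc t)) t≤k) (D.marks t≤k)
      ... | t' , t'≤k , v≡ , c≡ with level-injective m k {suc t} {suc t'} {rows-of s (suc t)} {rows-of s' (suc t')} v≡
      ...   | refl , r≡ = sym c≡ , trans (sym (rows-of-≤ s t≤k)) (trans r≡ (rows-of-≤ s' t'≤k))
      word≡ : c ≡ c'
      word≡ = nth-injective (length-word c content) (length-word c' content') (λ t< → proj₁ (same (ℕ.s≤s⁻¹ t<)))
      row≡ : ∀ d → row-of s d ≡ row-of s' d
      row≡ d = cases (b d) refl
        where
        cases : ∀ x → b d ≡ x → row-of s d ≡ row-of s' d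
        cases zero    eq = trans (norm d eq) (sym (norm' d eq))
        cases (suc x) eq =
          let t , t< , c≡d  = occurs c (trans (content d) eq)
              c≡c' , r≡ = same (ℕ.s≤s⁻¹ (subst (t <_) (length-word c content) t<))
          in trans (cong (row-of s) (sym c≡d)) (trans r≡ (cong (row-of s') (trans (sym c≡c') c≡d)))

    skeleton-exists : ∀ {F q col π} → Proper m k F → Described m k F q col π → (∀ e → Card (λ v → InGrid m k v × F v ≡ mark e) (b e)) →
                      ∃[ s ] IsSkeleton b s × HasSkeleton F s
    skeleton-exists {F} {q} {col} {π} proper D card-b = s , ((desc , content) , norm) , π , described-cong m k q≡ col≡ D
      where
      open Described D
      open Levels levels
      found : ∀ d → Dec (∃[ t ] col (toℕ {suc k} t) ≡ d)
      found d = Finₚ.any? (λ t → col (toℕ t) Finₚ.≟ d)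
      -- The row of a colour is read off at any level where it occurs; by `separated` the choice of
      -- the level is immaterial.
      g : Fin 3 → Fin (suc m)
      g d with found d
      ... | yes (t , _) = q (suc (toℕ t))
      ... | no _        = zero
      g-col : ∀ {t} → t ≤ k → g (col t) ≡ q (suc t)
      g-col {t} t≤k with found (col t)
      ... | yes (t' , eq) = separated m k D proper (ℕ.s≤s⁻¹ (Finₚ.toℕ<n t')) t≤k eq
      ... | no none       = ⊥-elim (none (clamp t , cong col (toℕ-clamp t≤k)))
      c : List (Fin 3)
      c = applyUpTo col (suc k)
      s : Skeleton (suc m)
      s = g 0F , g 1F , g 2F , c
      row≗ : ∀ d → row-of s d ≡ g d
      row≗ 0F = refl
      row≗ 1F = refl
      row≗ 2F = refl
      col≡ : ∀ {t} → t ≤ k → col t ≡ nth c t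
      col≡ t≤k = sym (nth-applyUpTo col (s≤s t≤k))
      q≡ : ∀ {t} → t ≤ 2 + k → q t ≡ rows-of s t
      q≡ {zero}  _ = first
      q≡ {suc t} (s≤s t≤) with t ℕₚ.≤? k
      ... | yes t≤k = sym (trans (row≗ (nth c (toℕ (clamp {k} t)))) (trans (cong (λ x → g (nth c x)) (toℕ-clamp t≤k)) (trans (cong g (sym (col≡ t≤k))) (g-col t≤k))))
      ... | no t≰k with refl ← ℕₚ.≤-antisym t≤ (ℕₚ.≰⇒> t≰k) = last
      content : Content b c
      content e = card-unique (card-marks m k D (card-cong (λ {t} → trans (col≡ (ℕ.s≤s⁻¹ (Finₚ.toℕ<n t)))) (λ {t} → trans (sym (col≡ (ℕ.s≤s⁻¹ (Finₚ.toℕ<n t)))))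
        (card-nth c e (Listₚ.length-applyUpTo col (suc k))))) (card-b e)
      desc : Descending (toℕ ∘ row-of s) c
      desc = AllPairsₚ.applyUpTo⁺₁ col (suc k) λ {i} {j} i<j j< →
        subst₂ _≤_ (cong toℕ (sym (trans (row≗ (col j)) (g-col (ℕ.s≤s⁻¹ j<))))) (cong toℕ (sym (trans (row≗ (col i)) (g-col (ℕₚ.≤-trans (ℕₚ.<⇒≤ i<j) (ℕ.s≤s⁻¹ j<))))))
          (antitone (s≤s (ℕₚ.<⇒≤ i<j)) (ℕₚ.m≤n⇒m≤1+n j<))
      norm : ∀ d → b d ≡ 0 → row-of s d ≡ zero
      norm d b≡0 = trans (row≗ d) g≡0
        where
        g≡0 : g d ≡ zero
        g≡0 with found d
        ... | no _ = refl
        ... | yes (t , eq) with card-b d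
        ...   | record { elems = _ ∷ _ ; size = size } = ⊥-elim (ℕₚ.0≢1+n (trans (sym b≡0) (sym size)))
        ...   | record { elems = [] ; complete = complete } with () ← complete (level-inGrid m k (q (suc (toℕ t))) (ℕ.s≤s⁻¹ (Finₚ.toℕ<n t)) , trans (marks (ℕ.s≤s⁻¹ (Finₚ.toℕ<n t))) (cong mark eq))

module _ (γ : List ℕ) (k : ℕ) where

  private
    m : ℕ
    m = length γ

    G : FinGraph (Size m k)
    G = inc (chainProduct (suc (m + k)) (suc m))

    Colouring : Set
    Colouring = Vec (Fin (3 + m)) (Size m k)

  contents : (Fin 3 → ℕ) → List ℕ
  contents b = b 0F ∷ b 1F ∷ b 2F ∷ γ

  lookup-mark : ∀ b e → lookup (contents b) (mark e) ≡ b e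
  lookup-mark b 0F = refl
  lookup-mark b 1F = refl
  lookup-mark b 2F = refl

  repaintₛ : Skeleton (suc m) → Colouring → Colouring
  repaintₛ s = repaint m k (rows-of m k s) (colours-of m k s)

  abstract
    skeleton-of : ∀ {b} → sum₃ m k b ≡ suc k → ∀ κ → IsColouring G (contents b) κ → ∃[ s ] IsSkeleton b s × HasSkeleton m k (at m k κ) s
    skeleton-of {b} Σb κ (mkColouring proper content) =
      let _ , _ , _ , D = structure m k proper' few in skeleton-exists m k Σb proper' D card-mark
      where
      proper' : Proper m k (at m k κ)
      proper' = proper⁻ m k κ proper
      card-mark : ∀ e → Card (λ v → InGrid m k v × at m k κ v ≡ mark e) (b e)
      card-mark e = subst (Card _) (trans (content (mark e)) (lookup-mark b e)) (card-colour m k κ (mark e))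
      differ : ∀ {d e v} → d ≢ e → InGrid m k v × at m k κ v ≡ mark d → InGrid m k v × at m k κ v ≡ mark e → ⊥
      differ d≢e (_ , eq) (_ , eq') = d≢e (mark-injective (trans (sym eq) eq'))
      few : Card (λ v → InGrid m k v × (∃[ e ] at m k κ v ≡ mark e)) (suc k)
      few = subst (Card _) Σb (card-cong
        (λ { (inj₁ (v∈ , eq)) → v∈ , 0F , eq ; (inj₂ (inj₁ (v∈ , eq))) → v∈ , 1F , eq ; (inj₂ (inj₂ (v∈ , eq))) → v∈ , 2F , eq })
        (λ { (v∈ , 0F , eq) → inj₁ (v∈ , eq) ; (v∈ , 1F , eq) → inj₂ (inj₁ (v∈ , eq)) ; (v∈ , 2F , eq) → inj₂ (inj₂ (v∈ , eq)) })
        (card-⊎ (λ p → [ differ (λ ()) p , differ (λ ()) p ]′) (card-mark 0F) (card-⊎ (differ (λ ())) (card-mark 1F) (card-mark 2F))))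

  module _ {b b' : Fin 3 → ℕ} (Σb' : sum₃ m k b' ≡ suc k) {κ : Colouring} {s s' : Skeleton (suc m)} (s'-skel : IsSkeleton b' s') where

    repaint-skeleton : HasSkeleton m k (at m k κ) s → HasSkeleton m k (at m k (repaintₛ s' κ)) s'
    repaint-skeleton (π , D) = π , repaint-described m k κ D (skeleton-levels m k Σb' s'-skel)

    repaint-colouring : HasSkeleton m k (at m k κ) s → IsColouring G (contents b) κ → IsColouring G (contents b') (repaintₛ s' κ)
    repaint-colouring (π , D) (mkColouring proper content) = mkColouring
      (proper⁺ m k κ' (proper-transfer m k D D' agree (proper⁻ m k κ proper) (skeleton-separated m k {b'} Σb' s'))) content'
      where
      κ' = repaintₛ s' κ
      D' : Described m k (at m k κ') (rows-of m k s') (colours-of m k s') π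
      D' = repaint-described m k κ D (skeleton-levels m k Σb' s'-skel)
      agree : ∀ {v} → InGrid m k v → Outer m k v → at m k κ' v ≡ at m k κ v
      agree = repaint-outer m k (rows-of m k s') (colours-of m k s') κ
      word-content : Content b' (word-of s')
      word-content = proj₂ (proj₁ s'-skel)
      occ-mark : ∀ e → occ (mark e) κ' ≡ lookup (contents b') (mark e)
      occ-mark e = trans (card-unique (card-colour m k κ' (mark e)) (card-marks m k D' (card-nth (word-of s') e (length-word m k Σb' (word-of s') word-content))))
        (trans (word-content e) (sym (lookup-mark b' e)))
      content' : ∀ c → occ c κ' ≡ lookup (contents b') c
      content' 0F = occ-mark 0F
      content' 1F = occ-mark 1F
      content' 2F = occ-mark 2F
      content' (suc (suc (suc i))) = trans (ℕₚ.≤-antisym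
        (chain-colour-≤ m k D' D (λ v∈ o → sym (agree v∈ o)) {i} (card-colour m k κ' (chain i)) (card-colour m k κ (chain i)))
        (chain-colour-≤ m k D D' agree {i} (card-colour m k κ (chain i)) (card-colour m k κ' (chain i)))) (content (chain i))

  -- The layout in which the common factor is counted. It is that of the hook colouring constructed
  -- below, which makes the factor positive.
  reference : Fin 3 → ℕ
  reference = tri (suc k) 0 0

  Σ-reference : sum₃ m k reference ≡ suc k
  Σ-reference = ℕₚ.+-identityʳ (suc k)

  top-row : Skeleton (suc m)
  top-row = fromℕ m , zero , zero , replicate (suc k) 0F

  top-row-skeleton : IsSkeleton reference top-row
  top-row-skeleton = (descending (suc k) , content) , λ { 1F _ → refl ; 2F _ → refl }
    where
    descending : ∀ x → Descending (toℕ ∘ row-of top-row) (replicate x 0F)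
    descending zero    = []
    descending (suc x) = All.tabulate (λ e∈ → ℕₚ.≤-reflexive (cong (toℕ ∘ row-of top-row) (constant x e∈))) ∷ descending x
      where
      constant : ∀ x {e} → e ∈ replicate x 0F → e ≡ 0F
      constant (suc x) (here eq)  = eq
      constant (suc x) (there e∈) = constant x e∈
    content : Content reference (replicate (suc k) 0F)
    content 0F = #-replicate 0F (suc k)
    content 1F = #-replicate-≢ {d = 0F} {1F} (suc k) (λ ())
    content 2F = #-replicate-≢ {d = 0F} {2F} (suc k) (λ ())

  -- A decidable stand-in for having the skeleton `top-row`, a statement that quantifies over `π`;
  -- on colourings with the reference content the two are equivalent.
  top-marked? : (κ : Colouring) → Dec (∀ (t : Fin (suc k)) → at m k κ (level m k (suc (toℕ t)) (fromℕ m)) ≡ mark 0F)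
  top-marked? κ = Finₚ.all? (λ t → at m k κ (level m k (suc (toℕ t)) (fromℕ m)) Finₚ.≟ mark 0F)

  IsReference : Colouring → Set
  IsReference κ = IsColouring G (contents reference) κ × HasSkeleton m k (at m k κ) top-row

  nth-replicate : ∀ x t → nth (replicate x 0F) t ≡ 0F
  nth-replicate zero    t       = refl
  nth-replicate (suc x) zero    = refl
  nth-replicate (suc x) (suc t) = nth-replicate x t

  rows-top : ∀ {t} → t ≤ k → rows-of m k top-row (suc t) ≡ fromℕ m
  rows-top {t} t≤k = trans (rows-of-≤ m k top-row t≤k) (cong (row-of top-row) (nth-replicate (suc k) t))

  top-marked-skeleton : ∀ {F s} → HasSkeleton m k F s → (∀ {t} → t ≤ k → F (level m k (suc t) (fromℕ m)) ≡ mark 0F) → HasSkeleton m k F top-row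
  top-marked-skeleton {F} {s} (π , D) top = π , described-cong m k rows≡ (λ t≤k → proj₂ (same t≤k)) D
    where
    same : ∀ {t} → t ≤ k → rows-of m k s (suc t) ≡ fromℕ m × colours-of m k s t ≡ colours-of m k top-row t
    same {t} t≤k with mark-level m k D (level-inGrid m k (fromℕ m) t≤k) (top t≤k)
    ... | t' , t'≤k , v≡ , c≡ with level-injective m k {suc t} {suc t'} {fromℕ m} {rows-of m k s (suc t')} v≡
    ...   | refl , r≡ = sym r≡ , trans c≡ (sym (nth-replicate (suc k) t))
    rows≡ : ∀ {t} → t ≤ 2 + k → rows-of m k s t ≡ rows-of m k top-row t
    rows≡ {zero}  _ = refl
    rows≡ {suc t} (s≤s t≤) with t ℕₚ.≤? k
    ... | yes t≤k = trans (sym (rows-of-≤′ s t≤k)) (trans (proj₁ (same t≤k)) (trans (sym (rows-top t≤k)) (rows-of-≤′ top-row t≤k)))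
      where
      rows-of-≤′ : ∀ s {t} → t ≤ k → rows-of m k s (suc t) ≡ row-of s (nth (word-of s) (toℕ (clamp {k} t)))
      rows-of-≤′ s t≤k = extend-≤ m k (λ t → row-of s (nth (word-of s) (toℕ t))) t≤k
    ... | no _    = refl

  top-marked⁺ : ∀ {κ} → IsColouring G (contents reference) κ → (∀ (t : Fin (suc k)) → at m k κ (level m k (suc (toℕ t)) (fromℕ m)) ≡ mark 0F) →
                HasSkeleton m k (at m k κ) top-row
  top-marked⁺ {κ} col top = top-marked-skeleton {s = proj₁ (skeleton-of {reference} Σ-reference κ col)} (proj₂ (proj₂ (skeleton-of {reference} Σ-reference κ col)))
    (λ t≤k → subst (λ x → at m k κ (level m k (suc x) (fromℕ m)) ≡ mark 0F) (toℕ-clamp t≤k) (top (clamp _)))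

  abstract
    references : ℕ
    references = countᵇ (λ κ → ⌊ top-marked? κ ⌋) (Card.elems (card-chromCoeff G (contents reference)))

    card-references : Card IsReference references
    card-references = card-cong
      (λ { {κ} (κ∈ , h) → let col = Card.sound c κ∈ in col , top-marked⁺ {κ} col (toWitness h) })
      (λ { {κ} (col , π , D) → Card.complete c col ,
           fromWitness (λ t → trans (cong (at m k κ ∘ level m k (suc (toℕ t))) (sym (rows-top (ℕ.s≤s⁻¹ (Finₚ.toℕ<n t)))))
             (trans (Described.marks D (ℕ.s≤s⁻¹ (Finₚ.toℕ<n t))) (cong mark (nth-replicate (suc k) (toℕ t))))) })
      (card-filter (λ κ → ⌊ top-marked? κ ⌋) (Card.unique c))
      where
      c : Card (IsColouring G (contents reference)) (chromCoeff G (contents reference))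
      c = card-chromCoeff G (contents reference)

  -- A colouring corresponds to its repainting by `top-row` paired with its own skeleton, and
  -- repainting with that skeleton leads back. Both directions are injective by `repaint-repaint`,
  -- the second also by `skeleton-unique`.
  card-colourings : ∀ {b M D W} → sum₃ m k b ≡ suc k → Card (IsColouring G (contents b)) M → Card IsReference D → Card (IsSkeleton b) W → M ≡ D * W
  card-colourings {b} Σb card-col card-ref card-skel = ℕₚ.≤-antisym
    (card-≤ {P = IsColouring G (contents b)} {Q = Pair} card-col (card-× card-ref card-skel) split split-pair split-injective)
    (card-≤ {P = Pair} {Q = IsColouring G (contents b)} (card-× card-ref card-skel) card-col merge merge-colouring merge-injective)
    where
    Pair : Colouring × Skeleton (suc m) → Set
    Pair (ρ , s) = IsReference ρ × IsSkeleton b s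

    split : ∀ {κ} → IsColouring G (contents b) κ → Colouring × Skeleton (suc m)
    split {κ} col = repaintₛ top-row κ , proj₁ (skeleton-of {b} Σb κ col)

    split-pair : ∀ {κ} (col : IsColouring G (contents b) κ) → Pair (split col)
    split-pair {κ} col = (repaint-colouring {b} Σ-reference {κ} {s} top-row-skeleton has col , repaint-skeleton {b} Σ-reference {κ} {s} top-row-skeleton has) , proj₁ (proj₂ (skeleton-of {b} Σb κ col))
      where
      s = proj₁ (skeleton-of {b} Σb κ col)
      has = proj₂ (proj₂ (skeleton-of {b} Σb κ col))

    restore : ∀ κ s s' → HasSkeleton m k (at m k κ) s → repaintₛ s (repaintₛ s' κ) ≡ κ
    restore κ s s' (_ , D) = repaint-repaint m k κ D

    merge : ∀ {p} → Pair p → Colouring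
    merge {ρ , s} _ = repaintₛ s ρ

    split-injective : ∀ {κ κ'} (col : IsColouring G (contents b) κ) (col' : IsColouring G (contents b) κ') → split col ≡ split col' → κ ≡ κ'
    split-injective {κ} {κ'} col col' eq = trans (sym (restore κ s top-row (proj₂ (proj₂ (skeleton-of {b} Σb κ col)))))
      (trans (cong (λ (ρ , s) → repaintₛ s ρ) eq) (restore κ' s' top-row (proj₂ (proj₂ (skeleton-of {b} Σb κ' col')))))
      where
      s  = proj₁ (skeleton-of {b} Σb κ col)
      s' = proj₁ (skeleton-of {b} Σb κ' col')

    merge-colouring : ∀ {p} (h : Pair p) → IsColouring G (contents b) (merge h)
    merge-colouring {ρ , s} ((col , has) , s-skel) = repaint-colouring {reference} Σb {ρ} {top-row} s-skel has col

    merge-injective : ∀ {p p'} (h : Pair p) (h' : Pair p') → merge h ≡ merge h' → p ≡ p'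
    merge-injective {ρ , s} {ρ' , s'} ((_ , has) , s-skel) ((_ , has') , s'-skel) eq = cong₂ _,_
      (trans (sym (restore ρ top-row s has)) (trans (cong (repaintₛ top-row) eq) (restore ρ' top-row s' has')))
      (skeleton-unique m k Σb {at m k (repaintₛ s ρ)} {s} {s'} s-skel s'-skel (repaint-skeleton {reference} Σb {ρ} {top-row} s-skel has)
        (subst (λ κ → HasSkeleton m k (at m k κ) s') (sym eq) (repaint-skeleton {reference} Σb {ρ'} {top-row} s'-skel has')))

  chromCoeff-skeletons : ∀ {b W} → sum₃ m k b ≡ suc k → Card (IsSkeleton b) W → chromCoeff G (contents b) ≡ references * W
  chromCoeff-skeletons {b} Σb = card-colourings {b} Σb (card-chromCoeff G (contents b)) card-references

-- The numerical inequality

-- This and the next statements clear the denominator of a multinomial coefficient: x! y! times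
-- `mult x y z` is the product of z + 1, ..., z + x + y. The induction on `z` follows the recursion
-- of `mult`, and `expand` splits the factor so that the smaller cases apply.
mult-01 : ∀ z → 1 * mult 0 1 z ≡ (1 + z)
mult-01 zero    = refl
mult-01 (suc z) = trans (expand (mult 0 0 (suc z)) (mult 0 1 z)) (trans (cong₂ _+_ (cong (1 *_) (cong (1 *_) (mult-00 (suc z)))) (mult-01 z)) (collect z))
  where
  expand : ∀ b w → 1 * (0 + (b + w)) ≡ 1 * (1 * b) + 1 * w
  expand = solve-∀
  collect : ∀ z → 1 * (1 * 1) + (1 + z) ≡ (1 + (1 + z))
  collect = solve-∀

mult-10 : ∀ z → 1 * mult 1 0 z ≡ (1 + z)
mult-10 zero    = refl
mult-10 (suc z) = trans (expand (mult 0 0 (suc z)) (mult 1 0 z)) (trans (cong₂ _+_ (cong (1 *_) (cong (1 *_) (mult-00 (suc z)))) (mult-10 z)) (collect z))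
  where
  expand : ∀ a w → 1 * (a + (0 + w)) ≡ 1 * (1 * a) + 1 * w
  expand = solve-∀
  collect : ∀ z → 1 * (1 * 1) + (1 + z) ≡ (1 + (1 + z))
  collect = solve-∀

mult-11 : ∀ z → 1 * mult 1 1 z ≡ ((1 + z) * (2 + z))
mult-11 zero    = refl
mult-11 (suc z) = trans (expand (mult 0 1 (suc z)) (mult 1 0 (suc z)) (mult 1 1 z)) (trans (cong₂ _+_ (cong₂ _+_ (cong (1 *_) (mult-01 (suc z))) (cong (1 *_) (mult-10 (suc z)))) (mult-11 z)) (collect z))
  where
  expand : ∀ a b w → 1 * (a + (b + w)) ≡ 1 * (1 * a) + 1 * (1 * b) + 1 * w
  expand = solve-∀
  collect : ∀ z → 1 * (1 + 1 + z) + 1 * (1 + 1 + z) + ((1 + z) * (2 + z)) ≡ ((1 + (1 + z)) * (2 + (1 + z)))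
  collect = solve-∀

mult-20 : ∀ z → 2 * mult 2 0 z ≡ ((1 + z) * (2 + z))
mult-20 zero    = refl
mult-20 (suc z) = trans (expand (mult 1 0 (suc z)) (mult 2 0 z)) (trans (cong₂ _+_ (cong (2 *_) (mult-10 (suc z))) (mult-20 z)) (collect z))
  where
  expand : ∀ a w → 2 * (a + (0 + w)) ≡ 2 * (1 * a) + 2 * w
  expand = solve-∀
  collect : ∀ z → 2 * (1 + 1 + z) + ((1 + z) * (2 + z)) ≡ ((1 + (1 + z)) * (2 + (1 + z)))
  collect = solve-∀

mult-02 : ∀ z → 2 * mult 0 2 z ≡ ((1 + z) * (2 + z))
mult-02 zero    = refl
mult-02 (suc z) = trans (expand (mult 0 1 (suc z)) (mult 0 2 z)) (trans (cong₂ _+_ (cong (2 *_) (mult-01 (suc z))) (mult-02 z)) (collect z))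
  where
  expand : ∀ b w → 2 * (0 + (b + w)) ≡ 2 * (1 * b) + 2 * w
  expand = solve-∀
  collect : ∀ z → 2 * (1 + 1 + z) + ((1 + z) * (2 + z)) ≡ ((1 + (1 + z)) * (2 + (1 + z)))
  collect = solve-∀

mult-30 : ∀ z → 6 * mult 3 0 z ≡ ((1 + z) * (2 + z) * (3 + z))
mult-30 zero    = refl
mult-30 (suc z) = trans (expand (mult 2 0 (suc z)) (mult 3 0 z)) (trans (cong₂ _+_ (cong (3 *_) (mult-20 (suc z))) (mult-30 z)) (collect z))
  where
  expand : ∀ a w → 6 * (a + (0 + w)) ≡ 3 * (2 * a) + 6 * w
  expand = solve-∀
  collect : ∀ z → 3 * ((1 + 1 + z) * (2 + 1 + z)) + ((1 + z) * (2 + z) * (3 + z)) ≡ ((1 + (1 + z)) * (2 + (1 + z)) * (3 + (1 + z)))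
  collect = solve-∀

mult-21 : ∀ z → 2 * mult 2 1 z ≡ ((1 + z) * (2 + z) * (3 + z))
mult-21 zero    = refl
mult-21 (suc z) = trans (expand (mult 1 1 (suc z)) (mult 2 0 (suc z)) (mult 2 1 z)) (trans (cong₂ _+_ (cong₂ _+_ (cong (2 *_) (mult-11 (suc z))) (cong (1 *_) (mult-20 (suc z)))) (mult-21 z)) (collect z))
  where
  expand : ∀ a b w → 2 * (a + (b + w)) ≡ 2 * (1 * a) + 1 * (2 * b) + 2 * w
  expand = solve-∀
  collect : ∀ z → 2 * ((1 + 1 + z) * (2 + 1 + z)) + 1 * ((1 + 1 + z) * (2 + 1 + z)) + ((1 + z) * (2 + z) * (3 + z)) ≡ ((1 + (1 + z)) * (2 + (1 + z)) * (3 + (1 + z)))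
  collect = solve-∀

mult-12 : ∀ z → 2 * mult 1 2 z ≡ ((1 + z) * (2 + z) * (3 + z))
mult-12 zero    = refl
mult-12 (suc z) = trans (expand (mult 0 2 (suc z)) (mult 1 1 (suc z)) (mult 1 2 z)) (trans (cong₂ _+_ (cong₂ _+_ (cong (1 *_) (mult-02 (suc z))) (cong (2 *_) (mult-11 (suc z)))) (mult-12 z)) (collect z))
  where
  expand : ∀ a b w → 2 * (a + (b + w)) ≡ 1 * (2 * a) + 2 * (1 * b) + 2 * w
  expand = solve-∀
  collect : ∀ z → 1 * ((1 + 1 + z) * (2 + 1 + z)) + 2 * ((1 + 1 + z) * (2 + 1 + z)) + ((1 + z) * (2 + z) * (3 + z)) ≡ ((1 + (1 + z)) * (2 + (1 + z)) * (3 + (1 + z)))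
  collect = solve-∀

mult-22 : ∀ z → 4 * mult 2 2 z ≡ ((1 + z) * (2 + z) * (3 + z) * (4 + z))
mult-22 zero    = refl
mult-22 (suc z) = trans (expand (mult 1 2 (suc z)) (mult 2 1 (suc z)) (mult 2 2 z)) (trans (cong₂ _+_ (cong₂ _+_ (cong (2 *_) (mult-12 (suc z))) (cong (2 *_) (mult-21 (suc z)))) (mult-22 z)) (collect z))
  where
  expand : ∀ a b w → 4 * (a + (b + w)) ≡ 2 * (2 * a) + 2 * (2 * b) + 4 * w
  expand = solve-∀
  collect : ∀ z → 2 * ((1 + 1 + z) * (2 + 1 + z) * (3 + 1 + z)) + 2 * ((1 + 1 + z) * (2 + 1 + z) * (3 + 1 + z)) + ((1 + z) * (2 + z) * (3 + z) * (4 + z)) ≡ ((1 + (1 + z)) * (2 + (1 + z)) * (3 + (1 + z)) * (4 + (1 + z)))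
  collect = solve-∀

mult-31 : ∀ z → 6 * mult 3 1 z ≡ ((1 + z) * (2 + z) * (3 + z) * (4 + z))
mult-31 zero    = refl
mult-31 (suc z) = trans (expand (mult 2 1 (suc z)) (mult 3 0 (suc z)) (mult 3 1 z)) (trans (cong₂ _+_ (cong₂ _+_ (cong (3 *_) (mult-21 (suc z))) (cong (1 *_) (mult-30 (suc z)))) (mult-31 z)) (collect z))
  where
  expand : ∀ a b w → 6 * (a + (b + w)) ≡ 3 * (2 * a) + 1 * (6 * b) + 6 * w
  expand = solve-∀
  collect : ∀ z → 3 * ((1 + 1 + z) * (2 + 1 + z) * (3 + 1 + z)) + 1 * ((1 + 1 + z) * (2 + 1 + z) * (3 + 1 + z)) + ((1 + z) * (2 + z) * (3 + z) * (4 + z)) ≡ ((1 + (1 + z)) * (2 + (1 + z)) * (3 + (1 + z)) * (4 + (1 + z)))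
  collect = solve-∀

private
  -- Twelve times one side of the inequality; 12 is the least common multiple of the denominators 1,
  -- 2, 4 and 6. Each coefficient is 12 divided by the denominator of its multinomial, and `r`
  -- collects the terms free of multinomials.
  weighted : (c₁ c₂ c₃ c₄ c₅ c₆ c₇ p r A B C D E F G : ℕ) → ℕ
  weighted c₁ c₂ c₃ c₄ c₅ c₆ c₇ p r A B C D E F G =
    (c₁ * A + p * (c₂ * B + c₃ * C)) + ((c₄ * D + c₅ * E) + (p * (c₆ * F + c₇ * G) + r))

  weighted-cong : ∀ c₁ c₂ c₃ c₄ c₅ c₆ c₇ p r {A B C D E F G A' B' C' D' E' F' G'} →
    A ≡ A' → B ≡ B' → C ≡ C' → D ≡ D' → E ≡ E' → F ≡ F' → G ≡ G' →
    weighted c₁ c₂ c₃ c₄ c₅ c₆ c₇ p r A B C D E F G ≡ weighted c₁ c₂ c₃ c₄ c₅ c₆ c₇ p r A' B' C' D' E' F' G'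
  weighted-cong _ _ _ _ _ _ _ _ _ refl refl refl refl refl refl refl = refl

  -- The two sides divided by their common factor n. The literals 6, 2, 4 and 3 are `mult 2 2 0`,
  -- `mult 1 1 0`, `mult 3 1 0` and `mult 2 1 0`.
  positive negative : ℕ → ℕ → (A B C D E F G : ℕ) → ℕ
  positive p m A B C D E F G = ((A + p * 6) + p * (B + (C + m))) + ((D + p) + ((E + p * 2) + p * (F + (G + m))))
  negative p m A B C D E F G = ((A + p * 4) + p * (B + (C + m))) + ((D + p) + ((E + p * 3) + p * (F + (G + m))))

  positive-weighted : ∀ p m A B C D E F G → 12 * positive p m A B C D E F G ≡
    weighted 3 6 6 2 12 12 12 p (108 * p + 24 * (p * m)) (4 * A) (2 * B) (2 * C) (6 * D) (1 * E) (1 * F) (1 * G)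
  positive-weighted = expand
    where
    expand : ∀ p m A B C D E F G → 12 * (((A + p * 6) + p * (B + (C + m))) + ((D + p) + ((E + p * 2) + p * (F + (G + m))))) ≡
      (3 * (4 * A) + p * (6 * (2 * B) + 6 * (2 * C))) + ((2 * (6 * D) + 12 * (1 * E)) + (p * (12 * (1 * F) + 12 * (1 * G)) + (108 * p + 24 * (p * m))))
    expand = solve-∀

  negative-weighted : ∀ p m A B C D E F G → 12 * negative p m A B C D E F G ≡
    weighted 2 2 12 6 6 6 12 p (96 * p + 24 * (p * m)) (6 * A) (6 * B) (1 * C) (2 * D) (2 * E) (2 * F) (1 * G)
  negative-weighted = expand
    where
    expand : ∀ p m A B C D E F G → 12 * (((A + p * 4) + p * (B + (C + m))) + ((D + p) + ((E + p * 3) + p * (F + (G + m))))) ≡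
      (2 * (6 * A) + p * (2 * (6 * B) + 12 * (1 * C))) + ((6 * (2 * D) + 6 * (2 * E)) + (p * (6 * (2 * F) + 12 * (1 * G)) + (96 * p + 24 * (p * m))))
    expand = solve-∀

  -- Here `a` is k - 5, `p` is n - 1 and `m` is n - 2. The terms with `p * m` agree on both sides,
  -- so the difference of the sides is affine in `p`: `excess` is its constant term and `deficit`,
  -- on the other side, its linear term.
  common excess deficit : ℕ → ℕ → ℕ → ℕ
  common a p m =
    (2 * ((3 + a) * (4 + a) * (5 + a) * (6 + a)) + (6 * ((5 + a) * (6 + a)) + 6 * ((4 + a) * (5 + a) * (6 + a)))) +
    p * ((6 * ((3 + a) * (4 + a)) + 6 * ((3 + a) * (4 + a))) + (12 * (5 + a) + 12 * (5 + a)) + 108 + 24 * m)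
  excess a _ _ = (1 + a) * (2 + a) * (5 + a) * (6 + a)
  deficit a p _ = p * (2 * (a * a * a + 9 * (a * a) + 32 * a + 24))

  positive-value : ∀ a p m → weighted 3 6 6 2 12 12 12 p (108 * p + 24 * (p * m))
    ((1 + (2 + a)) * (2 + (2 + a)) * (3 + (2 + a)) * (4 + (2 + a))) ((1 + (2 + a)) * (2 + (2 + a))) ((1 + (2 + a)) * (2 + (2 + a)))
    ((1 + (3 + a)) * (2 + (3 + a)) * (3 + (3 + a))) ((1 + (4 + a)) * (2 + (4 + a))) (1 + (4 + a)) (1 + (4 + a)) ≡ common a p m + excess a p m
  positive-value = expand
    where
    expand : ∀ a p m →
      (3 * ((1 + (2 + a)) * (2 + (2 + a)) * (3 + (2 + a)) * (4 + (2 + a))) + p * (6 * ((1 + (2 + a)) * (2 + (2 + a))) + 6 * ((1 + (2 + a)) * (2 + (2 + a))))) +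
      ((2 * ((1 + (3 + a)) * (2 + (3 + a)) * (3 + (3 + a))) + 12 * ((1 + (4 + a)) * (2 + (4 + a)))) + (p * (12 * (1 + (4 + a)) + 12 * (1 + (4 + a))) + (108 * p + 24 * (p * m)))) ≡
      ((2 * ((3 + a) * (4 + a) * (5 + a) * (6 + a)) + (6 * ((5 + a) * (6 + a)) + 6 * ((4 + a) * (5 + a) * (6 + a)))) +
      p * ((6 * ((3 + a) * (4 + a)) + 6 * ((3 + a) * (4 + a))) + (12 * (5 + a) + 12 * (5 + a)) + 108 + 24 * m)) + (1 + a) * (2 + a) * (5 + a) * (6 + a)
    expand = solve-∀

  negative-value : ∀ a p m → weighted 2 2 12 6 6 6 12 p (96 * p + 24 * (p * m))
    ((1 + (2 + a)) * (2 + (2 + a)) * (3 + (2 + a)) * (4 + (2 + a))) ((1 + (2 + a)) * (2 + (2 + a)) * (3 + (2 + a))) (1 + (2 + a))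
    ((1 + (4 + a)) * (2 + (4 + a))) ((1 + (3 + a)) * (2 + (3 + a)) * (3 + (3 + a))) ((1 + (3 + a)) * (2 + (3 + a))) (1 + (3 + a)) ≡ common a p m + deficit a p m
  negative-value = expand
    where
    expand : ∀ a p m →
      (2 * ((1 + (2 + a)) * (2 + (2 + a)) * (3 + (2 + a)) * (4 + (2 + a))) + p * (2 * ((1 + (2 + a)) * (2 + (2 + a)) * (3 + (2 + a))) + 12 * (1 + (2 + a)))) +
      ((6 * ((1 + (4 + a)) * (2 + (4 + a))) + 6 * ((1 + (3 + a)) * (2 + (3 + a)) * (3 + (3 + a)))) + (p * (6 * ((1 + (3 + a)) * (2 + (3 + a))) + 12 * (1 + (3 + a))) + (96 * p + 24 * (p * m)))) ≡
      ((2 * ((3 + a) * (4 + a) * (5 + a) * (6 + a)) + (6 * ((5 + a) * (6 + a)) + 6 * ((4 + a) * (5 + a) * (6 + a)))) +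
      p * ((6 * ((3 + a) * (4 + a)) + 6 * ((3 + a) * (4 + a))) + (12 * (5 + a) + 12 * (5 + a)) + 108 + 24 * m)) + p * (2 * (a * a * a + 9 * (a * a) + 32 * a + 24))
    expand = solve-∀

  -- Both sides are divisible by a + 1, and the quotients are (a + 2)(a + 5)(a + 6) and 2 p (a² + 8
  -- a + 24). Since (a + 2)(a + 6) = a² + 8 a + 12, the bound a + 5 ≤ 2 p, which is k ≤ 2 (n - 1),
  -- suffices.
  excess<deficit : ∀ a p m → 5 + a ≤ 2 * p → excess a p m < deficit a p m
  excess<deficit a p m h = ℕₚ.*-cancelˡ-< 2 _ _ (begin-strict
    2 * ((1 + a) * (2 + a) * (5 + a) * (6 + a))                          <⟨ ℕₚ.m<m+n _ (s≤s z≤n) ⟩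
    -- The slack is 24 (a + 1)(a + 5), written as a successor to be visibly positive.
    2 * ((1 + a) * (2 + a) * (5 + a) * (6 + a)) + suc (119 + 24 * (a * a) + 144 * a) ≡⟨ expand a ⟩
    (5 + a) * (2 * (a * a * a + 9 * (a * a) + 32 * a + 24))              ≤⟨ ℕₚ.*-monoˡ-≤ _ h ⟩
    2 * p * (2 * (a * a * a + 9 * (a * a) + 32 * a + 24))                ≡⟨ ℕₚ.*-assoc 2 p _ ⟩
    2 * (p * (2 * (a * a * a + 9 * (a * a) + 32 * a + 24)))              ∎)
    where
    open ℕₚ.≤-Reasoning
    expand : ∀ a → 2 * ((1 + a) * (2 + a) * (5 + a) * (6 + a)) + (1 + (119 + 24 * (a * a) + 144 * a)) ≡ (5 + a) * (2 * (a * a * a + 9 * (a * a) + 32 * a + 24))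
    expand = solve-∀

-- Up to a positive factor, left minus right is the coefficient of the Schur function of the excluded shape.
skeletons-< : ∀ m a → 7 + a ≤ 2 * (2 + m) →
  skeletons₃ m 2 2 (2 + a) + (skeletons₂ m 3 0 (3 + a) + skeletons₃ m 1 1 (4 + a)) <
  skeletons₃ m 3 1 (2 + a) + (skeletons₂ m 2 0 (4 + a) + skeletons₃ m 2 1 (3 + a))
skeletons-< m a h = subst₂ _<_
  (factor (2 + m) (inner₃ 2 2 (2 + a)) (inner₂ 3 (3 + a)) (inner₃ 1 1 (4 + a))) (factor (2 + m) (inner₃ 3 1 (2 + a)) (inner₂ 2 (4 + a)) (inner₃ 2 1 (3 + a)))
  -- The factor n = 2 + m is taken out of both sides, and multiplication by 12 clears the
  -- denominators.
  (ℕₚ.*-monoʳ-< (2 + m) {left} {right} (ℕₚ.*-cancelˡ-< 12 left right (subst₂ _<_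
  (sym (trans (positive-weighted p m (mult 2 2 (2 + a)) (mult 2 0 (2 + a)) (mult 0 2 (2 + a)) (mult 3 0 (3 + a)) (mult 1 1 (4 + a)) (mult 1 0 (4 + a)) (mult 0 1 (4 + a)))
    (trans (weighted-cong 3 6 6 2 12 12 12 p _ (mult-22 (2 + a)) (mult-20 (2 + a)) (mult-02 (2 + a)) (mult-30 (3 + a)) (mult-11 (4 + a)) (mult-10 (4 + a)) (mult-01 (4 + a)))
      (positive-value a p m))))
  (sym (trans (negative-weighted p m (mult 3 1 (2 + a)) (mult 3 0 (2 + a)) (mult 0 1 (2 + a)) (mult 2 0 (4 + a)) (mult 2 1 (3 + a)) (mult 2 0 (3 + a)) (mult 0 1 (3 + a)))
    (trans (weighted-cong 2 2 12 6 6 6 12 p _ (mult-31 (2 + a)) (mult-30 (2 + a)) (mult-01 (2 + a)) (mult-20 (4 + a)) (mult-21 (3 + a)) (mult-20 (3 + a)) (mult-01 (3 + a)))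
      (negative-value a p m))))
  (ℕₚ.+-monoʳ-< (common a p m) (excess<deficit a p m h')))))
  where
  p = suc m
  inner₃ : ℕ → ℕ → ℕ → ℕ
  inner₃ x y z = (mult x y z + p * mult x y 0) + p * (mult x 0 z + (mult 0 y z + m))
  inner₂ : ℕ → ℕ → ℕ
  inner₂ x z = mult x 0 z + p
  left right : ℕ
  left  = inner₃ 2 2 (2 + a) + (inner₂ 3 (3 + a) + inner₃ 1 1 (4 + a))
  right = inner₃ 3 1 (2 + a) + (inner₂ 2 (4 + a) + inner₃ 2 1 (3 + a))
  h' : 5 + a ≤ 2 * p
  h' = ℕ.s≤s⁻¹ (ℕ.s≤s⁻¹ (ℕₚ.≤-trans h (ℕₚ.≤-reflexive (cong suc (ℕₚ.+-suc (suc m) (suc (m + 0)))))))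
  factor : ∀ c x y z → c * (x + (y + z)) ≡ c * x + (c * y + c * z)
  factor c x y z = trans (ℕₚ.*-distribˡ-+ c x (y + z)) (cong (c * x +_) (ℕₚ.*-distribˡ-+ c y z))

-- The partition into hooks

module _ (m k : ℕ) where

  private
    V = Vertex m k

  -- The i-th hook runs along row i and then up the column m + k + 1 ∸ i.
  hook-index : V → ℕ
  hook-index (c , j) = j ⊓ (suc (m + k) ∸ c)

  -- The hook of index `m` is the part of row m over columns 1 to k + 1. These are the k + 1
  -- exceptional vertices, all of colour 0.
  hook-colour : ℕ → Fin (3 + m)
  hook-colour i with i ℕₚ.<? m
  ... | yes i<m = chain (fromℕ< i<m)
  ... | no _    = mark 0F

  hook : V → Fin (3 + m)
  hook = hook-colour ∘ hook-index

  hook-colour-mark : ∀ {i e} → hook-colour i ≡ mark e → m ≤ i × e ≡ 0F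
  hook-colour-mark {i} eq with i ℕₚ.<? m
  ... | yes _  = ⊥-elim (mark≢chain (sym eq))
  ... | no i≮m = ℕₚ.≮⇒≥ i≮m , mark-injective (sym eq)

  hook-colour-top : ∀ {i} → m ≤ i → hook-colour i ≡ mark 0F
  hook-colour-top {i} m≤i with i ℕₚ.<? m
  ... | yes i<m = ⊥-elim (ℕₚ.<⇒≱ i<m m≤i)
  ... | no _    = refl

  hook-colour-injective : ∀ {i i'} → i ≤ m → i' ≤ m → hook-colour i ≡ hook-colour i' → i ≡ i'
  hook-colour-injective {i} {i'} i≤m i'≤m eq with i ℕₚ.<? m | i' ℕₚ.<? m
  ... | yes p | yes p' = trans (sym (Finₚ.toℕ-fromℕ< p)) (trans (cong toℕ (chain-injective {i = fromℕ< p} {fromℕ< p'} eq)) (Finₚ.toℕ-fromℕ< p'))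
  ... | yes p | no _   = ⊥-elim (mark≢chain (sym eq))
  ... | no _  | yes p' = ⊥-elim (mark≢chain eq)
  ... | no ¬p | no ¬p' = trans (ℕₚ.≤-antisym i≤m (ℕₚ.≮⇒≥ ¬p)) (sym (ℕₚ.≤-antisym i'≤m (ℕₚ.≮⇒≥ ¬p')))

  -- The four cases tell on which arm of their common hook the two vertices lie. If the first is on
  -- the vertical arm and the second on the horizontal one, the second lies below the first, and the
  -- ranks force equality.
  hook-proper : Proper m k hook
  hook-proper {c , j} {c' , j'} (_ , c≤ , j≤m) (_ , c'≤ , j'≤m) rank≤ eq with
    hook-colour-injective (ℕₚ.≤-trans (ℕₚ.m⊓n≤m j _) j≤m) (ℕₚ.≤-trans (ℕₚ.m⊓n≤m j' _) j'≤m) eq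
    | ℕₚ.≤-total j (suc (m + k) ∸ c) | ℕₚ.≤-total j' (suc (m + k) ∸ c')
  ... | same | inj₁ p | inj₁ p' rewrite ℕₚ.m≤n⇒m⊓n≡m p | ℕₚ.m≤n⇒m⊓n≡m p' | same = ℕₚ.+-cancelʳ-≤ j' c c' rank≤ , ℕₚ.≤-refl
  ... | same | inj₁ p | inj₂ p' rewrite ℕₚ.m≤n⇒m⊓n≡m p | ℕₚ.m≥n⇒m⊓n≡n p' =
    ℕₚ.≮⇒≥ (λ c'<c → ℕₚ.<⇒≱ (ℕₚ.∸-monoʳ-< c'<c c≤) (subst (_≤ suc (m + k) ∸ c) same p)) , subst (_≤ j') (sym same) p'
  ... | same | inj₂ p | inj₁ p' rewrite ℕₚ.m≥n⇒m⊓n≡n p | ℕₚ.m≤n⇒m⊓n≡m p' = ⊑-antisym-rank m k {c , j} {c' , j'}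
    (ℕₚ.≮⇒≥ (λ c<c' → ℕₚ.<⇒≱ (ℕₚ.∸-monoʳ-< c<c' c'≤) (subst (_≤ suc (m + k) ∸ c') (sym same) p')) , subst (_≤ j) same p) rank≤
  ... | same | inj₂ p | inj₂ p' rewrite ℕₚ.m≥n⇒m⊓n≡n p | ℕₚ.m≥n⇒m⊓n≡n p' =
    ℕₚ.≤-reflexive c≡c' , ℕₚ.+-cancelˡ-≤ c j j' (subst (λ x → c + j ≤ x + j') (sym c≡c') rank≤)
    where
    c≡c' : c ≡ c'
    c≡c' = ℕₚ.∸-cancelˡ-≡ c≤ c'≤ same

  hook-top : ∀ {t} → t ≤ k → hook (level m k (suc t) (fromℕ m)) ≡ mark 0F
  hook-top {t} t≤k = hook-colour-top (ℕₚ.⊓-glb (ℕₚ.≤-reflexive (sym (Finₚ.toℕ-fromℕ m)))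
    (ℕₚ.≤-trans (ℕₚ.≤-reflexive (sym (ℕₚ.m+n∸n≡m m k))) (subst (λ x → m + k ∸ k ≤ suc (m + k) ∸ (x + suc t)) (sym zero-gap) (ℕₚ.∸-monoʳ-≤ (m + k) t≤k))))
    where
    zero-gap : m ∸ toℕ (fromℕ m) ≡ 0
    zero-gap = trans (cong (m ∸_) (Finₚ.toℕ-fromℕ m)) (ℕₚ.n∸n≡0 m)

  hook-mark : ∀ {v} → InGrid m k v → ∀ {e} → hook v ≡ mark e → e ≡ 0F × ∃[ t ] t ≤ k × v ≡ level m k (suc t) (fromℕ m)
  hook-mark {suc t , j} (_ , s≤s c≤ , j≤m) eq with hook-colour-mark eq
  ... | m≤ , e≡ = e≡ , t , t≤k , cong₂ _,_ (sym (trans (cong (λ x → m ∸ x + suc t) (Finₚ.toℕ-fromℕ m)) (cong (_+ suc t) (ℕₚ.n∸n≡0 m)))) (trans j≡m (sym (Finₚ.toℕ-fromℕ m)))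
    where
    j≡m : j ≡ m
    j≡m = ℕₚ.≤-antisym j≤m (ℕₚ.≤-trans m≤ (ℕₚ.m⊓n≤m j _))
    t≤k : t ≤ k
    t≤k = ℕₚ.+-cancelˡ-≤ m t k (subst (m + t ≤_) (ℕₚ.m∸n+n≡m c≤) (ℕₚ.+-monoˡ-≤ t (ℕₚ.≤-trans m≤ (ℕₚ.m⊓n≤n j _))))

  hook-colouring : Vec (Fin (3 + m)) (Size m k)
  hook-colouring = colouring m k hook

  at-hook : ∀ {v} → InGrid m k v → at m k hook-colouring v ≡ hook v
  at-hook = at-colouring m k hook

  hook-colouring-proper : Proper m k (at m k hook-colouring)
  hook-colouring-proper v∈ w∈ le eq = hook-proper v∈ w∈ le (trans (sym (at-hook v∈)) (trans eq (at-hook w∈)))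

  card-hook-mark : ∀ e → Card (λ v → InGrid m k v × at m k hook-colouring v ≡ mark e) (tri (suc k) 0 0 e)
  card-hook-mark 0F = card-⇔ (λ (t : Fin (suc k)) → level m k (suc (toℕ t)) (fromℕ m))
    (λ {t} {t'} eq → Finₚ.toℕ-injective (ℕₚ.suc-injective (proj₁ (level-injective m k {j = fromℕ m} {fromℕ m} eq))))
    (λ {t} _ → let t≤k = ℕ.s≤s⁻¹ (Finₚ.toℕ<n t) ; v∈ = level-inGrid m k (fromℕ m) t≤k in v∈ , trans (at-hook v∈) (hook-top t≤k))
    (λ (v∈ , eq) → let _ , t , t≤k , v≡ = hook-mark v∈ (trans (sym (at-hook v∈)) eq) in
      clamp t , tt , trans v≡ (cong (λ x → level m k (suc x) (fromℕ m)) (sym (toℕ-clamp t≤k))))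
    (card-allFin (suc k))
  card-hook-mark 1F = card-⊥ λ (v∈ , eq) → 1≢0 (proj₁ (hook-mark v∈ (trans (sym (at-hook v∈)) eq)))
    where
    1≢0 : (Fin 3 ∋ 1F) ≢ 0F
    1≢0 ()
  card-hook-mark 2F = card-⊥ λ (v∈ , eq) → 2≢0 (proj₁ (hook-mark v∈ (trans (sym (at-hook v∈)) eq)))
    where
    2≢0 : (Fin 3 ∋ 2F) ≢ 0F
    2≢0 ()

  hook-contents : List ℕ
  hook-contents = List.tabulate (λ i → occ (chain i) hook-colouring)

-- Phrased with `length γ` in place of `m` because the colours are indexed by the length of the
-- exponent list.
HookContents : List ℕ → ℕ → Set
HookContents γ k = ∀ i → lookup γ i ≡ occ (chain i) (hook-colouring (length γ) k)

-- The hook colouring is itself a reference colouring.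
references-positive : ∀ γ k → HookContents γ k → 1 ≤ references γ k
references-positive γ k γ≡ = card-≤ (card-singleton (hook-colouring (length γ) k)) (card-references γ k) (λ {κ} _ → κ)
  (λ { refl → is-colouring , top-marked⁺ γ k {hook-colouring (length γ) k} is-colouring top }) (λ { _ _ eq → eq })
  where
  is-colouring : IsColouring (inc (chainProduct (suc ((length γ) + k)) (suc (length γ)))) (contents γ k (reference γ k)) (hook-colouring (length γ) k)
  is-colouring = mkColouring (proper⁺ (length γ) k (hook-colouring (length γ) k) (hook-colouring-proper (length γ) k)) content
    where
    occ-mark : ∀ e → occ (mark e) (hook-colouring (length γ) k) ≡ tri (suc k) 0 0 e
    occ-mark e = card-unique (card-colour (length γ) k (hook-colouring (length γ) k) (mark e)) (card-hook-mark (length γ) k e)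
    content : ∀ c → occ c (hook-colouring (length γ) k) ≡ lookup (contents γ k (reference γ k)) c
    content 0F = occ-mark 0F
    content 1F = occ-mark 1F
    content 2F = occ-mark 2F
    content (suc (suc (suc i))) = sym (γ≡ i)
  top : ∀ (t : Fin (suc k)) → at (length γ) k (hook-colouring (length γ) k) (level (length γ) k (suc (toℕ t)) (fromℕ (length γ))) ≡ mark 0F
  top t = trans (at-hook (length γ) k (level-inGrid (length γ) k (fromℕ (length γ)) t≤k)) (hook-top (length γ) k t≤k)
    where t≤k = ℕ.s≤s⁻¹ (Finₚ.toℕ<n t)

-- Contradiction with Schur positivity

chromCoeff-≤ : ∀ {N} {G : FinGraph N} → SchurPositiveGraph G → ∀ a γ →
  chromCoeff G (3 ∷ 1 ∷ a ∷ γ) + (chromCoeff G (2 ∷ 0 ∷ 2 + a ∷ γ) + chromCoeff G (2 ∷ 1 ∷ 1 + a ∷ γ)) ≤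
  chromCoeff G (2 ∷ 2 ∷ a ∷ γ) + (chromCoeff G (3 ∷ 0 ∷ 1 + a ∷ γ) + chromCoeff G (1 ∷ 1 ∷ 2 + a ∷ γ))
chromCoeff-≤ {G = G} positive a γ = schurPositive-≤ {3 ∷ 1 ∷ a ∷ γ} {2 ∷ 0 ∷ 2 + a ∷ γ} {2 ∷ 1 ∷ 1 + a ∷ γ}
  {2 ∷ 2 ∷ a ∷ γ} {3 ∷ 0 ∷ 1 + a ∷ γ} {1 ∷ 1 ∷ 2 + a ∷ γ} (λ λ' partition → kostka-≤ partition {a} {γ}) {G = G} positive

-- Stated for arbitrary c and D because the actual counts unfold to unmanageable terms.
skeleton-counts-contradict : ∀ m a D (c : ℕ → ℕ → ℕ → ℕ) → 1 ≤ D → 7 + a ≤ 2 * (2 + m) →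
  (∀ b₀ b₁ b₂ → suc b₀ + (suc b₁ + suc b₂) ≡ 6 + a → c (suc b₀) (suc b₁) (suc b₂) ≡ D * skeletons₃ m (suc b₀) (suc b₁) (suc b₂)) →
  (∀ b₀ b₂ → suc b₀ + (0 + suc b₂) ≡ 6 + a → c (suc b₀) 0 (suc b₂) ≡ D * skeletons₂ m (suc b₀) 0 (suc b₂)) →
  ¬ (∀ a → c 3 1 a + (c 2 0 (2 + a) + c 2 1 (1 + a)) ≤ c 2 2 a + (c 3 0 (1 + a) + c 1 1 (2 + a)))
skeleton-counts-contradict m a D c 1≤D large count₃ count₂ h = ℕₚ.<⇒≱
  (ℕₚ.*-monoʳ-< D {{ℕ.>-nonZero 1≤D}} (skeletons-< m a large))
  (subst₂ _≤_
    (distrib (count₃ 2 0 (1 + a) refl) (count₂ 1 (3 + a) refl) (count₃ 1 0 (2 + a) refl))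
    (distrib (count₃ 1 1 (1 + a) refl) (count₂ 2 (2 + a) refl) (count₃ 0 0 (3 + a) refl))
    -- Here k = 5 + a, so the long exponent k - 3 is `2 + a`.
    (h (2 + a)))
  where
  distrib : ∀ {p q r p' q' r'} → p ≡ D * p' → q ≡ D * q' → r ≡ D * r' → p + (q + r) ≡ D * (p' + (q' + r'))
  distrib {p' = p'} {q'} {r'} refl refl refl = sym (trans (ℕₚ.*-distribˡ-+ D p' (q' + r')) (cong (D * p' +_) (ℕₚ.*-distribˡ-+ D q' r')))

-- There are n - 1 chains, whereas the skeleton counts are written in terms of n - 2; splitting off
-- one exponent `x` makes n - 2 the length of `γ`.
not-schurPositive : ∀ x γ k a → k ≡ 5 + a → 7 + a ≤ 2 * (2 + length γ) → HookContents (x ∷ γ) k →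
                    ¬ SchurPositive (chainProduct (suc (suc (length γ)) + k) (suc (suc (length γ))))
not-schurPositive x γ k a k≡ large γ≡ positive = skeleton-counts-contradict (length γ) a (references (x ∷ γ) k) (λ b₀ b₁ b₂ → chromCoeff (inc (chainProduct (suc (suc (length γ)) + k) (suc (suc (length γ))))) (b₀ ∷ b₁ ∷ b₂ ∷ x ∷ γ))
  (references-positive (x ∷ γ) k γ≡) large
  (λ b₀ b₁ b₂ Σb → chromCoeff-skeletons (x ∷ γ) k {tri (suc b₀) (suc b₁) (suc b₂)} (trans Σb (cong suc (sym k≡))) (card-skeletons₃ (length γ) b₀ b₁ b₂))
  (λ b₀ b₂ Σb → chromCoeff-skeletons (x ∷ γ) k {tri (suc b₀) 0 (suc b₂)} (trans Σb (cong suc (sym k≡))) (card-skeletons₂ (length γ) b₀ b₂))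
  (λ a → chromCoeff-≤ {G = inc (chainProduct (suc (suc (length γ)) + k) (suc (suc (length γ))))} positive a (x ∷ γ))

hook-contents-correct : ∀ m k → HookContents (hook-contents m k) k
hook-contents-correct m k = transport (hook-contents m k) (Listₚ.length-tabulate f) (Listₚ.lookup-tabulate f)
  where
  f : Fin m → ℕ
  f i = occ (chain i) (hook-colouring m k)
  transport : ∀ γ (eq : length γ ≡ m) → (∀ i → lookup γ (cast (sym eq) i) ≡ f i) → HookContents γ k
  transport γ refl h i = trans (cong (lookup γ) (sym (Finₚ.cast-is-id refl i))) (h i)

length-hook-contents : ∀ m k → length (hook-contents m k) ≡ m
length-hook-contents m k = Listₚ.length-tabulate (λ i → occ (chain i) (hook-colouring m k))


not-schurPositive-tail : ∀ x γ m k a → length γ ≡ m → k ≡ 5 + a → 7 + a ≤ 2 * (2 + length γ) → HookContents (x ∷ γ) k → ¬ SchurPositive (chainProduct (suc (suc m) + k) (suc (suc m)))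
not-schurPositive-tail x γ m k a refl p q r = not-schurPositive x γ k a p q r

not-schurPositive-contents : ∀ m k a → k ≡ 5 + a → 7 + a ≤ 2 * (2 + m) → ∀ γ → length γ ≡ suc m → HookContents γ k → ¬ SchurPositive (chainProduct (suc (suc m) + k) (suc (suc m)))
not-schurPositive-contents m k a k≡ large (x ∷ γ) eq h = not-schurPositive-tail x γ m k a (ℕₚ.suc-injective eq) k≡ (subst (λ m → 7 + a ≤ 2 * (2 + m)) (sym (ℕₚ.suc-injective eq)) large) h

not-schurPositive-hook : ∀ m k a → k ≡ 5 + a → k + 2 ≤ 2 * (2 + m) → ¬ SchurPositive (chainProduct (suc (suc m) + k) (suc (suc m)))
not-schurPositive-hook m k a k≡ large = not-schurPositive-contents m k a k≡ (subst (_≤ 2 * (2 + m)) (trans (ℕₚ.+-comm k 2) (cong (2 +_) k≡)) large)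
  (hook-contents (suc m) k) (length-hook-contents (suc m) k) (hook-contents-correct (suc m) k)

theorem4p1 : (n k : ℕ) → 5 ≤ k → k + 2 ≤ 2 * n →
    ¬ SchurPositive (chainProduct (n + k) n)
theorem4p1 0 k 5≤k large _ = ℕₚ.<⇒≱ (ℕₚ.≤-trans (s≤s z≤n) 5≤k) (ℕₚ.≤-trans (ℕₚ.m≤m+n k 2) large)
theorem4p1 1 k 5≤k large _ = ℕₚ.<⇒≱ (ℕₚ.≤-trans (s≤s (s≤s (s≤s z≤n))) 5≤k) (ℕₚ.≤-trans (ℕₚ.m≤m+n k 2) large)
theorem4p1 (suc (suc m)) k 5≤k large = not-schurPositive-hook m k (k ∸ 5) (sym (ℕₚ.m+[n∸m]≡n 5≤k)) large
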